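{- Let $R$ be a commutative valuation ring with infinite residue field $k$, and $f:A=\prod_{i\in I} A_i\to B$ a surjective homomorphism from a direct product of $R$-algebras to an $R$-algebra $B$ which is torsion-free as an $R$-module. Write $\mathrm{rk}_R(B)$ for the rank of $B$ as an $R$-module, i.e., the common cardinality of all maximal $R$-linearly independent subsets of $B$. Suppose that either (i) $\mathrm{rk}_R(B)<\mathrm{card}(k)$, or (ii) $\mathrm{rk}_R(B)<2^{\aleph_0}$. Then the composite homomorphism $A\to B\to B/Z(B)$ (of $f$ with the quotient map) can be factored $$A\ \to\ A/\mathcal{U}_0\times\dots\times A/\mathcal{U}_{n-1}\ \to\ B/Z(B)$$ for some $n\in\omega$, where the first map is the product of the quotient maps and the $\mathcal{U}_m$ are ultrafilters on $I$, which are $\mathrm{card}(k)^+$-complete in case (i), and countably complete in case (ii). Thus, if $\mathrm{card}(I)$ is less than every measurable cardinal $>\mathrm{card}(k)$ in case (i), or less than every uncountable measurable cardinal in case (ii), then the composite $A\to B\to B/Z(B)$ factors through the projection of $A$ to the product of finitely many of the $A_i$, and $f:A\to B$ can be written as the sum of a homomorphism $f_1:A\to B$ that factors through the projection of $A$ to the product of these finitely many $A_i$, and a homomorphism $f_0:A\to Z(B)$.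
   Context: For a commutative (associative unital) ring $R$, an $R$-algebra means an $R$-module $A$ with an $R$-bilinear multiplication $A\times A\to A$, not assumed associative, commutative, or unital; homomorphisms are $R$-algebra homomorphisms. For an algebra $B$, the total annihilator ideal is $Z(B)=\{x\in B\mid xB=Bx=\{0\}\}$. For a filter $\mathcal{U}$ on $I$, $A/\mathcal{U}$ denotes the reduced product: the quotient of $\prod_{i\in I} A_i$ by the relation $(a_i)\sim(b_i)$ iff $\{i\mid a_i=b_i\}\in\mathcal{U}$, with induced algebra structure. An ultrafilter on $I$ is a maximal proper filter of subsets of $I$; it is principal if it has the form $\{J\subseteq I\mid i_0\in J\}$. A filter is $\kappa$-complete ($\kappa$ an infinite cardinal) if it is closed under intersections of families of $<\kappa$ members, and countably complete if it is $\aleph_1$-complete. $\mathrm{card}(k)^+$ is the successor cardinal of $\mathrm{card}(k)$. An infinite cardinal $\mu$ is measurable if there exists a nonprincipal $\mu$-complete ultrafilter on $\mu$ (so $\aleph_0$ counts as measurable). A field is regarded as a valuation ring with trivial value group. -}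

module Defs where

open import Algebra.Bundles using (AbelianGroup; CommutativeRing)
open import Algebra.Core using (Op₂)
open import Algebra.Definitions using (Congruent₂)
open import Algebra.Module.Bundles using (Module)
open import Algebra.Module.Morphism.Structures using (module ModuleMorphisms)
open import Algebra.Module.Structures using (IsLeftModule)
open import Algebra.Module.Structures.Biased using (module IsModuleFromLeft)
import Algebra.Module.Morphism.Construct.Composition as ModuleComposition
import Algebra.Properties.AbelianGroup as AbelianGroupProperties
import Algebra.Properties.CommutativeSemigroup as CommutativeSemigroupProperties
import Algebra.Properties.Monoid.Sum as MonoidSum
import Algebra.Properties.Ring as RingProperties
import Algebra.Properties.Semiring.Divisibility as SemiringDivisibility
open import Axiom.ExcludedMiddle using (ExcludedMiddle)
open import Data.Bool.Base using (Bool)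
open import Data.Fin.Base using (Fin)
open import Data.Nat.Base using (ℕ)
open import Data.Product using (Σ; Σ-syntax; ∃-syntax; _×_; _,_; proj₁; proj₂)
open import Data.Sum.Base using (_⊎_; inj₁; inj₂)
open import Function.Base using (_∘_)
open import Function.Bundles using (Func; Injection; Surjection; Bijection; _⇔_)
open import Function.Definitions using (Injective; Surjective)
open import Level using (Level; _⊔_; suc)
open import Agda.Primitive using (Setω)
open import Relation.Binary.Bundles using (Setoid)
open import Relation.Binary.Core using (Rel)
import Relation.Binary.Construct.On as On
open import Relation.Binary.Definitions using (_Respects_)
open import Relation.Binary.PropositionalEquality.Core using (_≡_)
open import Relation.Binary.PropositionalEquality using (setoid; _→-setoid_)
import Relation.Binary.Reasoning.Setoid as SetoidReasoning
open import Relation.Binary.Structures using (IsEquivalence)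
open import Relation.Nullary.Negation.Core using (¬_)
open import Relation.Unary using (Pred; _∈_; _∉_; _⊆_; _∩_; ⋂)
open import Relation.Unary.Polymorphic using (U; ∅)

private
  variable
    a b c d i j ℓ ℓ₁ ℓ₂ ℓ₃ r : Level

-- The principles of the ZFC metatheory that are missing here.  Sets are rendered
-- as setoids, so choice has to produce a section that respects the equalities.

record Classical : Setω where
  field
    em     : ∀ {a} → ExcludedMiddle a
    choice : ∀ {a ℓ₁ b ℓ₂} {S : Setoid a ℓ₁} {T : Setoid b ℓ₂} (f : Surjection S T) →
             Σ[ g ∈ Func T S ]
               (∀ y → Setoid._≈_ T (Surjection.to f (Func.to g y)) y)

infix 4 _≼_ _≺_

_≼_ : Setoid a ℓ₁ → Setoid b ℓ₂ → Set _
S ≼ T = Injection S T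

_≺_ : Setoid a ℓ₁ → Setoid b ℓ₂ → Set _
S ≺ T = S ≼ T × ¬ (T ≼ S)

Infinite : Setoid a ℓ → Set _
Infinite S = ¬ (∃[ n ] Bijection S (setoid (Fin n)))

ℵ₀ : Setoid _ _
ℵ₀ = setoid ℕ

2^ℵ₀ : Setoid _ _
2^ℵ₀ = ℕ →-setoid Bool

subsetoid : (S : Setoid a ℓ) → Pred (Setoid.Carrier S) r → Setoid _ _
subsetoid S P = On.setoid S (proj₁ {B = P})

record Filter (I : Set i) : Set (suc i) where
  field
    members : Pred (Pred I i) i
    full    : U ∈ members
    ∩-mem   : ∀ {X Y} → X ∈ members → Y ∈ members → (X ∩ Y) ∈ members
    ⊆-mem   : ∀ {X Y} → X ⊆ Y → X ∈ members → Y ∈ members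

open Filter using (members)

Proper : {I : Set i} → Filter I → Set _
Proper F = ∅ ∉ members F

record IsUltrafilter {I : Set i} (F : Filter I) : Set (suc i) where
  field
    proper  : Proper F
    maximal : ∀ G → Proper G → members F ⊆ members G → members G ⊆ members F

Principal : {I : Set i} → Filter I → Set _
Principal {I = I} F = Σ[ i₀ ∈ I ] ∀ J → J ∈ members F ⇔ i₀ ∈ J

ClosedUnder⋂ : {I : Set i} → (Set i → Set r) → Filter I → Set _
ClosedUnder⋂ {i = i} Small F =
  (J : Set i) → Small J → (X : J → Pred _ i) → (∀ j → X j ∈ members F) →
  ⋂ J X ∈ members F

Complete : {I : Set i} → Setoid a ℓ → Filter I → Set _
Complete κ = ClosedUnder⋂ (λ J → setoid J ≺ κ)

-- κ⁺-completeness, where κ⁺ is the successor cardinal of κ: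
-- having fewer than κ⁺ members means having at most κ members.

SuccComplete : {I : Set i} → Setoid a ℓ → Filter I → Set _
SuccComplete κ = ClosedUnder⋂ (λ J → setoid J ≼ κ)

CountablyComplete : {I : Set i} → Filter I → Set _
CountablyComplete = SuccComplete ℵ₀

-- ℵ₀ counts as measurable.

record Measurable (M : Set i) : Set (suc i) where
  field
    infinite      : Infinite (setoid M)
    filter        : Filter M
    isUltrafilter : IsUltrafilter filter
    nonprincipal  : ¬ Principal filter
    complete      : Complete (setoid M) filter

module Modulo (G : AbelianGroup a ℓ) (N : Pred (AbelianGroup.Carrier G) r)
  (N-resp : N Respects AbelianGroup._≈_ G)
  (N-ε    : AbelianGroup.ε G ∈ N)
  (N-∙    : ∀ {x y} → x ∈ N → y ∈ N → AbelianGroup._∙_ G x y ∈ N)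
  (N-⁻¹   : ∀ {x} → x ∈ N → AbelianGroup._⁻¹ G x ∈ N)
  where

  open AbelianGroup G
  open AbelianGroupProperties G
    using (⁻¹-anti-homo‿-; ⁻¹-∙-comm; x≈y⇒x∙y⁻¹≈ε)
  open CommutativeSemigroupProperties commutativeSemigroup using (interchange)
  open SetoidReasoning (AbelianGroup.setoid G)

  infix 4 _∼_

  _∼_ : Rel Carrier r
  x ∼ y = (x - y) ∈ N

  ≈⇒∼ : ∀ {x y} → x ≈ y → x ∼ y
  ≈⇒∼ x≈y = N-resp (sym (x≈y⇒x∙y⁻¹≈ε x≈y)) N-ε

  ∼-sym : ∀ {x y} → x ∼ y → y ∼ x
  ∼-sym {x} {y} p = N-resp (⁻¹-anti-homo‿- x y) (N-⁻¹ p)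

  ∼-trans : ∀ {x y z} → x ∼ y → y ∼ z → x ∼ z
  ∼-trans {x} {y} {z} p q = N-resp eq (N-∙ p q)
    where
    eq : (x - y) ∙ (y - z) ≈ x - z
    eq = begin
      (x - y) ∙ (y - z)      ≈⟨ assoc x (y ⁻¹) (y - z) ⟩
      x ∙ (y ⁻¹ ∙ (y - z))   ≈⟨ ∙-congˡ (assoc (y ⁻¹) y (z ⁻¹)) ⟨
      x ∙ ((y ⁻¹ ∙ y) - z)   ≈⟨ ∙-congˡ (∙-congʳ (inverseˡ y)) ⟩
      x ∙ (ε - z)            ≈⟨ ∙-congˡ (identityˡ (z ⁻¹)) ⟩
      x - z                  ∎

  ∼-isEquivalence : IsEquivalence _∼_
  ∼-isEquivalence = record { refl = ≈⇒∼ refl ; sym = ∼-sym ; trans = ∼-trans }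

  ∙-cong-∼ : Congruent₂ _∼_ _∙_
  ∙-cong-∼ {x} {y} {u} {v} p q = N-resp eq (N-∙ p q)
    where
    eq : (x - y) ∙ (u - v) ≈ (x ∙ u) - (y ∙ v)
    eq = begin
      (x - y) ∙ (u - v)          ≈⟨ interchange x (y ⁻¹) u (v ⁻¹) ⟩
      (x ∙ u) ∙ (y ⁻¹ ∙ v ⁻¹)    ≈⟨ ∙-congˡ (⁻¹-∙-comm y v) ⟩
      (x ∙ u) - (y ∙ v)          ∎

  ⁻¹-cong-∼ : ∀ {x y} → x ∼ y → x ⁻¹ ∼ y ⁻¹
  ⁻¹-cong-∼ {x} {y} p = N-resp (sym (⁻¹-∙-comm x (y ⁻¹))) (N-⁻¹ p)

record IsValuationRing (R : CommutativeRing c ℓ) : Set (c ⊔ ℓ) where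
  open CommutativeRing R
  open SemiringDivisibility semiring using (_∣_)
  field
    1≉0      : ¬ (1# ≈ 0#)
    integral : ∀ x y → x * y ≈ 0# → x ≈ 0# ⊎ y ≈ 0#
    ∣-total  : ∀ x y → x ∣ y ⊎ y ∣ x

module ResidueField (R : CommutativeRing c ℓ) (isValuationRing : IsValuationRing R) where
  open CommutativeRing R
  open SemiringDivisibility semiring
    using (_∣_; _,_; ∣-refl; ∣-trans; ∣-respˡ; x∣yx)
  open IsValuationRing isValuationRing
  open RingProperties ring
    using (-1*x≈-x; x[y-z]≈xy-xz; [y-z]x≈yx-zx)

  -- The nonunits form the maximal ideal of a valuation ring.
  𝔪 : Pred Carrier _
  𝔪 x = ¬ (x ∣ 1#)

  𝔪-resp : 𝔪 Respects _≈_
  𝔪-resp x≈y x∈𝔪 y∣1 = x∈𝔪 (∣-respˡ (sym x≈y) y∣1)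

  𝔪-* : ∀ y {x} → x ∈ 𝔪 → (y * x) ∈ 𝔪
  𝔪-* y {x} x∈𝔪 yx∣1 = x∈𝔪 (∣-trans (x∣yx x y) yx∣1)

  𝔪-0 : 0# ∈ 𝔪
  𝔪-0 (q , q0≈1) = 1≉0 (trans (sym q0≈1) (zeroʳ q))

  𝔪-neg : ∀ {x} → x ∈ 𝔪 → (- x) ∈ 𝔪
  𝔪-neg {x} x∈𝔪 = 𝔪-resp (-1*x≈-x x) (𝔪-* (- 1#) x∈𝔪)

  ∣-+ : ∀ {x y z} → x ∣ y → x ∣ z → x ∣ (y + z)
  ∣-+ {x} (p , px≈y) (q , qx≈z) = p + q , trans (distribʳ x p q) (+-cong px≈y qx≈z)

  𝔪-+ : ∀ {x y} → x ∈ 𝔪 → y ∈ 𝔪 → (x + y) ∈ 𝔪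
  𝔪-+ {x} {y} x∈𝔪 y∈𝔪 x+y∣1 with ∣-total x y
  ... | inj₁ x∣y = x∈𝔪 (∣-trans (∣-+ ∣-refl x∣y) x+y∣1)
  ... | inj₂ y∣x = y∈𝔪 (∣-trans (∣-+ y∣x ∣-refl) x+y∣1)

  open Modulo +-abelianGroup 𝔪 𝔪-resp 𝔪-0 𝔪-+ 𝔪-neg public

  *-cong-∼ : Congruent₂ _∼_ _*_
  *-cong-∼ {x} {y} {u} {v} p q = ∼-trans
    (𝔪-resp (x[y-z]≈xy-xz x u v) (𝔪-* x q))
    (𝔪-resp (trans (*-comm v (x - y)) ([y-z]x≈yx-zx v x y)) (𝔪-* v p))

  residueField : CommutativeRing _ _
  residueField = record
    { _≈_ = _∼_
    ; _+_ = _+_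
    ; _*_ = _*_
    ; -_  = -_
    ; 0#  = 0#
    ; 1#  = 1#
    ; isCommutativeRing = record
      { isRing = record
        { +-isAbelianGroup = record
          { isGroup = record
            { isMonoid = record
              { isSemigroup = record
                { isMagma = record { isEquivalence = ∼-isEquivalence ; ∙-cong = ∙-cong-∼ }
                ; assoc   = λ x y z → ≈⇒∼ (+-assoc x y z)
                }
              ; identity = (λ x → ≈⇒∼ (+-identityˡ x)) , (λ x → ≈⇒∼ (+-identityʳ x))
              }
            ; inverse = (λ x → ≈⇒∼ (-‿inverseˡ x)) , (λ x → ≈⇒∼ (-‿inverseʳ x))
            ; ⁻¹-cong = ⁻¹-cong-∼
            }
          ; comm = λ x y → ≈⇒∼ (+-comm x y)
          }
        ; *-cong     = *-cong-∼
        ; *-assoc    = λ x y z → ≈⇒∼ (*-assoc x y z)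
        ; *-identity = (λ x → ≈⇒∼ (*-identityˡ x)) , (λ x → ≈⇒∼ (*-identityʳ x))
        ; distrib    = (λ x y z → ≈⇒∼ (distribˡ x y z)) , (λ x y z → ≈⇒∼ (distribʳ x y z))
        }
      ; *-comm = λ x y → ≈⇒∼ (*-comm x y)
      }
    }

open ResidueField public using (residueField)

record RAlgebra (R : CommutativeRing c ℓ) a ℓ₁ : Set (c ⊔ ℓ ⊔ suc (a ⊔ ℓ₁)) where
  no-eta-equality
  infixl 7 _∙_
  field
    baseModule : Module R a ℓ₁

  open Module baseModule public

  field
    _∙_         : Op₂ Carrierᴹ
    ∙-cong      : Congruent₂ _≈ᴹ_ _∙_
    ∙-distribˡ  : ∀ x y z → x ∙ (y +ᴹ z) ≈ᴹ (x ∙ y) +ᴹ (x ∙ z)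
    ∙-distribʳ  : ∀ x y z → (y +ᴹ z) ∙ x ≈ᴹ (y ∙ x) +ᴹ (z ∙ x)
    *ₗ-∙-assocˡ : ∀ r x y → (r *ₗ x) ∙ y ≈ᴹ r *ₗ (x ∙ y)
    *ₗ-∙-assocʳ : ∀ r x y → x ∙ (r *ₗ y) ≈ᴹ r *ₗ (x ∙ y)

  open AbelianGroupProperties +ᴹ-abelianGroup public
    using () renaming (identityʳ-unique to +ᴹ-identityʳ-unique; inverseʳ-unique to +ᴹ-inverseʳ-unique)

  ∙-zeroʳ : ∀ x → x ∙ 0ᴹ ≈ᴹ 0ᴹ
  ∙-zeroʳ x = +ᴹ-identityʳ-unique _ _
    (≈ᴹ-trans (≈ᴹ-sym (∙-distribˡ x 0ᴹ 0ᴹ)) (∙-cong ≈ᴹ-refl (+ᴹ-identityˡ 0ᴹ)))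

  ∙-zeroˡ : ∀ x → 0ᴹ ∙ x ≈ᴹ 0ᴹ
  ∙-zeroˡ x = +ᴹ-identityʳ-unique _ _
    (≈ᴹ-trans (≈ᴹ-sym (∙-distribʳ x 0ᴹ 0ᴹ)) (∙-cong (+ᴹ-identityˡ 0ᴹ) ≈ᴹ-refl))

  ∙-negʳ : ∀ x y → x ∙ (-ᴹ y) ≈ᴹ -ᴹ (x ∙ y)
  ∙-negʳ x y = +ᴹ-inverseʳ-unique _ _
    (≈ᴹ-trans (≈ᴹ-sym (∙-distribˡ x y (-ᴹ y)))
      (≈ᴹ-trans (∙-cong ≈ᴹ-refl (-ᴹ‿inverseʳ y)) (∙-zeroʳ x)))

  ∙-negˡ : ∀ x y → (-ᴹ y) ∙ x ≈ᴹ -ᴹ (y ∙ x)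
  ∙-negˡ x y = +ᴹ-inverseʳ-unique _ _
    (≈ᴹ-trans (≈ᴹ-sym (∙-distribʳ x y (-ᴹ y)))
      (≈ᴹ-trans (∙-cong (-ᴹ‿inverseʳ y) ≈ᴹ-refl) (∙-zeroˡ x)))

  *ₗ-neg : ∀ r x → r *ₗ (-ᴹ x) ≈ᴹ -ᴹ (r *ₗ x)
  *ₗ-neg r x = +ᴹ-inverseʳ-unique _ _
    (≈ᴹ-trans (≈ᴹ-sym (*ₗ-distribˡ r x (-ᴹ x)))
      (≈ᴹ-trans (*ₗ-congˡ (-ᴹ‿inverseʳ x)) (*ₗ-zeroʳ r)))

private
  variable
    R : CommutativeRing c ℓ

record Hom {R : CommutativeRing c ℓ} (A : RAlgebra R a ℓ₁) (B : RAlgebra R b ℓ₂) :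
           Set (c ⊔ a ⊔ ℓ₁ ⊔ b ⊔ ℓ₂) where
  no-eta-equality
  private
    module A = RAlgebra A
    module B = RAlgebra B
  open ModuleMorphisms A.rawModule B.rawModule using (IsModuleHomomorphism)
  field
    ⟦_⟧                  : A.Carrierᴹ → B.Carrierᴹ
    isModuleHomomorphism : IsModuleHomomorphism ⟦_⟧
    ∙-homo               : ∀ x y → ⟦ x A.∙ y ⟧ B.≈ᴹ ⟦ x ⟧ B.∙ ⟦ y ⟧
  open IsModuleHomomorphism isModuleHomomorphism public

module _ {R : CommutativeRing c ℓ} {A : RAlgebra R a ℓ₁} {B : RAlgebra R b ℓ₂} where
  private
    module A = RAlgebra A
    module B = RAlgebra B

  mkHom : (f : A.Carrierᴹ → B.Carrierᴹ) →
          (∀ {x y} → x A.≈ᴹ y → f x B.≈ᴹ f y) →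
          (∀ x y → f (x A.+ᴹ y) B.≈ᴹ f x B.+ᴹ f y) →
          (∀ r x → f (r A.*ₗ x) B.≈ᴹ r B.*ₗ f x) →
          (∀ x y → f (x A.∙ y) B.≈ᴹ f x B.∙ f y) →
          Hom A B
  mkHom f f-cong f-+ f-*ₗ f-∙ = record
    { ⟦_⟧ = f
    ; isModuleHomomorphism = record
      { isBimoduleHomomorphism = record
        { +ᴹ-isGroupHomomorphism = record
          { isMonoidHomomorphism = record
            { isMagmaHomomorphism = record
              { isRelHomomorphism = record { cong = f-cong }
              ; homo = f-+
              }
            ; ε-homo = f-0
            }
          ; ⁻¹-homo = λ x → B.+ᴹ-inverseʳ-unique _ _
              (B.≈ᴹ-trans (B.≈ᴹ-sym (f-+ x (A.-ᴹ x)))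
                (B.≈ᴹ-trans (f-cong (A.-ᴹ‿inverseʳ x)) f-0))
          }
        ; *ₗ-homo = f-*ₗ
        ; *ᵣ-homo = λ r x → B.≈ᴹ-trans (f-cong (A.≈ᴹ-sym (A.*ₗ-*ᵣ-coincident r x)))
            (B.≈ᴹ-trans (f-*ₗ r x) (B.*ₗ-*ᵣ-coincident r (f x)))
        }
      }
    ; ∙-homo = f-∙
    }
    where
    f-0 : f A.0ᴹ B.≈ᴹ B.0ᴹ
    f-0 = B.+ᴹ-identityʳ-unique _ _
      (B.≈ᴹ-trans (B.≈ᴹ-sym (f-+ A.0ᴹ A.0ᴹ)) (f-cong (A.+ᴹ-identityˡ A.0ᴹ)))

  infix 4 _≗ₕ_

  _≗ₕ_ : Rel (Hom A B) _
  f ≗ₕ g = ∀ x → Hom.⟦ f ⟧ x B.≈ᴹ Hom.⟦ g ⟧ x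

  IsSurjective : Hom A B → Set _
  IsSurjective f = Surjective A._≈ᴹ_ B._≈ᴹ_ Hom.⟦ f ⟧

infixr 9 _∘ₕ_

_∘ₕ_ : {A : RAlgebra R a ℓ₁} {B : RAlgebra R b ℓ₂} {C : RAlgebra R d ℓ₃} →
       Hom B C → Hom A B → Hom A C
_∘ₕ_ {C = C} g f = record
  { ⟦_⟧                  = Hom.⟦ g ⟧ ∘ Hom.⟦ f ⟧
  ; isModuleHomomorphism = ModuleComposition.isModuleHomomorphism C.≈ᴹ-trans
      (Hom.isModuleHomomorphism f) (Hom.isModuleHomomorphism g)
  ; ∙-homo               = λ x y →
      C.≈ᴹ-trans (Hom.⟦⟧-cong g (Hom.∙-homo f x y)) (Hom.∙-homo g _ _)
  }
  where module C = RAlgebra C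

module _ {R : CommutativeRing c ℓ} {I : Set i} (A : I → RAlgebra R a ℓ₁) where
  private
    module A k = RAlgebra (A k)

  private
    Π-isLeftModule : IsLeftModule {M = ∀ k → A.Carrierᴹ k} (CommutativeRing.ring R)
      (λ x y → ∀ k → A._≈ᴹ_ k (x k) (y k))
      (λ x y k → A._+ᴹ_ k (x k) (y k))
      A.0ᴹ
      (λ x k → A.-ᴹ_ k (x k))
      (λ r x k → A._*ₗ_ k r (x k))
    Π-isLeftModule = record
      { isLeftSemimodule = record
        { +ᴹ-isCommutativeMonoid = record
          { isMonoid = record
            { isSemigroup = record
              { isMagma = record
                { isEquivalence = record
                  { refl  = λ k → A.≈ᴹ-refl k
                  ; sym   = λ p k → A.≈ᴹ-sym k (p k)
                  ; trans = λ p q k → A.≈ᴹ-trans k (p k) (q k)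
                  }
                ; ∙-cong = λ p q k → A.+ᴹ-cong k (p k) (q k)
                }
              ; assoc = λ x y z k → A.+ᴹ-assoc k (x k) (y k) (z k)
              }
            ; identity = (λ x k → A.+ᴹ-identityˡ k (x k)) , (λ x k → A.+ᴹ-identityʳ k (x k))
            }
          ; comm = λ x y k → A.+ᴹ-comm k (x k) (y k)
          }
        ; isPreleftSemimodule = record
          { *ₗ-cong      = λ p q k → A.*ₗ-cong k p (q k)
          ; *ₗ-zeroˡ     = λ x k → A.*ₗ-zeroˡ k (x k)
          ; *ₗ-distribʳ  = λ x r s k → A.*ₗ-distribʳ k (x k) r s
          ; *ₗ-identityˡ = λ x k → A.*ₗ-identityˡ k (x k)
          ; *ₗ-assoc     = λ r s x k → A.*ₗ-assoc k r s (x k)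
          ; *ₗ-zeroʳ     = λ r k → A.*ₗ-zeroʳ k r
          ; *ₗ-distribˡ  = λ r x y k → A.*ₗ-distribˡ k r (x k) (y k)
          }
        }
      ; -ᴹ‿cong    = λ p k → A.-ᴹ‿cong k (p k)
      ; -ᴹ‿inverse = (λ x k → A.-ᴹ‿inverseˡ k (x k)) , (λ x k → A.-ᴹ‿inverseʳ k (x k))
      }

  Π : RAlgebra R (i ⊔ a) (i ⊔ ℓ₁)
  Π .RAlgebra.baseModule = record
    { isModule = IsModuleFromLeft.isModule {commutativeRing = R}
        (record { isLeftModule = Π-isLeftModule }) }
  Π .RAlgebra._∙_         = λ x y k → A._∙_ k (x k) (y k)
  Π .RAlgebra.∙-cong      = λ p q k → A.∙-cong k (p k) (q k)
  Π .RAlgebra.∙-distribˡ  = λ x y z k → A.∙-distribˡ k (x k) (y k) (z k)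
  Π .RAlgebra.∙-distribʳ  = λ x y z k → A.∙-distribʳ k (x k) (y k) (z k)
  Π .RAlgebra.*ₗ-∙-assocˡ = λ r x y k → A.*ₗ-∙-assocˡ k r (x k) (y k)
  Π .RAlgebra.*ₗ-∙-assocʳ = λ r x y k → A.*ₗ-∙-assocʳ k r (x k) (y k)

module _ {R : CommutativeRing c ℓ} {I : Set i} {A : I → RAlgebra R a ℓ₁} where
  private
    module A k = RAlgebra (A k)

  project : {J : Set j} (s : J → I) → Hom (Π A) (Π (A ∘ s))
  project s = mkHom (λ x k → x (s k)) (λ p k → p (s k))
    (λ _ _ k → A.≈ᴹ-refl (s k)) (λ _ _ k → A.≈ᴹ-refl (s k)) (λ _ _ k → A.≈ᴹ-refl (s k))

  ⟨_⟩ : {B : RAlgebra R b ℓ₂} → (∀ k → Hom B (A k)) → Hom B (Π A)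
  ⟨ f ⟩ = mkHom (λ x k → F.⟦_⟧ k x) (λ p k → F.⟦⟧-cong k p)
    (λ x y k → F.+ᴹ-homo k x y) (λ r x k → F.*ₗ-homo k r x) (λ x y k → F.∙-homo k x y)
    where module F k = Hom (f k)

record Congruence {R : CommutativeRing c ℓ} (A : RAlgebra R a ℓ₁) r :
                  Set (c ⊔ a ⊔ ℓ₁ ⊔ suc r) where
  open RAlgebra A
  infix 4 _∼_
  field
    _∼_           : Rel Carrierᴹ r
    isEquivalence : IsEquivalence _∼_
    ≈⇒∼           : ∀ {x y} → x ≈ᴹ y → x ∼ y
    +-cong-∼      : Congruent₂ _∼_ _+ᴹ_
    neg-cong-∼      : ∀ {x y} → x ∼ y → (-ᴹ x) ∼ (-ᴹ y)
    *ₗ-cong-∼     : ∀ r {x y} → x ∼ y → (r *ₗ x) ∼ (r *ₗ y)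
    ∙-cong-∼      : Congruent₂ _∼_ _∙_

module _ {R : CommutativeRing c ℓ} (A : RAlgebra R a ℓ₁) (E : Congruence A r) where
  open RAlgebra A
  open Congruence E

  private
    quotient-isLeftModule : IsLeftModule (CommutativeRing.ring R) _∼_ _+ᴹ_ 0ᴹ -ᴹ_ _*ₗ_
    quotient-isLeftModule = record
      { isLeftSemimodule = record
        { +ᴹ-isCommutativeMonoid = record
          { isMonoid = record
            { isSemigroup = record
              { isMagma = record { isEquivalence = isEquivalence ; ∙-cong = +-cong-∼ }
              ; assoc   = λ x y z → ≈⇒∼ (+ᴹ-assoc x y z)
              }
            ; identity = (λ x → ≈⇒∼ (+ᴹ-identityˡ x)) , (λ x → ≈⇒∼ (+ᴹ-identityʳ x))
            }
          ; comm = λ x y → ≈⇒∼ (+ᴹ-comm x y)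
          }
        ; isPreleftSemimodule = record
          { *ₗ-cong      = λ {_} {s} p q →
              IsEquivalence.trans isEquivalence (≈⇒∼ (*ₗ-congʳ p)) (*ₗ-cong-∼ s q)
          ; *ₗ-zeroˡ     = λ x → ≈⇒∼ (*ₗ-zeroˡ x)
          ; *ₗ-distribʳ  = λ x r s → ≈⇒∼ (*ₗ-distribʳ x r s)
          ; *ₗ-identityˡ = λ x → ≈⇒∼ (*ₗ-identityˡ x)
          ; *ₗ-assoc     = λ r s x → ≈⇒∼ (*ₗ-assoc r s x)
          ; *ₗ-zeroʳ     = λ r → ≈⇒∼ (*ₗ-zeroʳ r)
          ; *ₗ-distribˡ  = λ r x y → ≈⇒∼ (*ₗ-distribˡ r x y)
          }
        }
      ; -ᴹ‿cong    = neg-cong-∼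
      ; -ᴹ‿inverse = (λ x → ≈⇒∼ (-ᴹ‿inverseˡ x)) , (λ x → ≈⇒∼ (-ᴹ‿inverseʳ x))
      }

  quotient : RAlgebra R a r
  quotient .RAlgebra.baseModule = record
    { isModule = IsModuleFromLeft.isModule {commutativeRing = R}
        (record { isLeftModule = quotient-isLeftModule }) }
  quotient .RAlgebra._∙_         = _∙_
  quotient .RAlgebra.∙-cong      = ∙-cong-∼
  quotient .RAlgebra.∙-distribˡ  = λ x y z → ≈⇒∼ (∙-distribˡ x y z)
  quotient .RAlgebra.∙-distribʳ  = λ x y z → ≈⇒∼ (∙-distribʳ x y z)
  quotient .RAlgebra.*ₗ-∙-assocˡ = λ r x y → ≈⇒∼ (*ₗ-∙-assocˡ r x y)
  quotient .RAlgebra.*ₗ-∙-assocʳ = λ r x y → ≈⇒∼ (*ₗ-∙-assocʳ r x y)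

  quotientMap : Hom A quotient
  quotientMap = mkHom (λ x → x) ≈⇒∼
    (λ _ _ → ≈⇒∼ ≈ᴹ-refl) (λ _ _ → ≈⇒∼ ≈ᴹ-refl) (λ _ _ → ≈⇒∼ ≈ᴹ-refl)

module _ {R : CommutativeRing c ℓ} {I : Set i} (A : I → RAlgebra R a i) (F : Filter I) where
  private
    module A k = RAlgebra (A k)
  open Filter F hiding (members)

  filterCongruence : Congruence (Π A) i
  filterCongruence = record
    { _∼_           = λ x y → (λ k → A._≈ᴹ_ k (x k) (y k)) ∈ members F
    ; isEquivalence = record
      { refl  = ⊆-mem (λ {k} _ → A.≈ᴹ-refl k) full
      ; sym   = ⊆-mem (λ {k} → A.≈ᴹ-sym k)
      ; trans = λ p q → ⊆-mem (λ {k} (u , v) → A.≈ᴹ-trans k u v) (∩-mem p q)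
      }
    ; ≈⇒∼           = λ p → ⊆-mem (λ {k} _ → p k) full
    ; +-cong-∼      = λ p q → ⊆-mem (λ {k} (u , v) → A.+ᴹ-cong k u v) (∩-mem p q)
    ; neg-cong-∼      = ⊆-mem (λ {k} → A.-ᴹ‿cong k)
    ; *ₗ-cong-∼     = λ r → ⊆-mem (λ {k} → A.*ₗ-congˡ k)
    ; ∙-cong-∼      = λ p q → ⊆-mem (λ {k} (u , v) → A.∙-cong k u v) (∩-mem p q)
    }

  reducedProduct : RAlgebra R (i ⊔ a) i
  reducedProduct = quotient (Π A) filterCongruence

  reduce : Hom (Π A) reducedProduct
  reduce = quotientMap (Π A) filterCongruence

module _ {R : CommutativeRing c ℓ} (B : RAlgebra R b ℓ₁) where
  open RAlgebra B

  TotalAnnihilator : Pred Carrierᴹ (b ⊔ ℓ₁)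
  TotalAnnihilator x = ∀ y → x ∙ y ≈ᴹ 0ᴹ × y ∙ x ≈ᴹ 0ᴹ

  private
    Z-resp : TotalAnnihilator Respects _≈ᴹ_
    Z-resp x≈x′ z y =
      ≈ᴹ-trans (∙-cong (≈ᴹ-sym x≈x′) ≈ᴹ-refl) (proj₁ (z y)) ,
      ≈ᴹ-trans (∙-cong ≈ᴹ-refl (≈ᴹ-sym x≈x′)) (proj₂ (z y))

    Z-0 : 0ᴹ ∈ TotalAnnihilator
    Z-0 y = ∙-zeroˡ y , ∙-zeroʳ y

    Z-+ : ∀ {x x′} → x ∈ TotalAnnihilator → x′ ∈ TotalAnnihilator →
          (x +ᴹ x′) ∈ TotalAnnihilator
    Z-+ z z′ y =
      ≈ᴹ-trans (∙-distribʳ y _ _)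
        (≈ᴹ-trans (+ᴹ-cong (proj₁ (z y)) (proj₁ (z′ y))) (+ᴹ-identityˡ 0ᴹ)) ,
      ≈ᴹ-trans (∙-distribˡ y _ _)
        (≈ᴹ-trans (+ᴹ-cong (proj₂ (z y)) (proj₂ (z′ y))) (+ᴹ-identityˡ 0ᴹ))

    Z-*ₗ : ∀ r {x} → x ∈ TotalAnnihilator → (r *ₗ x) ∈ TotalAnnihilator
    Z-*ₗ r z y =
      ≈ᴹ-trans (*ₗ-∙-assocˡ r _ y) (≈ᴹ-trans (*ₗ-congˡ (proj₁ (z y))) (*ₗ-zeroʳ r)) ,
      ≈ᴹ-trans (*ₗ-∙-assocʳ r y _) (≈ᴹ-trans (*ₗ-congˡ (proj₂ (z y))) (*ₗ-zeroʳ r))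

    -0≈0 : -ᴹ 0ᴹ ≈ᴹ 0ᴹ
    -0≈0 = ≈ᴹ-sym (+ᴹ-inverseʳ-unique 0ᴹ 0ᴹ (+ᴹ-identityˡ 0ᴹ))

    Z-neg : ∀ {x} → x ∈ TotalAnnihilator → (-ᴹ x) ∈ TotalAnnihilator
    Z-neg z y =
      ≈ᴹ-trans (∙-negˡ y _) (≈ᴹ-trans (-ᴹ‿cong (proj₁ (z y))) -0≈0) ,
      ≈ᴹ-trans (∙-negʳ y _) (≈ᴹ-trans (-ᴹ‿cong (proj₂ (z y))) -0≈0)

    Z-∙ : ∀ {x} w → x ∈ TotalAnnihilator → (x ∙ w) ∈ TotalAnnihilator
    Z-∙ w z = Z-resp (≈ᴹ-sym (proj₁ (z w))) Z-0

    open Modulo +ᴹ-abelianGroup TotalAnnihilator Z-resp Z-0 Z-+ Z-neg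

    ∙-congruent : Congruent₂ _∼_ _∙_
    ∙-congruent {x} {x′} {y} {y′} p q = ≈⇒∼ (≈ᴹ-trans xy≈x′y x′y≈x′y′)
      where
      open AbelianGroupProperties +ᴹ-abelianGroup using (x∙y⁻¹≈ε⇒x≈y)
      xy≈x′y : x ∙ y ≈ᴹ x′ ∙ y
      xy≈x′y = x∙y⁻¹≈ε⇒x≈y _ _
        (≈ᴹ-trans (+ᴹ-cong ≈ᴹ-refl (≈ᴹ-sym (∙-negˡ y x′)))
          (≈ᴹ-trans (≈ᴹ-sym (∙-distribʳ y x (-ᴹ x′))) (proj₁ (p y))))
      x′y≈x′y′ : x′ ∙ y ≈ᴹ x′ ∙ y′
      x′y≈x′y′ = x∙y⁻¹≈ε⇒x≈y _ _
        (≈ᴹ-trans (+ᴹ-cong ≈ᴹ-refl (≈ᴹ-sym (∙-negʳ x′ y′)))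
          (≈ᴹ-trans (≈ᴹ-sym (∙-distribˡ x′ y (-ᴹ y′))) (proj₂ (q x′))))

  annihilatorCongruence : Congruence B (b ⊔ ℓ₁)
  annihilatorCongruence = record
    { _∼_           = λ x y → (x +ᴹ (-ᴹ y)) ∈ TotalAnnihilator
    ; isEquivalence = ∼-isEquivalence
    ; ≈⇒∼           = ≈⇒∼
    ; +-cong-∼      = ∙-cong-∼
    ; neg-cong-∼      = ⁻¹-cong-∼
    ; *ₗ-cong-∼     = λ r {x} {y} p → Z-resp
        (≈ᴹ-trans (*ₗ-distribˡ r x (-ᴹ y)) (+ᴹ-cong ≈ᴹ-refl (*ₗ-neg r y))) (Z-*ₗ r p)
    ; ∙-cong-∼      = ∙-congruent
    }

  private
    Z-isLeftModule : IsLeftModule {M = Σ Carrierᴹ TotalAnnihilator} (CommutativeRing.ring R)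
      (λ x y → proj₁ x ≈ᴹ proj₁ y)
      (λ (x , p) (y , q) → x +ᴹ y , Z-+ p q)
      (0ᴹ , Z-0)
      (λ (x , p) → -ᴹ x , Z-neg p)
      (λ r (x , p) → r *ₗ x , Z-*ₗ r p)
    Z-isLeftModule = record
      { isLeftSemimodule = record
        { +ᴹ-isCommutativeMonoid = record
          { isMonoid = record
            { isSemigroup = record
              { isMagma = record
                { isEquivalence = On.isEquivalence proj₁ ≈ᴹ-isEquivalence
                ; ∙-cong        = +ᴹ-cong
                }
              ; assoc = λ _ _ _ → +ᴹ-assoc _ _ _
              }
            ; identity = (λ _ → +ᴹ-identityˡ _) , (λ _ → +ᴹ-identityʳ _)
            }
          ; comm = λ _ _ → +ᴹ-comm _ _
          }
        ; isPreleftSemimodule = record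
          { *ₗ-cong      = *ₗ-cong
          ; *ₗ-zeroˡ     = λ _ → *ₗ-zeroˡ _
          ; *ₗ-distribʳ  = λ _ _ _ → *ₗ-distribʳ _ _ _
          ; *ₗ-identityˡ = λ _ → *ₗ-identityˡ _
          ; *ₗ-assoc     = λ _ _ _ → *ₗ-assoc _ _ _
          ; *ₗ-zeroʳ     = *ₗ-zeroʳ
          ; *ₗ-distribˡ  = λ _ _ _ → *ₗ-distribˡ _ _ _
          }
        }
      ; -ᴹ‿cong    = -ᴹ‿cong
      ; -ᴹ‿inverse = (λ _ → -ᴹ‿inverseˡ _) , (λ _ → -ᴹ‿inverseʳ _)
      }

  Z : RAlgebra R (b ⊔ ℓ₁) ℓ₁
  Z .RAlgebra.baseModule = record
    { isModule = IsModuleFromLeft.isModule {commutativeRing = R}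
        (record { isLeftModule = Z-isLeftModule }) }
  Z .RAlgebra._∙_         = λ (x , p) (y , q) → x ∙ y , Z-∙ y p
  Z .RAlgebra.∙-cong      = ∙-cong
  Z .RAlgebra.∙-distribˡ  = λ _ _ _ → ∙-distribˡ _ _ _
  Z .RAlgebra.∙-distribʳ  = λ _ _ _ → ∙-distribʳ _ _ _
  Z .RAlgebra.*ₗ-∙-assocˡ = λ _ _ _ → *ₗ-∙-assocˡ _ _ _
  Z .RAlgebra.*ₗ-∙-assocʳ = λ _ _ _ → *ₗ-∙-assocʳ _ _ _

  _/Z : RAlgebra R b (b ⊔ ℓ₁)
  _/Z = quotient B annihilatorCongruence

  mod-Z : Hom B _/Z
  mod-Z = quotientMap B annihilatorCongruence

module _ {R : CommutativeRing c ℓ} (B : Module R b ℓ₁) where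
  open CommutativeRing R using (0#) renaming (Carrier to ∣R∣; _≈_ to _≈ᴿ_)
  open Module B
  open MonoidSum +ᴹ-monoid using (sum)

  TorsionFree : Set _
  TorsionFree = ∀ r x → r *ₗ x ≈ᴹ 0ᴹ → r ≈ᴿ 0# ⊎ x ≈ᴹ 0ᴹ

  LinearlyIndependent : Pred Carrierᴹ r → Set _
  LinearlyIndependent X =
    ∀ n (x : Fin n → Carrierᴹ) (r : Fin n → ∣R∣) →
    (∀ k → x k ∈ X) → Injective _≡_ _≈ᴹ_ x →
    sum (λ k → r k *ₗ x k) ≈ᴹ 0ᴹ → ∀ k → r k ≈ᴿ 0#

  record IsMaximalLinearlyIndependent (X : Pred Carrierᴹ r) :
                                      Set (c ⊔ ℓ ⊔ b ⊔ ℓ₁ ⊔ suc r) where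
    field
      respects    : X Respects _≈ᴹ_
      independent : LinearlyIndependent X
      maximal     : ∀ (Y : Pred Carrierᴹ r) → Y Respects _≈ᴹ_ →
                    LinearlyIndependent Y → X ⊆ Y → Y ⊆ X

  -- All maximal linearly independent subsets (of a module over an integral
  -- domain) are equinumerous, so any one of them determines the rank.

  HasRank : Setoid d ℓ₂ → Set _
  HasRank κ = Σ[ X ∈ Pred Carrierᴹ (b ⊔ ℓ₁) ]
    IsMaximalLinearlyIndependent X × Bijection (subsetoid ≈ᴹ-setoid X) κ

module _ {R : CommutativeRing c ℓ} {I : Set i} {A : I → RAlgebra R a i}
         {B : RAlgebra R b ℓ₁} (f : Hom (Π A) B) where

  FactorsThroughUltraproducts : (Filter I → Set r) → Set _
  FactorsThroughUltraproducts P =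
    ∃[ n ] Σ[ 𝓤 ∈ (Fin n → Filter I) ]
      (∀ m → IsUltrafilter (𝓤 m) × P (𝓤 m)) ×
      (Σ[ g ∈ Hom (Π (λ m → reducedProduct A (𝓤 m))) (B /Z) ]
         mod-Z B ∘ₕ f ≗ₕ g ∘ₕ ⟨ (λ m → reduce A (𝓤 m)) ⟩)

  SplitsOverFiniteSubproduct : Set _
  SplitsOverFiniteSubproduct =
    ∃[ n ] Σ[ s ∈ (Fin n → I) ] Injective _≡_ _≡_ s ×
      (Σ[ g ∈ Hom (Π (A ∘ s)) (B /Z) ] mod-Z B ∘ₕ f ≗ₕ g ∘ₕ project s) ×
      (Σ[ f₁ ∈ Hom (Π A) B ] Σ[ f₀ ∈ Hom (Π A) (Z B) ]
         (Σ[ h ∈ Hom (Π (A ∘ s)) B ] f₁ ≗ₕ h ∘ₕ project s) ×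
         (∀ x → Hom.⟦ f ⟧ x ≈ᴹ Hom.⟦ f₁ ⟧ x +ᴹ proj₁ (Hom.⟦ f₀ ⟧ x)))
    where open RAlgebra B

{-# OPTIONS --safe #-}

-- Call J ⊆ I null if f maps the subproduct over J into Z(B), that is, if f(ab) = 0 for
-- all a, b supported in J.  Let (u s), s ∈ S, be functions T → R such that every
-- combination of them which is nontrivial modulo the maximal ideal 𝔪 is a unit at all but
-- finitely many points.  If S has no injection into rk(B), then for a ∈ A and λ : I → T the
-- elements f((u s ∘ λ) a) are linearly dependent.  Dividing the relation by a coefficient
-- which divides all others, and using that B is torsion-free, one finds w : T → R with
-- f((w ∘ λ) a) = 0 which is a unit at all but finitely many points.  Where it is a unit,
-- ab = (wa)(w⁻¹b), so these points contribute nothing to f(a)f(b).  Since T is infinite,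
-- there is no infinite family of disjoint non-null sets, so I is, up to a null set, a
-- finite union of atoms modulo null sets.  Each atom carries an ultrafilter, and the same argument
-- with λ reading off the member of a family that i misses shows that this ultrafilter is
-- closed under T-indexed intersections.
--
-- In case (i), S = T = k and u s t = 1 / (t − s).  In case (ii), T = ℕ, S consists of the
-- branches of the binary tree, and u s n = q (s ↾ n) for a function q on the nodes such
-- that every square matrix of values of q at distinct nodes is nonsingular modulo 𝔪.
--
-- A nonprincipal ultrafilter on I which is closed under κ-indexed intersections pushes
-- forward to a measurable cardinal M with κ < M ≤ card(I), namely the least M such that
-- it is not closed under M-indexed intersections.

module Submission where

open import Algebra.Bundles using (CommutativeRing)
open import Algebra.Module.Bundles using (Module)
import Algebra.Properties.AbelianGroup as AbelianGroupProperties
import Algebra.Properties.CommutativeMonoid.Sum as CommutativeMonoidSum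
import Algebra.Properties.Ring as RingProperties
import Algebra.Properties.Semiring.Divisibility as SemiringDivisibility
import Algebra.Properties.Semiring.Sum as SemiringSum
import Algebra.Solver.Ring.NaturalCoefficients.Default as SemiringSolver
open import Axiom.UniquenessOfIdentityProofs.WithK using (uip)
open import Data.Bool.Base using (Bool; true; false; _∨_)
open import Data.Bool.Properties using (∨-zeroʳ; ¬-not)
open import Data.Empty using (⊥; ⊥-elim)
open import Data.Fin.Base
  using (Fin; zero; suc; toℕ; fromℕ<; punchIn; punchOut; combine; remQuot; finToFun; funToFin;
         splitAt; join)
import Data.Fin.Properties as Finₚ
open import Data.List.Base
  using (List; []; _∷_; _++_; applyUpTo; concat; deduplicate; length; lookup; map; tabulate; upTo)
import Data.List.Membership.Propositional as Membership
open import Data.List.Membership.Propositional.Properties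
  using (∈-++⁺ˡ; ∈-++⁺ʳ; ∈-applyUpTo⁺; ∈-concat⁺′; ∈-lookup; ∈-map⁺; ∈-tabulate⁺; ∈-upTo⁺)
open import Data.List.Membership.Setoid.Properties using (∈-deduplicate⁺)
import Data.List.Properties as Listₚ
import Data.List.Relation.Unary.All as All
open import Data.List.Relation.Unary.AllPairs.Core using (_∷_)
open import Data.List.Relation.Unary.Any using (here; there; index)
open import Data.List.Relation.Unary.Any.Properties using (lookup-index)
open import Data.List.Relation.Unary.Unique.DecPropositional.Properties using (deduplicate-!)
open import Data.List.Relation.Unary.Unique.Propositional using (Unique)
open import Data.Nat.Base as ℕ using (ℕ; zero; suc; s≤s; _<_; _≤_)
import Data.Nat.Binary.Base as ℕᵇ
import Data.Nat.Binary.Properties as ℕᵇₚ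
import Data.Nat.Properties as ℕₚ
open import Data.Product using (Σ; Σ-syntax; ∃-syntax; _×_; _,_; proj₁; proj₂)
open import Data.Sum.Base using (_⊎_; inj₁; inj₂; [_,_]′)
open import Data.Unit.Base using (⊤; tt)
open import Data.Vec.Functional using () renaming (_∷_ to _∷ᶠ_)
open import Function.Base using (_∘_; id; case_of_)
open import Function.Bundles
  using (Func; Injection; Surjection; Bijection; mk↣; mk⇔; module Bijection; module Equivalence)
import Function.Construct.Composition as Compose
import Function.Construct.Identity as Identity
open import Function.Definitions using (Injective)
open import Level using (Level; _⊔_; Lift; lift; lower)
open import Relation.Binary.Bundles using (Setoid)
open import Relation.Binary.Definitions using (DecidableEquality; tri<; tri≈; tri>)
open import Relation.Binary.PropositionalEquality as ≡ using (_≡_; _≢_; _≗_; setoid)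
import Relation.Binary.Reasoning.Setoid as SetoidReasoning
open import Relation.Nullary using (¬_; Dec; yes; no; ⌊_⌋)
open import Relation.Nullary.Decidable using (decidable-stable)
import Relation.Unary as Unary
open import Relation.Unary using (Pred)
open import Relation.Unary.Polymorphic using (U)
open import Defs

private variable
  a b c p p′ s t t′ ℓ ℓ₁ ℓ₂ ℓ₃ : Level

-- Zorn's lemma, comparability of sets, and quotients by chosen representatives.

module Choice (classical : Classical) where
  open ≡ using (refl; sym; trans; cong)
  open Classical classical

  byContradiction : {A : Set a} → ¬ ¬ A → A
  byContradiction = decidable-stable em

  -- Subsets are coded as Bool-valued functions, so that unions of arbitrary
  -- families of them do not raise the universe level.
  χ : Set a → Bool
  χ A = ⌊ em {P = A} ⌋

  χ⁺ : {A : Set a} → A → χ A ≡ true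
  χ⁺ {A = A} x with em {P = A}
  ... | yes _ = refl
  ... | no ¬x = ⊥-elim (¬x x)

  χ⁻ : {A : Set a} → χ A ≡ true → A
  χ⁻ {A = A} eq with em {P = A}
  χ⁻ eq | yes x = x

  -- The decision is an argument, so that facts about it can be proved by matching and then
  -- instantiated at `em`. The label read off is that of the witness inside the decision, which may
  -- differ from a witness known beforehand; `labelBy-yes` therefore returns a new one.
  labelBy : {N : Set a} {P : N → Set b} {C : Set c} → C → (N → C) → Dec (Σ N P) → C
  labelBy c₀ label (yes (n , _)) = label n
  labelBy c₀ label (no _)        = c₀

  labelBy-yes : {N : Set a} {P : N → Set b} {C : Set c} {c₀ : C} {label : N → C} (d : Dec (Σ N P)) →
                Σ N P → Σ[ n ∈ N ] P n × labelBy c₀ label d ≡ label n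
  labelBy-yes (yes (n , p)) _ = n , p , refl
  labelBy-yes (no ∄) e = ⊥-elim (∄ e)

  infix 4 _⊑_

  _⊑_ : {T : Set t} → (T → Bool) → (T → Bool) → Set t
  P ⊑ Q = ∀ x → P x ≡ true → Q x ≡ true

  ⊑-antisym : {T : Set t} {P Q : T → Bool} → P ⊑ Q → Q ⊑ P → P ≗ Q
  ⊑-antisym {P = P} {Q} p q x with P x in eq | Q x in eq′
  ... | true  | true  = refl
  ... | false | false = refl
  ... | true  | false = trans (sym (p x eq)) eq′
  ... | false | true  = trans (sym eq) (q x eq′)

  ⋃ : {T : Set t} → ((T → Bool) → Bool) → T → Bool
  ⋃ F x = χ (∃[ P ] F P ≡ true × P x ≡ true)

  insert : {T : Set t} → (T → Bool) → T → T → Bool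
  insert P e x = P x ∨ χ (x ≡ e)

  insert⁻ : {T : Set t} (P : T → Bool) (e : T) {x : T} →
            insert P e x ≡ true → P x ≡ true ⊎ x ≡ e
  insert⁻ P e {x} eq with P x
  ... | true  = inj₁ refl
  ... | false = inj₂ (χ⁻ eq)

  insert-old : {T : Set t} (P : T → Bool) (e : T) → P ⊑ insert P e
  insert-old P e x eq rewrite eq = refl

  insert-new : {T : Set t} (P : T → Bool) (e : T) → insert P e e ≡ true
  insert-new P e = trans (cong (P e ∨_) (χ⁺ refl)) (∨-zeroʳ (P e))

  Chain : {T : Set t} → ((T → Bool) → Bool) → Set t
  Chain F = ∀ {P Q} → F P ≡ true → F Q ≡ true → P ⊑ Q ⊎ Q ⊑ P

  ⋃-common : {T : Set t} (F : (T → Bool) → Bool) → Chain F →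
             ∀ {x y} → ⋃ F x ≡ true → ⋃ F y ≡ true →
             ∃[ P ] F P ≡ true × P x ≡ true × P y ≡ true
  ⋃-common F chain {x} {y} x∈ y∈ with χ⁻ x∈ | χ⁻ y∈
  ... | P , P∈F , x∈P | Q , Q∈F , y∈Q with chain P∈F Q∈F
  ...   | inj₁ P⊑Q = Q , Q∈F , P⊑Q x x∈P , y∈Q
  ...   | inj₂ Q⊑P = P , P∈F , x∈P , Q⊑P y y∈Q

  -- Zermelo's proof: the tower generated by a one-element extension operator
  -- and by unions is a chain, hence its union admits no extension.
  module Zorn {T : Set t} (Φ : (T → Bool) → Set p)
    (Φ-resp : ∀ {P Q} → P ≗ Q → Φ P → Φ Q)
    (Φ-∅ : Φ (λ _ → false))
    (Φ-⋃ : (F : (T → Bool) → Bool) → ∃[ P ] F P ≡ true →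
           Chain F → (∀ {P} → F P ≡ true → Φ P) → Φ (⋃ F))
    where

    private
      Extends : (T → Bool) → T → Set p
      Extends P e = Φ (insert P e)

      Extendable : (T → Bool) → Set (t ⊔ p)
      Extendable P = Σ[ e ∈ T ] P e ≡ false × Extends P e

      insert-cong : ∀ {P Q : T → Bool} → P ≗ Q → ∀ e → insert P e ≗ insert Q e
      insert-cong eq e x = cong (_∨ χ (x ≡ e)) (eq x)

      -- Both setoids consist of subsets with a possible new element, but equality in `subsets`
      -- ignores that element. A section of the identity from `marked` to `subsets` thus makes the
      -- new element depend on the subset only up to pointwise equality.
      subsets marked : Setoid (t ⊔ p) t
      subsets = record
        { Carrier = Σ (T → Bool) Extendable
        ; _≈_ = λ X Y → proj₁ X ≗ proj₁ Y
        ; isEquivalence = record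
          { refl = λ _ → refl ; sym = λ f x → sym (f x) ; trans = λ f g x → trans (f x) (g x) } }
      marked = record
        { Carrier = Σ (T → Bool) Extendable
        ; _≈_ = λ X Y → proj₁ X ≗ proj₁ Y × proj₁ (proj₂ X) ≡ proj₁ (proj₂ Y)
        ; isEquivalence = record
          { refl = (λ _ → refl) , refl
          ; sym = λ (f , g) → (λ x → sym (f x)) , sym g
          ; trans = λ (f , g) (f′ , g′) → (λ x → trans (f x) (f′ x)) , trans g g′ } }

      forget : Surjection marked subsets
      forget = record { to = id ; cong = proj₁ ; surjective = λ y → y , proj₁ }

      section = proj₁ (choice forget)

      pick : Σ (T → Bool) Extendable → T
      pick X = proj₁ (proj₂ (Func.to section X))

      pick-cong : ∀ X Y → proj₁ X ≗ proj₁ Y → pick X ≡ pick Y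
      pick-cong X Y eq = proj₂ (Func.cong section {X} {Y} eq)

      pick-extends : ∀ X → Extends (proj₁ X) (pick X)
      pick-extends X = Φ-resp (insert-cong (proj₂ (choice forget) X) _)
        (proj₂ (proj₂ (proj₂ (Func.to section X))))

      pick-fresh : ∀ X → proj₁ X (pick X) ≡ false
      pick-fresh X = trans (sym (proj₂ (choice forget) X _))
        (proj₁ (proj₂ (proj₂ (Func.to section X))))

      growBy : ∀ P → Dec (Extendable P) → T → Bool
      growBy P (yes e) = insert P (pick (P , e))
      growBy P (no _)  = P

      grow : (T → Bool) → T → Bool
      grow P = growBy P em

      ⊑-grow : ∀ P → P ⊑ grow P
      ⊑-grow P with em {P = Extendable P}
      ... | yes e = insert-old P _
      ... | no _  = λ _ → id

      extendable-resp : ∀ {P Q} → P ≗ Q → Extendable P → Extendable Q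
      extendable-resp eq (e , e∉P , φ) =
        e , trans (sym (eq e)) e∉P , Φ-resp (insert-cong eq e) φ

      grow-cong : ∀ {P Q} → P ≗ Q → grow P ≗ grow Q
      grow-cong {P} {Q} eq x with em {P = Extendable P} | em {P = Extendable Q}
      ... | yes e | yes e′ rewrite pick-cong (P , e) (Q , e′) eq = insert-cong eq _ x
      ... | yes e | no ¬e′ = ⊥-elim (¬e′ (extendable-resp eq e))
      ... | no ¬e | yes e′ = ⊥-elim (¬e (extendable-resp (sym ∘ eq) e′))
      ... | no _  | no _   = eq x

      data Tower : (T → Bool) → Set t where
        step : ∀ {P} → Tower P → Tower (grow P)
        sup  : ∀ F → (∀ P → F P ≡ true → Tower P) → Tower (⋃ F)

      -- The second alternative is `grow Q ⊑ P` rather than `Q ⊑ P`: no member of the tower lies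
      -- strictly between `Q` and `grow Q`. In the successor case the comparison is made both ways;
      -- if each of `P` and `Q` contains the other, they agree, and `grow-cong` makes their
      -- extensions agree.
      compare : ∀ {P Q} → Tower P → Tower Q → P ⊑ Q ⊎ grow Q ⊑ P
      compare {Q = Q} (sup F h) q with em {P = ∃[ P ] F P ≡ true × grow Q ⊑ P}
      ... | yes (P , P∈F , Q⁺⊑P) = inj₂ λ x x∈Q⁺ → χ⁺ (P , P∈F , Q⁺⊑P x x∈Q⁺)
      ... | no ¬above = inj₁ λ x x∈⋃ → below x (χ⁻ x∈⋃)
        where
        below : ∀ x → ∃[ P ] F P ≡ true × P x ≡ true → Q x ≡ true
        below x (P , P∈F , x∈P) with compare (h P P∈F) q
        ... | inj₁ P⊑Q  = P⊑Q x x∈P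
        ... | inj₂ Q⁺⊑P = ⊥-elim (¬above (P , P∈F , Q⁺⊑P))
      compare (step {P} p) q with compare p q
      ... | inj₂ Q⁺⊑P = inj₂ λ x → ⊑-grow P x ∘ Q⁺⊑P x
      ... | inj₁ P⊑Q with compare q p
      ...   | inj₂ P⁺⊑Q = inj₁ P⁺⊑Q
      ...   | inj₁ Q⊑P  = inj₂ λ x → trans (sym (grow-cong (⊑-antisym Q⊑P P⊑Q) x))

      chain : ∀ {P Q} → Tower P → Tower Q → P ⊑ Q ⊎ Q ⊑ P
      chain {Q = Q} p q with compare p q
      ... | inj₁ P⊑Q  = inj₁ P⊑Q
      ... | inj₂ Q⁺⊑P = inj₂ λ x → Q⁺⊑P x ∘ ⊑-grow Q x

      tower-Φ : ∀ {P} → Tower P → Φ P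
      tower-Φ (step {P} p) with em {P = Extendable P}
      ... | yes e = pick-extends (P , e)
      ... | no _  = tower-Φ p
      tower-Φ (sup F h) with em {P = ∃[ P ] F P ≡ true}
      ... | yes inhabited = Φ-⋃ F inhabited
              (λ P∈F Q∈F → chain (h _ P∈F) (h _ Q∈F)) (λ P∈F → tower-Φ (h _ P∈F))
      -- `Φ-⋃` only concerns inhabited families; the union of an empty one is the empty set.
      ... | no empty = Φ-resp (λ x → sym (false-on x)) Φ-∅
        where
        false-on : ∀ x → ⋃ F x ≡ false
        false-on x with ⋃ F x in eq
        ... | false = refl
        ... | true with χ⁻ eq
        ...   | P , P∈F , _ = ⊥-elim (empty (P , P∈F))

      top : Tower (⋃ (χ ∘ Tower))
      top = sup (χ ∘ Tower) (λ _ → χ⁻)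

    -- The union of the whole tower is itself in the tower, hence so is its extension. That
    -- extension is then contained in the union, although it would have a fresh element if one
    -- existed.
    maximal-subset : Σ[ P ∈ (T → Bool) ] Φ P × (∀ e → P e ≡ false → ¬ Φ (insert P e))
    maximal-subset = P , tower-Φ top , λ e e∉P φ → stuck (e , e∉P , φ)
      where
      P = ⋃ (χ ∘ Tower)
      top-closed : grow P ⊑ P
      top-closed x x∈P⁺ = χ⁺ (grow P , χ⁺ (step top) , x∈P⁺)
      stuck : ¬ Extendable P
      stuck ext with em {P = Extendable P} | top-closed
      ... | no ¬e | _ = ¬e ext
      ... | yes e | closed with trans (sym (pick-fresh (P , e))) (closed _ (insert-new P _))
      ...   | ()

  -- Hönig's argument: in a maximal set of elements of the product on which
  -- every projection is injective, some projection is also surjective.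
  smallest : {Ix : Set s} (A : Ix → Set a) → Ix →
             Σ[ i ∈ Ix ] ∀ j → setoid (A i) ≼ setoid (A j)
  smallest {Ix = Ix} A i₀ = i , into
    where
    T = ∀ i → A i
    Φ : (T → Bool) → Set _
    Φ P = ∀ x y → P x ≡ true → P y ≡ true → ∀ i j → x i ≡ y i → x j ≡ y j

    Φ-⋃ : (F : (T → Bool) → Bool) → ∃[ P ] F P ≡ true → Chain F →
          (∀ {P} → F P ≡ true → Φ P) → Φ (⋃ F)
    Φ-⋃ F _ chain φ x y x∈ y∈ =
      let (P , P∈F , x∈P , y∈P) = ⋃-common F chain x∈ y∈ in φ P∈F x y x∈P y∈P

    open Zorn Φ (λ eq φ x y x∈ y∈ → φ x y (trans (eq x) x∈) (trans (eq y) y∈))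
      (λ _ _ ()) Φ-⋃
    P = proj₁ maximal-subset
    φ = proj₁ (proj₂ maximal-subset)

    Covered : (i : Ix) → A i → Set _
    Covered i c = Σ[ x ∈ T ] P x ≡ true × x i ≡ c

    covered : Σ[ i ∈ Ix ] ∀ c → Covered i c
    covered = byContradiction λ none →
      let missed : ∀ i → Σ[ c ∈ A i ] ¬ Covered i c
          missed i = byContradiction λ all → none (i , λ c → byContradiction λ ¬c → all (c , ¬c))
          e = proj₁ ∘ missed
          e∉P : P e ≡ false
          e∉P = notTrue λ e∈P → proj₂ (missed i₀) (e , e∈P , refl)
      in proj₂ (proj₂ maximal-subset) e e∉P λ x y x∈ y∈ →
           extended (proj₂ ∘ missed) (insert⁻ P e x∈) (insert⁻ P e y∈)
      where
      notTrue : ∀ {b} → ¬ b ≡ true → b ≡ false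
      notTrue {false} _ = refl
      notTrue {true}  h = ⊥-elim (h refl)
      extended : ∀ {e x y : T} → (∀ i → ¬ Covered i (e i)) →
                 P x ≡ true ⊎ x ≡ e → P y ≡ true ⊎ y ≡ e → ∀ i j → x i ≡ y i → x j ≡ y j
      extended miss (inj₁ x∈) (inj₁ y∈) = φ _ _ x∈ y∈
      extended miss (inj₁ x∈) (inj₂ refl) i j eq = ⊥-elim (miss i (_ , x∈ , eq))
      extended miss (inj₂ refl) (inj₁ y∈) i j eq = ⊥-elim (miss i (_ , y∈ , sym eq))
      extended miss (inj₂ refl) (inj₂ refl) i j eq = refl

    i = proj₁ covered
    into : ∀ j → setoid (A i) ≼ setoid (A j)
    into j = mk↣ {to = λ c → proj₁ (proj₂ covered c) j} λ {c} {d} eq →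
      let (x , x∈ , xi) = proj₂ covered c
          (y , y∈ , yi) = proj₂ covered d
      in trans (sym xi) (trans (φ x y x∈ y∈ j i eq) yi)

  -- The smaller member of a two-element family injects into the other; `Lift` only puts both sets
  -- at one level.
  ≼-total : (A : Set a) (B : Set b) → setoid A ≼ setoid B ⊎ setoid B ≼ setoid A
  ≼-total {a} {b} A B = compare (smallest family true)
    where
    family : Bool → Set (a ⊔ b)
    family true  = Lift b A
    family false = Lift a B
    compare : Σ[ i ∈ Bool ] (∀ j → setoid (family i) ≼ setoid (family j)) →
              setoid A ≼ setoid B ⊎ setoid B ≼ setoid A
    compare (true  , into) = inj₁ (mk↣ {to = lower ∘ Injection.to (into false) ∘ lift} λ eq →
      cong lower (Injection.injective (into false) (cong lift eq)))
    compare (false , into) = inj₂ (mk↣ {to = lower ∘ Injection.to (into true) ∘ lift} λ eq →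
      cong lower (Injection.injective (into true) (cong lift eq)))

  module Quotient (S : Setoid a ℓ₁) where
    private
      module S = Setoid S
      represent : Surjection (setoid S.Carrier) S
      represent = record
        { to = id ; cong = S.reflexive ; surjective = λ y → y , S.reflexive }
      rep = Func.to (proj₁ (choice represent))
      rep-cong = Func.cong (proj₁ (choice represent))
      rep-≈ = proj₂ (choice represent)

    -- The quotient is realised as the set of chosen representatives, so that it has propositional
    -- equality. The proof of being a fixed point of `rep` is irrelevant by `uip`.
    Q : Set a
    Q = Σ[ x ∈ S.Carrier ] rep x ≡ x

    class : S.Carrier → Q
    class x = rep x , rep-cong (rep-≈ x)

    element : Q → S.Carrier
    element = proj₁

    element-class : ∀ x → element (class x) S.≈ x
    element-class = rep-≈

    private
      Q-≡ : {u v : Q} → proj₁ u ≡ proj₁ v → u ≡ v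
      Q-≡ {x , p} {_ , q} refl = cong (x ,_) (uip p q)

    class-cong : ∀ {x y} → x S.≈ y → class x ≡ class y
    class-cong eq = Q-≡ (rep-cong eq)

    class-injective : ∀ {x y} → class x ≡ class y → x S.≈ y
    class-injective eq = S.trans (S.sym (rep-≈ _)) (S.trans (S.reflexive (cong proj₁ eq)) (rep-≈ _))

    element-injective : ∀ {u v} → element u S.≈ element v → u ≡ v
    element-injective {u} {v} eq =
      Q-≡ (trans (sym (proj₂ u)) (trans (rep-cong eq) (proj₂ v)))

    ≼-quotient : S ≼ setoid Q
    ≼-quotient = record { to = class ; cong = class-cong ; injective = class-injective }

    quotient-≼ : setoid Q ≼ S
    quotient-≼ = record
      { to = element ; cong = S.reflexive ∘ cong element ; injective = element-injective }

  ≼-trans : {A : Setoid a ℓ₁} {B : Setoid b ℓ₂} {C : Setoid c ℓ₃} → A ≼ B → B ≼ C → A ≼ C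
  ≼-trans = Compose.injection

-- Sequences constructed stage by stage, and freshness in infinite sets.

uniform-bound : ∀ {m} (P : Fin m → ℕ → Set p) → (∀ i → ∃[ N ] ∀ n → N ≤ n → P i n) →
                ∃[ N ] ∀ n → N ≤ n → ∀ i → P i n
uniform-bound {m = zero}  P h = 0 , λ _ _ ()
uniform-bound {m = suc m} P h =
  let (N₀ , h₀) = h zero ; (N , hN) = uniform-bound (P ∘ suc) (h ∘ suc) in
  N₀ ℕ.⊔ N , λ n N≤n → λ
    { zero    → h₀ n (ℕₚ.≤-trans (ℕₚ.m≤m⊔n N₀ N) N≤n)
    ; (suc i) → hN n (ℕₚ.≤-trans (ℕₚ.m≤n⊔m N₀ N) N≤n) i }

module _ {A : Set a} where
  open ≡ using (refl; sym; trans; cong; subst; subst₂)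
  open Membership using (_∈_; _∉_)

  updateBy : ∀ {i n : ℕ} → Dec (i ≡ n) → A → A → A
  updateBy (yes _) new old = new
  updateBy (no _)  new old = old

  update : (ℕ → A) → ℕ → A → ℕ → A
  update q n x i = updateBy (i ℕₚ.≟ n) x (q i)

  update-at : ∀ q n x → update q n x n ≡ x
  update-at q n x with n ℕₚ.≟ n
  ... | yes _  = refl
  ... | no n≢n = ⊥-elim (n≢n refl)

  update-off : ∀ q n x {i} → i ≢ n → update q n x i ≡ q i
  update-off q n x {i} i≢n with i ℕₚ.≟ n
  ... | yes i≡n = ⊥-elim (i≢n i≡n)
  ... | no _    = refl

  -- By `local` the condition at stage `n` depends only on the values below `n`. Later stages leave
  -- these unchanged, so the diagonal of the stages meets every condition.
  build-sequence : (G : ℕ → (ℕ → A) → Set p) →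
    (∀ {n q q′} → (∀ i → i < n → q i ≡ q′ i) → G n q → G n q′) →
    (q₀ : ℕ → A) → G 0 q₀ →
    (∀ n q → G n q → Σ[ x ∈ A ] G (suc n) (update q n x)) →
    Σ[ q ∈ (ℕ → A) ] ∀ n → G n q
  build-sequence G local q₀ g₀ next = limit , λ n → local (agree n) (proj₂ (stage n))
    where
    stage : ∀ n → Σ[ q ∈ (ℕ → A) ] G n q
    stage zero = q₀ , g₀
    stage (suc n) = let (q , g) = stage n in update q n (proj₁ (next n q g)) , proj₂ (next n q g)
    limit : ℕ → A
    limit n = proj₁ (stage (suc n)) n
    agree : ∀ n i → i < n → proj₁ (stage n) i ≡ limit i
    agree (suc n) i i<1+n with ℕₚ.m<1+n⇒m<n∨m≡n i<1+n
    ... | inj₂ refl = refl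
    ... | inj₁ i<n  = trans (update-off (proj₁ (stage n)) n _ (ℕₚ.<⇒≢ i<n)) (agree n i i<n)

  injective-sequence : (P : A → Set p) → (∀ l → Σ[ x ∈ A ] P x × x ∉ l) →
    Σ[ τ ∈ (ℕ → A) ] Injective _≡_ _≡_ τ × ∀ n → P (τ n)
  injective-sequence P fresh = τ , injective , λ n → proj₁ (g (suc n) n (ℕₚ.n<1+n n))
    where
    G : ℕ → (ℕ → A) → Set _
    G n q = ∀ i → i < n → P (q i) × ∀ j → j < i → q j ≢ q i
    sequence = build-sequence G
      (λ eq g i i<n → subst P (eq i i<n) (proj₁ (g i i<n)) ,
        λ j j<i → subst₂ _≢_ (eq j (ℕₚ.<-trans j<i i<n)) (eq i i<n) (proj₂ (g i i<n) j j<i))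
      (λ _ → proj₁ (fresh [])) (λ _ ())
      λ n q g → let (x , px , x∉) = fresh (applyUpTo q n) in x , extend n q g x px x∉
      where
      extend : ∀ n q → G n q → ∀ x → P x → x ∉ applyUpTo q n → G (suc n) (update q n x)
      extend n q g x px x∉ i i<1+n with ℕₚ.m<1+n⇒m<n∨m≡n i<1+n
      ... | inj₂ refl = subst P (sym (update-at q n x)) px , λ j j<n eq → x∉ (subst (_∈ applyUpTo q n)
              (trans (sym (update-off q n x (ℕₚ.<⇒≢ j<n))) (trans eq (update-at q n x)))
                  (∈-applyUpTo⁺ q j<n))
      ... | inj₁ i<n = subst P (sym (update-off q n x (ℕₚ.<⇒≢ i<n))) (proj₁ (g i i<n)) , λ j j<i →
              subst₂ _≢_ (sym (update-off q n x (ℕₚ.<⇒≢ (ℕₚ.<-trans j<i i<n))))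
                (sym (update-off q n x (ℕₚ.<⇒≢ i<n))) (proj₂ (g i i<n) j j<i)
    τ = proj₁ sequence
    g = proj₂ sequence
    injective : Injective _≡_ _≡_ τ
    injective {i} {j} eq with ℕₚ.<-cmp i j
    ... | tri< i<j _ _ = ⊥-elim (proj₂ (g (suc j) j (ℕₚ.n<1+n j)) i i<j eq)
    ... | tri≈ _ i≡j _ = i≡j
    ... | tri> _ _ j<i = ⊥-elim (proj₂ (g (suc i) i (ℕₚ.n<1+n i)) j j<i (sym eq))

  lookup-unique : ∀ {l : List A} → Unique l → Injective _≡_ _≡_ (lookup l)
  lookup-unique (_ ∷ _) {zero}  {zero}  _  = refl
  lookup-unique {_ ∷ l} (x∉ ∷ _) {zero}  {suc j} eq = ⊥-elim (All.lookup x∉ (∈-lookup {xs = l} j) eq)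
  lookup-unique {_ ∷ l} (x∉ ∷ _) {suc i} {zero}  eq = ⊥-elim (All.lookup x∉ (∈-lookup {xs =
    l} i) (sym eq))
  lookup-unique (_ ∷ u) {suc i} {suc j} eq = cong suc (lookup-unique u eq)

module Sequences (classical : Classical) where
  open ≡ using (refl; sym; trans; cong)
  open Membership using (_∈_; _∉_)
  open Classical classical
  open Choice classical

  module _ {A : Set a} where

    -- A list containing every element would, after removal of repetitions, give a bijection with
    -- some `Fin n`.
    fresh-element : Infinite (setoid A) → ∀ l → Σ[ x ∈ A ] x ∉ l
    fresh-element infinite l = byContradiction λ none →
      infinite (length u , enumerate λ x → ∈-deduplicate⁺ (setoid A) _≟_
        (λ { refl refl → refl }) (byContradiction λ x∉ → none (x , x∉)))
      where
      _≟_ : DecidableEquality A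
      x ≟ y = em
      u = deduplicate _≟_ l
      enumerate : (∀ x → x ∈ u) → Bijection (setoid A) (setoid (Fin (length u)))
      enumerate mem = record
        { to = λ x → index (mem x)
        ; cong = cong (λ x → index (mem x))
        ; bijective =
            (λ {x} {y} eq → trans (lookup-index (mem x))
                (trans (cong (lookup u) eq) (sym (lookup-index (mem y))))) ,
            λ i → lookup u i , λ { refl → lookup-unique (deduplicate-! _≟_ l)
                (sym (lookup-index (mem (lookup u i)))) } }

    eventually-∉ : (τ : ℕ → A) → Injective _≡_ _≡_ τ → ∀ l → ∃[ N ] ∀ n → N ≤ n → τ n ∉ l
    eventually-∉ τ inj [] = 0 , λ _ _ ()
    eventually-∉ τ inj (x ∷ l) with eventually-∉ τ inj l | em {P = ∃[ k ] τ k ≡ x}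
    ... | N , avoids | no never = N , λ
            { n N≤n (here eq) → never (n , eq)
            ; n N≤n (there τn∈l) → avoids n N≤n τn∈l }
    ... | N , avoids | yes (k , refl) = N ℕ.⊔ suc k , λ
            { n N≤n (here eq) → ℕₚ.<-irrefl (inj (sym eq)) (ℕₚ.≤-trans (ℕₚ.m≤n⊔m N (suc k)) N≤n)
            ; n N≤n (there τn∈l) → avoids n (ℕₚ.≤-trans (ℕₚ.m≤m⊔n N (suc k)) N≤n) τn∈l }

-- Nonsingular matrices over a field.

Injective₂ : ∀ {m} {A : Set a} → (Fin m → Fin m → A) → Set a
Injective₂ e = ∀ {i j i′ j′} → e i j ≡ e i′ j′ → i ≡ i′ × j ≡ j′

by-punchIn : ∀ {m} {P : Fin (suc m) → Set p} (i : Fin (suc m)) → P i → (∀ j → P (punchIn i j)) → ∀ j →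
    P j
by-punchIn {P = P} i pᵢ pₒ j with i Finₚ.≟ j
... | yes ≡.refl = pᵢ
... | no i≢j  = ≡.subst P (Finₚ.punchIn-punchOut i≢j) (pₒ (punchOut i≢j))

module Matrices (classical : Classical) (F : CommutativeRing c ℓ) where
  open CommutativeRing F hiding (zero; setoid)
  open SemiringSum semiring using (sum; sum-cong-≋; sum-remove; ∑-distrib-+; *-distribˡ-sum)
  open Choice classical

  -- Triviality of the kernel replaces a nonvanishing determinant. The unknowns are indexed by
  -- columns and the equations by rows.
  Nonsingular : ∀ {m} → (Fin m → Fin m → Carrier) → Set _
  Nonsingular {m} M = ∀ (r : Fin m → Carrier) → (∀ i → sum (λ j → r j * M i j) ≈ 0#) → ∀ j → r j ≈ 0#

  nonsingular-resp : ∀ {m} {M N : Fin m → Fin m → Carrier} → (∀ i j → M i j ≈ N i j) →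
                     Nonsingular M → Nonsingular N
  nonsingular-resp eq ns r eqs = ns r λ i → trans (sum-cong-≋ λ j → *-congˡ (eq i j)) (eqs i)

  module OverField (integral : ∀ {x y} → x * y ≈ 0# → ¬ x ≈ 0# → y ≈ 0#)
                   (1≉0 : ¬ 1# ≈ 0#) where

    open AbelianGroupProperties +-abelianGroup using ()
      renaming (∙-cancelʳ to +-cancelʳ; x∙y⁻¹≈ε⇒x≈y to x-y≈0⇒x≈y)
    open SemiringSolver commutativeSemiring using (solve; _:+_; _:*_; _:=_)
    open SetoidReasoning (CommutativeRing.setoid F)

    x-y+y≈x : ∀ x y → (x - y) + y ≈ x
    x-y+y≈x x y = trans (+-assoc x (- y) y) (trans (+-congˡ (-‿inverseˡ y)) (+-identityʳ x))

    unit≉0 : ∀ {x y} → x * y ≈ 1# → ¬ y ≈ 0#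
    unit≉0 xy≈1 y≈0 = 1≉0 (trans (sym xy≈1) (trans (*-congˡ y≈0) (zeroʳ _)))

    -- Here M i j = 1 / (t i − s j).  Scaling row i by t i − s 0 and subtracting the
    -- scaled row 0 eliminates the first unknown and leaves, up to the factor
    -- t 0 − t i, a Cauchy system of size one less.
    cauchy : ∀ {m} (s t : Fin m → Carrier) (d M : Fin m → Fin m → Carrier) →
             (∀ i j → d i j + s j ≈ t i) → (∀ i j → d i j * M i j ≈ 1#) →
             Injective _≡_ _≈_ s → Injective _≡_ _≈_ t → Nonsingular M
    cauchy {zero}  s t d M ds dM s-inj t-inj r eqs ()
    cauchy {suc m} s t d M ds dM s-inj t-inj r eqs = λ { zero → r₀≈0 ; (suc j) → rₛ≈0 j }
      where
      -- The unknowns `r′` of the smaller system carry the factors split off from column `j`. Since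
      -- `e zero` is zero, the first one drops out; for the others `e j` and `M zero j` are nonzero,
      -- so `r′` determines `r`.
      e g r′ : Fin (suc m) → Carrier
      e j = s j - s zero
      g i = t zero - t i
      r′ j = r j * (e j * M zero j)

      d-shift : ∀ i j → d i zero ≈ d i j + e j
      d-shift i j = +-cancelʳ (s zero) _ _ (begin
        d i zero + s zero         ≈⟨ ds i zero ⟩
        t i                       ≈⟨ ds i j ⟨
        d i j + s j               ≈⟨ +-congˡ (x-y+y≈x (s j) (s zero)) ⟨
        d i j + (e j + s zero)    ≈⟨ +-assoc _ _ _ ⟨
        (d i j + e j) + s zero    ∎)

      d-row : ∀ i j → d zero j ≈ g i + d i j
      d-row i j = +-cancelʳ (s j) _ _ (begin
        d zero j + s j          ≈⟨ ds zero j ⟩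
        t zero                  ≈⟨ x-y+y≈x (t zero) (t i) ⟨
        g i + t i               ≈⟨ +-congˡ (ds i j) ⟨
        g i + (d i j + s j)     ≈⟨ +-assoc _ _ _ ⟨
        (g i + d i j) + s j     ∎)

      expand : ∀ i j → d i zero * (r j * M i j) ≈ r j + r j * (e j * M i j)
      expand i j = begin
        d i zero * (r j * M i j)                 ≈⟨ *-congʳ (d-shift i j) ⟩
        (d i j + e j) * (r j * M i j)           
            ≈⟨ solve 4 (λ d e r m → (d :+ e) :* (r :* m) := r :* (d :* m) :+ r :* (e :* m)) refl
                (d i j) (e j) (r j) (M i j) ⟩
        r j * (d i j * M i j) + r j * (e j * M i j)
            ≈⟨ +-congʳ (trans (*-congˡ (dM i j)) (*-identityʳ _)) ⟩
        r j + r j * (e j * M i j)                ∎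

      row-difference : ∀ i j → M i j ≈ M zero j + g i * (M zero j * M i j)
      row-difference i j = begin
        M i j                                    ≈⟨ *-identityʳ _ ⟨
        M i j * 1#                               ≈⟨ *-congˡ (dM zero j) ⟨
        M i j * (d zero j * M zero j)            ≈⟨ *-congˡ (*-congʳ (d-row i j)) ⟩
        M i j * ((g i + d i j) * M zero j)      
            ≈⟨ solve 4 (λ m g d n → m :* ((g :+ d) :* n) := (d :* m) :* n :+ g :* (n :* m)) refl
                (M i j) (g i) (d i j) (M zero j) ⟩
        (d i j * M i j) * M zero j + g i * (M zero j * M i j)
            ≈⟨ +-congʳ (trans (*-congʳ (dM i j)) (*-identityˡ _)) ⟩
        M zero j + g i * (M zero j * M i j)      ∎

      eliminate : ∀ i j → d i zero * (r j * M i j) ≈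
                          d zero zero * (r j * M zero j) + g i * (r′ j * M i j)
      eliminate i j = begin
        d i zero * (r j * M i j)   ≈⟨ expand i j ⟩
        r j + r j * (e j * M i j)  ≈⟨ +-congˡ (*-congˡ (*-congˡ (row-difference i j))) ⟩
        r j + r j * (e j * (M zero j + g i * (M zero j * M i j)))
          ≈⟨ solve 5 (λ r e n g m → r :+ r :* (e :* (n :+ g :* (n :* m))) :=
            (r :+ r :* (e :* n)) :+ g :* ((r :* (e :* n)) :* m)) refl (r j) (e j) (M zero j) (g i)
                (M i j) ⟩
        (r j + r j * (e j * M zero j)) + g i * (r′ j * M i j) ≈⟨ +-congʳ (expand zero j) ⟨
        d zero zero * (r j * M zero j) + g i * (r′ j * M i j) ∎

      reduced : ∀ i → g i * sum (λ j → r′ j * M i j) ≈ 0#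
      reduced i = begin
        g i * sum (λ j → r′ j * M i j)           ≈⟨ +-identityˡ _ ⟨
        0# + g i * sum (λ j → r′ j * M i j)      ≈⟨ +-congʳ (trans (*-congˡ (eqs zero)) (zeroʳ _)) ⟨
        d zero zero * sum (λ j → r j * M zero j) + g i * sum (λ j → r′ j * M i j)
          ≈⟨ +-cong (*-distribˡ-sum (d zero zero) (λ j → r j * M zero j))
              (*-distribˡ-sum (g i) (λ j → r′ j * M i j)) ⟩
        sum (λ j → d zero zero * (r j * M zero j)) + sum (λ j → g i * (r′ j * M i j))
          ≈⟨ ∑-distrib-+ (λ j → d zero zero * (r j * M zero j)) (λ j → g i * (r′ j * M i j)) ⟨
        sum (λ j → d zero zero * (r j * M zero j) + g i * (r′ j * M i j)) ≈⟨ sum-cong-≋ (eliminate i) ⟨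
        sum (λ j → d i zero * (r j * M i j))     ≈⟨ *-distribˡ-sum (d i zero) (λ j → r j * M i j) ⟨
        d i zero * sum (λ j → r j * M i j)       ≈⟨ trans (*-congˡ (eqs i)) (zeroʳ _) ⟩
        0#                                       ∎

      r′₀≈0 : r′ zero ≈ 0#
      r′₀≈0 = trans (*-congˡ (trans (*-congʳ (-‿inverseʳ (s zero))) (zeroˡ _))) (zeroʳ _)

      smaller : ∀ i → sum (λ j → r′ (suc j) * M (suc i) (suc j)) ≈ 0#
      smaller i = begin
        sum (λ j → r′ (suc j) * M (suc i) (suc j)) ≈⟨ +-identityˡ _ ⟨
        0# + sum (λ j → r′ (suc j) * M (suc i) (suc j)) ≈⟨ +-congʳ (trans (*-congʳ r′₀≈0) (zeroˡ _)) ⟨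
        sum (λ j → r′ j * M (suc i) j)
            ≈⟨ integral (reduced (suc i)) (λ g≈0 → Finₚ.0≢1+n (t-inj (x-y≈0⇒x≈y _ _ g≈0))) ⟩
        0# ∎

      rₛ≈0 : ∀ j → r (suc j) ≈ 0#
      rₛ≈0 j = integral
        (trans (*-comm _ _) (cauchy (s ∘ suc) (t ∘ suc) (λ i j → d (suc i) (suc j))
            (λ i j → M (suc i) (suc j))
          (λ i j → ds (suc i) (suc j)) (λ i j → dM (suc i) (suc j))
          (Finₚ.suc-injective ∘ s-inj) (Finₚ.suc-injective ∘ t-inj) (r′ ∘ suc) smaller j))
        λ eM≈0 → unit≉0 (dM zero (suc j)) (integral eM≈0 λ e≈0 →
            Finₚ.0≢1+n (≡.sym (s-inj (x-y≈0⇒x≈y _ _ e≈0))))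

      r₀≈0 : r zero ≈ 0#
      r₀≈0 = integral (begin
        M zero zero * r zero ≈⟨ *-comm _ _ ⟩
        r zero * M zero zero ≈⟨ +-identityʳ _ ⟨
        r zero * M zero zero + 0#
            ≈⟨ +-congˡ (vanish (λ j → r (suc j) * M zero (suc j)) λ j → trans (*-congʳ (rₛ≈0 j))
                (zeroˡ _)) ⟨
        sum (λ j → r j * M zero j) ≈⟨ eqs zero ⟩
        0# ∎) (unit≉0 (dM zero zero))
        where
        vanish : ∀ {n} (x : Fin n → Carrier) → (∀ j → x j ≈ 0#) → sum x ≈ 0#
        vanish {zero}  x h = refl
        vanish {suc n} x h = trans (+-cong (h zero) (vanish (x ∘ suc) (h ∘ suc))) (+-identityˡ _)

    -- The determinant is affine in one entry, and its slope is the minor.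
    one-singular-entry : ∀ {m} (M M′ : Fin (suc m) → Fin (suc m) → Carrier) i₀ j₀ →
      (∀ i j → ¬ (i ≡ i₀ × j ≡ j₀) → M i j ≈ M′ i j) →
      Nonsingular (λ i j → M (punchIn i₀ i) (punchIn j₀ j)) →
      ¬ Nonsingular M → ¬ Nonsingular M′ → M i₀ j₀ ≈ M′ i₀ j₀
    one-singular-entry {m} M M′ i₀ j₀ agree minor singular singular′ = byContradiction λ M≉M′ →
      singular λ r eqs → byContradiction λ r≉0 → singular′ λ r′ eqs′ → byContradiction λ r′≉0 →
      M≉M′ (main r eqs r≉0 r′ eqs′ r′≉0)
      where
      Kernel : (Fin (suc m) → Fin (suc m) → Carrier) → (Fin (suc m) → Carrier) → Set _
      Kernel N r = ∀ i → sum (λ j → r j * N i j) ≈ 0#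

      module _ (N : Fin (suc m) → Fin (suc m) → Carrier)
               (N-minor : Nonsingular (λ i j → N (punchIn i₀ i) (punchIn j₀ j)))
               (r : Fin (suc m) → Carrier) (eqs : Kernel N r) where
        split : ∀ i → r j₀ * N i j₀ + sum (λ j → r (punchIn j₀ j) * N i (punchIn j₀ j)) ≈ 0#
        split i = trans (sym (sum-remove {i = j₀} (λ j → r j * N i j))) (eqs i)

        -- If the entry at `j₀` were zero, the remaining entries would form a kernel vector of the
        -- minor, which has none but zero.
        leading≉0 : ¬ (∀ j → r j ≈ 0#) → ¬ r j₀ ≈ 0#
        leading≉0 r≉0 lead≈0 = r≉0 (by-punchIn j₀ lead≈0 (N-minor (r ∘ punchIn j₀) λ i → begin
          sum (λ j → r (punchIn j₀ j) * N (punchIn i₀ i) (punchIn j₀ j)) ≈⟨ +-identityˡ _ ⟨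
          0# + sum (λ j → r (punchIn j₀ j) * N (punchIn i₀ i) (punchIn j₀ j))
              ≈⟨ +-congʳ (trans (*-congʳ lead≈0) (zeroˡ _)) ⟨
          r j₀ * N (punchIn i₀ i) j₀ + sum (λ j → r (punchIn j₀ j) * N (punchIn i₀ i) (punchIn j₀ j))
              ≈⟨ split _ ⟩
          0# ∎))

      main : ∀ r → Kernel M r → ¬ (∀ j → r j ≈ 0#) → ∀ r′ → Kernel M′ r′ → ¬ (∀ j → r′ j ≈ 0#) →
             M i₀ j₀ ≈ M′ i₀ j₀
      main r eqs r≉0 r′ eqs′ r′≉0 = x-y≈0⇒x≈y _ _ (integral (begin
          (x * y) * (M i₀ j₀ - M′ i₀ j₀) ≈⟨ distribˡ _ _ _ ⟩
          (x * y) * M i₀ j₀ + (x * y) * - M′ i₀ j₀ ≈⟨ +-congʳ swap-last ⟩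
          (x * y) * M′ i₀ j₀ + (x * y) * - M′ i₀ j₀ ≈⟨ distribˡ _ _ _ ⟨
          (x * y) * (M′ i₀ j₀ - M′ i₀ j₀) ≈⟨ trans (*-congˡ (-‿inverseʳ _)) (zeroʳ _) ⟩
          0# ∎) (λ xy≈0 → y≉0 (integral xy≈0 x≉0)))
        where
        x = r j₀
        y = r′ j₀
        x≉0 = leading≉0 M minor r eqs r≉0
        M′-minor : Nonsingular (λ i j → M′ (punchIn i₀ i) (punchIn j₀ j))
        M′-minor = nonsingular-resp (λ i j → agree _ _ (Finₚ.punchInᵢ≢i i₀ i ∘ proj₁)) minor
        y≉0 = leading≉0 M′ M′-minor r′ eqs′ r′≉0
        S S′ : Fin (suc m) → Carrier
        S  i = sum (λ j → r (punchIn j₀ j) * M i (punchIn j₀ j))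
        S′ i = sum (λ j → r′ (punchIn j₀ j) * M i (punchIn j₀ j))
        S′-eq : ∀ i → y * M′ i j₀ + S′ i ≈ 0#
        S′-eq i = trans (+-congˡ (sum-cong-≋ λ j → *-congˡ (agree i _ (Finₚ.punchInᵢ≢i j₀ j ∘ proj₂))))
          (split M′ M′-minor r′ eqs′ i)
        S-eq = split M minor r eqs
        -- The two matrices agree in all rows other than `i₀`, so there `y r − x r′` satisfies the
        -- equations of both. Its entry at `j₀` is zero, hence the minor kills the rest. Row `i₀`
        -- then compares the two exceptional entries.
        proportional : ∀ j → y * r (punchIn j₀ j) ≈ x * r′ (punchIn j₀ j)
        proportional j = x-y≈0⇒x≈y _ _
            (minor (λ j → y * r (punchIn j₀ j) - x * r′ (punchIn j₀ j)) vanish j)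
          where
          vanish : ∀ i → sum (λ j → (y * r (punchIn j₀ j) - x * r′ (punchIn j₀ j)) * M (punchIn i₀ i)
              (punchIn j₀ j)) ≈ 0#
          vanish i = +-cancelʳ (x * S′ k) _ _ (begin
            sum (λ j → (y * r (punchIn j₀ j) - x * r′ (punchIn j₀ j)) * M k (punchIn j₀ j)) + x * S′ k
              ≈⟨ +-congˡ (*-distribˡ-sum x (λ j → r′ (punchIn j₀ j) * M k (punchIn j₀ j))) ⟩
            sum (λ j → (y * r (punchIn j₀ j) - x * r′ (punchIn j₀ j)) * M k (punchIn j₀ j)) + sum
                (λ j → x * (r′ (punchIn j₀ j) * M k (punchIn j₀ j)))
              ≈⟨ ∑-distrib-+ (λ j → (y * r (punchIn j₀ j) - x * r′ (punchIn j₀ j)) * M k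
                  (punchIn j₀ j)) (λ j → x * (r′ (punchIn j₀ j) * M k (punchIn j₀ j))) ⟨
            sum (λ j → (y * r (punchIn j₀ j) - x * r′ (punchIn j₀ j)) * M k (punchIn j₀ j) + x *
                (r′ (punchIn j₀ j) * M k (punchIn j₀ j)))
              ≈⟨ sum-cong-≋ (λ j → recombine (y * r (punchIn j₀ j)) x (r′ (punchIn j₀ j))
                  (M k (punchIn j₀ j))) ⟩
            sum (λ j → (y * r (punchIn j₀ j)) * M k (punchIn j₀ j))
                ≈⟨ sum-cong-≋ (λ j → *-assoc y (r (punchIn j₀ j)) (M k (punchIn j₀ j))) ⟩
            sum (λ j → y * (r (punchIn j₀ j) * M k (punchIn j₀ j)))
                ≈⟨ *-distribˡ-sum y (λ j → r (punchIn j₀ j) * M k (punchIn j₀ j)) ⟨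
            y * S k ≈⟨ +-cancelʳ ((x * y) * M k j₀) _ _ (begin
              y * S k + (x * y) * M k j₀
                  ≈⟨ solve 4 (λ x y s m → y :* s :+ (x :* y) :* m := y :* (x :* m :+ s)) refl x y (S k)
                      (M k j₀) ⟩
              y * (x * M k j₀ + S k) ≈⟨ trans (*-congˡ (S-eq k)) (zeroʳ _) ⟩
              0# ≈⟨ trans (*-congˡ (S′-eq k)) (zeroʳ _) ⟨
              x * (y * M′ k j₀ + S′ k)
                  ≈⟨ *-congˡ (+-congʳ (*-congˡ (agree k j₀ (Finₚ.punchInᵢ≢i i₀ i ∘ proj₁)))) ⟨
              x * (y * M k j₀ + S′ k)
                  ≈⟨ solve 4 (λ x y s m → x :* (y :* m :+ s) := x :* s :+ (x :* y) :* m) refl x y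
                      (S′ k) (M k j₀) ⟩
              x * S′ k + (x * y) * M k j₀ ∎) ⟩
            x * S′ k ≈⟨ +-identityˡ _ ⟨
            0# + x * S′ k ∎)
            where
            k = punchIn i₀ i
            recombine : ∀ u x v m → (u - x * v) * m + x * (v * m) ≈ u * m
            recombine u x v m = begin
              (u - x * v) * m + x * (v * m) ≈⟨ +-congˡ (*-assoc x v m) ⟨
              (u - x * v) * m + (x * v) * m ≈⟨ distribʳ m _ _ ⟨
              ((u - x * v) + x * v) * m ≈⟨ *-congʳ (x-y+y≈x u (x * v)) ⟩
              u * m ∎
        yS≈xS′ : y * S i₀ ≈ x * S′ i₀
        yS≈xS′ = begin
          y * S i₀ ≈⟨ *-distribˡ-sum y (λ j → r (punchIn j₀ j) * M i₀ (punchIn j₀ j)) ⟩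
          sum (λ j → y * (r (punchIn j₀ j) * M i₀ (punchIn j₀ j)))
              ≈⟨ sum-cong-≋ (λ j → trans (sym (*-assoc _ _ _))
                  (trans (*-congʳ (proportional j)) (*-assoc _ _ _))) ⟩
          sum (λ j → x * (r′ (punchIn j₀ j) * M i₀ (punchIn j₀ j)))
              ≈⟨ *-distribˡ-sum x (λ j → r′ (punchIn j₀ j) * M i₀ (punchIn j₀ j)) ⟨
          x * S′ i₀ ∎
        swap-last : (x * y) * M i₀ j₀ ≈ (x * y) * M′ i₀ j₀
        swap-last = +-cancelʳ (y * S i₀) _ _ (begin
          (x * y) * M i₀ j₀ + y * S i₀
              ≈⟨ solve 4 (λ x y s m → (x :* y) :* m :+ y :* s := y :* (x :* m :+ s)) refl x y (S i₀)
                  (M i₀ j₀) ⟩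
          y * (x * M i₀ j₀ + S i₀) ≈⟨ trans (*-congˡ (S-eq i₀)) (zeroʳ _) ⟩
          0# ≈⟨ trans (*-congˡ (S′-eq i₀)) (zeroʳ _) ⟨
          x * (y * M′ i₀ j₀ + S′ i₀)
              ≈⟨ solve 4 (λ x y s m → x :* (y :* m :+ s) := (x :* y) :* m :+ x :* s) refl x y (S′ i₀)
                  (M′ i₀ j₀) ⟩
          (x * y) * M′ i₀ j₀ + x * S′ i₀ ≈⟨ +-congˡ yS≈xS′ ⟨
          (x * y) * M′ i₀ j₀ + y * S i₀ ∎)

-- Families of functions whose combinations have few zeros.

module Families (classical : Classical) (F : CommutativeRing c ℓ) where
  open CommutativeRing F hiding (zero; setoid)
  open Classical classical
  open Membership using (_∈_; _∉_)
  open Choice classical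
  open Sequences classical
  open Matrices classical F
  open SemiringSum semiring using (sum)

  -- Away from a finite set, which may depend on the chosen members, these form a Chebyshev system:
  -- a nontrivial combination of `m` members has fewer than `m` zeros there.
  Good : {S : Set s} {T : Set t} → (S → T → Carrier) → Set _
  Good {S = S} {T} u = ∀ {m} (σ : Fin m → S) → Injective _≡_ _≡_ σ →
    Σ[ E ∈ List T ] ∀ (τ : Fin m → T) → Injective _≡_ _≡_ τ → (∀ i → τ i ∉ E) →
    Nonsingular λ i j → u (σ j) (τ i)

  -- From some index on the sequence avoids the exceptional list, and `m` consecutive terms then
  -- give a nonsingular matrix, so the combination cannot vanish at all of them.
  good-nonvanishing : {S : Set s} {T : Set t} (u : S → T → Carrier) → Good u →
    ∀ {m} (σ : Fin m → S) → Injective _≡_ _≡_ σ → (r : Fin m → Carrier) → ¬ (∀ j → r j ≈ 0#) →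
    (τ : ℕ → T) → Injective _≡_ _≡_ τ → ∃[ n ] ¬ sum (λ j → r j * u (σ j) (τ n)) ≈ 0#
  good-nonvanishing u good σ σ-inj r r≉0 τ τ-inj = byContradiction λ none →
    let (E , nonsingular) = good σ σ-inj
        (N , avoids) = eventually-∉ τ τ-inj E
    in r≉0 (nonsingular (λ i → τ (N ℕ.+ toℕ i))
         (Finₚ.toℕ-injective ∘ ℕₚ.+-cancelˡ-≡ N _ _ ∘ τ-inj)
         (λ i → avoids _ (ℕₚ.m≤m+n N (toℕ i))) r
         λ i → byContradiction λ ≉0 → none (_ , ≉0))

  module OverInfiniteField (inverse : ∀ {x} → ¬ x ≈ 0# → Σ[ y ∈ Carrier ] x * y ≈ 1#)
    (1≉0 : ¬ 1# ≈ 0#) (infinite : Infinite (CommutativeRing.setoid F)) where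

    private
      integral : ∀ {x y} → x * y ≈ 0# → ¬ x ≈ 0# → y ≈ 0#
      integral {x} {y} xy≈0 x≉0 with inverse x≉0
      ... | x⁻¹ , xx⁻¹≈1 =
        trans (sym (*-identityˡ y)) (trans (*-congʳ (trans (sym xx⁻¹≈1) (*-comm x x⁻¹)))
          (trans (*-assoc x⁻¹ x y) (trans (*-congˡ xy≈0) (zeroʳ x⁻¹))))

    open OverField integral 1≉0
    open Quotient (CommutativeRing.setoid F)
      using (Q; class; element; element-class; class-cong; class-injective; element-injective)

    Q-infinite : Infinite (setoid Q)
    Q-infinite (n , bijection) = infinite (n , record
      { to = to ∘ class ; cong = λ eq → ≡.cong to (class-cong eq)
      ; bijective = (λ eq → class-injective (injective eq)) , λ i →
          element (proj₁ (surjective i)) , λ eq → ≡.trans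
            (≡.cong to (element-injective (trans (element-class _) eq)))
                (proj₂ (surjective i) ≡.refl) })
      where
      open Bijection bijection

    reciprocal : Carrier → Carrier
    reciprocal x with em {P = Σ[ y ∈ Carrier ] x * y ≈ 1#}
    ... | yes (y , _) = y
    ... | no _        = 0#

    *-reciprocal : ∀ {x} → ¬ x ≈ 0# → x * reciprocal x ≈ 1#
    *-reciprocal {x} x≉0 with em {P = Σ[ y ∈ Carrier ] x * y ≈ 1#}
    ... | yes (_ , xy≈1) = xy≈1
    ... | no ¬y = ⊥-elim (¬y (inverse x≉0))

    cauchyFamily : Q → Q → Carrier
    cauchyFamily s t = reciprocal (element t - element s)

    cauchyFamily-good : Good cauchyFamily
    -- The exceptional points are the poles, where `reciprocal` returns its default value.
    cauchyFamily-good σ σ-inj = tabulate σ , λ τ τ-inj τ∉σ →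
      cauchy (element ∘ σ) (element ∘ τ) (λ i j → element (τ i) - element (σ j)) _
        (λ i j → x-y+y≈x (element (τ i)) (element (σ j)))
        (λ i j → *-reciprocal λ τ-σ≈0 → τ∉σ i (≡.subst (_∈ tabulate σ)
          (element-injective (sym (x-y≈0⇒x≈y _ _ τ-σ≈0))) (∈-tabulate⁺ j)))
        (σ-inj ∘ element-injective) (τ-inj ∘ element-injective)
      where open AbelianGroupProperties +-abelianGroup using () renaming (x∙y⁻¹≈ε⇒x≈y to x-y≈0⇒x≈y)

    Covered : (Carrier → Set p) → Set _
    Covered P = Σ[ l ∈ List Carrier ] ∀ x → P x → Σ[ y ∈ Carrier ] y ∈ l × x ≈ y

    covered-single : (P : Carrier → Set p) → (∀ {x y} → P x → P y → x ≈ y) → Covered P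
    covered-single P unique with em {P = Σ[ x ∈ Carrier ] P x}
    ... | yes (x , px) = x ∷ [] , λ y py → x , here ≡.refl , unique py px
    ... | no none      = [] , λ y py → ⊥-elim (none (y , py))

    covered-Fin : ∀ {n} (P : Fin n → Carrier → Set p) → (∀ i → Covered (P i)) →
                  Covered (λ x → Σ[ i ∈ Fin n ] P i x)
    covered-Fin P h = concat (tabulate (proj₁ ∘ h)) , λ x (i , pi) →
      let (y , y∈ , x≈y) = proj₂ (h i) x pi in y , ∈-concat⁺′ y∈ (∈-tabulate⁺ i) , x≈y

    covered-below : ∀ n (P : ℕ → Carrier → Set p) → (∀ i → Covered (P i)) →
                    Covered (λ x → Σ[ i ∈ ℕ ] i < n × P i x)
    covered-below zero    P h = [] , λ { x (_ , () , _) }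
    covered-below (suc n) P h =
      let (l , cover) = h zero ; (l′ , cover′) = covered-below n (P ∘ suc) (h ∘ suc) in
      l ++ l′ , λ
        { x (zero , _ , px) → let (y , y∈ , x≈y) = cover x px in y , ∈-++⁺ˡ y∈ , x≈y
        ; x (suc i , s≤s i<n , px) →
            let (y , y∈ , x≈y) = cover′ x (i , i<n , px) in y , ∈-++⁺ʳ l y∈ , x≈y }

    uncovered : (P : Carrier → Set p) → Covered P → Σ[ x ∈ Carrier ] ¬ P x
    uncovered P (l , cover) =
      let (x , x∉) = fresh-element Q-infinite (map class l) in
      element x , λ px → let (y , y∈ , x≈y) = cover (element x) px in
        x∉ (≡.subst (_∈ map class l) (element-injective (trans (element-class y) (sym x≈y)))
            (∈-map⁺ class y∈))

    -- The next value only has to avoid, for each of the finitely many matrices in which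
    -- it occurs, the single value that makes the matrix singular.
    Generic : ℕ → (ℕ → Carrier) → Set _
    Generic n q = ∀ m (e : Fin m → Fin m → ℕ) → Injective₂ e → (∀ i j → e i j < n) →
                  Nonsingular λ i j → q (e i j)

    private
      -- Square arrays of indices below `n` are coded by one finite type, so that a condition over
      -- all of them becomes a finite union for `covered-Fin`.
      decode : ∀ m n → Fin (n ℕ.^ (m ℕ.* m)) → Fin m → Fin m → ℕ
      decode m n f i j = toℕ (finToFun f (combine i j))

      encode : ∀ {m n} (e : Fin m → Fin m → ℕ) (e< : ∀ i j → e i j < n) →
               Σ[ f ∈ Fin (n ℕ.^ (m ℕ.* m)) ] ∀ i j → decode m n f i j ≡ e i j
      encode {m} {n} e e< = funToFin entry , λ i j →
        ≡.trans (≡.cong toℕ (Finₚ.finToFun-funToFin entry (combine i j)))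
          (≡.trans (Finₚ.toℕ-fromℕ< (bound (combine i j)))
              (≡.cong (λ (i , j) → e i j) (Finₚ.remQuot-combine i j)))
        where
        position : Fin (m ℕ.* m) → Fin m × Fin m
        position = remQuot m
        bound : ∀ k → e (proj₁ (position k)) (proj₂ (position k)) < n
        bound k = e< (proj₁ (position k)) (proj₂ (position k))
        entry : Fin (m ℕ.* m) → Fin n
        entry k = fromℕ< (bound k)

      module _ (n : ℕ) (q : ℕ → Carrier) (generic : Generic n q) where

        Bad : ∀ m → Fin (suc n ℕ.^ (suc m ℕ.* suc m)) → Fin (suc m) → Fin (suc m) → Carrier → Set _
        Bad m f i₀ j₀ x = Injective₂ e × e i₀ j₀ ≡ n × ¬ Nonsingular (λ i j → update q n x (e i j))
          where e = decode (suc m) (suc n) f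

        -- Injectivity of the array puts the index `n` at a single position, and the complementary
        -- minor involves older values only, so it is nonsingular by genericity. Hence
        -- `one-singular-entry` applies.
        bad-unique : ∀ m f i₀ j₀ {x y} → Bad m f i₀ j₀ x → Bad m f i₀ j₀ y → x ≈ y
        bad-unique m f i₀ j₀ {x} {y} (e-inj , eq , singular) (_ , _ , singular′) =
          trans (reflexive (≡.sym (value x))) (trans
            (one-singular-entry (λ i j → update q n x (e i j)) (λ i j → update q n y (e i j)) i₀ j₀
              (λ i j ne → trans (off i j ne) (sym (off i j ne)))
              (nonsingular-resp (λ i j → sym (off _ _ (Finₚ.punchInᵢ≢i i₀ i ∘ proj₁)))
                (generic m (λ i j → e (punchIn i₀ i) (punchIn j₀ j))
                  (λ eq → let (eqᵢ , eqⱼ) = e-inj eq in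
                    Finₚ.punchIn-injective i₀ _ _ eqᵢ , Finₚ.punchIn-injective j₀ _ _ eqⱼ)
                  λ i j → ℕₚ.≤∧≢⇒< (ℕₚ.≤-pred (Finₚ.toℕ<n _))
                    (≢n _ _ (Finₚ.punchInᵢ≢i i₀ i ∘ proj₁))))
              singular singular′)
            (reflexive (value y)))
          where
          e = decode (suc m) (suc n) f
          value : ∀ x → update q n x (e i₀ j₀) ≡ x
          value x = ≡.trans (≡.cong (update q n x) eq) (update-at q n x)
          ≢n : ∀ i j → ¬ (i ≡ i₀ × j ≡ j₀) → e i j ≢ n
          ≢n i j ne e≡n = ne (e-inj (≡.trans e≡n (≡.sym eq)))
          off : ∀ {x} i j → ¬ (i ≡ i₀ × j ≡ j₀) → update q n x (e i j) ≈ q (e i j)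
          off i j ne = reflexive (update-off q n _ (≢n i j ne))

        SomeBad : Carrier → Set _
        SomeBad x = Σ[ m ∈ ℕ ] m < suc n × Σ[ f ∈ _ ] Σ[ i ∈ _ ] Σ[ j ∈ _ ] Bad m f i j x

        extend : ∀ x → ¬ SomeBad x → Generic (suc n) (update q n x)
        extend x ¬bad m e e-inj e< with em {P = Σ[ i ∈ Fin m ] Σ[ j ∈ Fin m ] e i j ≡ n}
        ... | no e≢n = nonsingular-resp
                (λ i j → reflexive (≡.sym (update-off q n x λ eq → e≢n (i , j , eq))))
                (generic m e e-inj λ i j → ℕₚ.≤∧≢⇒< (ℕₚ.≤-pred (e< i j)) λ eq → e≢n (i , j , eq))
        extend x ¬bad (suc m) e e-inj e< | yes (i , j , eq) = byContradiction λ singular →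
          ¬bad (m , m<1+n , f , i , j ,
            (λ eq → e-inj (≡.trans (≡.sym (f≗e _ _)) (≡.trans eq (f≗e _ _)))) ,
            ≡.trans (f≗e i j) eq ,
            λ nonsingular → singular
                (nonsingular-resp (λ i j → reflexive (≡.cong (update q n x) (f≗e i j))) nonsingular))
          where
          f = proj₁ (encode e e<)
          f≗e = proj₂ (encode e e<)
          -- Column `j` of `e` has `suc m` distinct indices below `suc n`; this bounds the sizes of
          -- the matrices that have to be considered.
          m<1+n : m < suc n
          m<1+n = Finₚ.injective⇒≤ {f = λ k → fromℕ< (e< k j)} λ {k} {k′} eq →
            proj₁ (e-inj (≡.trans (≡.sym (Finₚ.toℕ-fromℕ< (e< k j)))
              (≡.trans (≡.cong toℕ eq) (Finₚ.toℕ-fromℕ< (e< k′ j)))))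

        next : Σ[ x ∈ Carrier ] Generic (suc n) (update q n x)
        next = let (x , ¬bad) = avoid in x , extend x ¬bad
          where
          avoid : Σ[ x ∈ Carrier ] ¬ SomeBad x
          avoid = uncovered SomeBad (covered-below (suc n) _ λ m →
            covered-Fin _ λ f → covered-Fin _ λ i → covered-Fin _ λ j →
              covered-single (Bad m f i j) (bad-unique m f i j))

    generic-sequence : Σ[ q ∈ (ℕ → Carrier) ] ∀ {m} (e : Fin m → Fin m → ℕ) → Injective₂ e →
                       Nonsingular λ i j → q (e i j)
    generic-sequence =
      let (q , generic) = build-sequence Generic local (λ _ → 0#) base next in
      q , λ e e-inj →
        let (N , e<) = uniform-bound (λ i n → ∀ j → e i j < n) λ i →
                         uniform-bound (λ j n → e i j < n) λ j → suc (e i j) , λ _ → id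
        in generic N _ e e-inj (e< N ℕₚ.≤-refl)
      where
      local : ∀ {n q q′} → (∀ i → i < n → q i ≡ q′ i) → Generic n q → Generic n q′
      local eq g m e e-inj e< = nonsingular-resp (λ i j → reflexive (eq _ (e< i j))) (g m e e-inj e<)
      base : Generic 0 (λ _ → 0#)
      base m e _ e< r _ j with () ← e< j j

    prefix : (ℕ → Bool) → ℕ → List Bool
    prefix x zero    = []
    prefix x (suc n) = x n ∷ prefix x n

    prefix-length : ∀ x n → length (prefix x n) ≡ n
    prefix-length x zero    = ≡.refl
    prefix-length x (suc n) = ≡.cong suc (prefix-length x n)

    prefix-injective : ∀ {x y} n → prefix x n ≡ prefix y n → ∀ i → i < n → x i ≡ y i
    prefix-injective (suc n) eq i i<1+n with ℕₚ.m<1+n⇒m<n∨m≡n i<1+n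
    ... | inj₁ i<n = prefix-injective n (Listₚ.∷-injectiveʳ eq) i i<n
    ... | inj₂ ≡.refl = Listₚ.∷-injectiveˡ eq

    private
      -- The constructors of `ℕᵇ` are the digits of bijective base-two numeration, so finite binary
      -- words are coded without collisions.
      code : List Bool → ℕᵇ.ℕᵇ
      code []          = ℕᵇ.zero
      code (true ∷ l)  = ℕᵇ.2[1+ code l ]
      code (false ∷ l) = ℕᵇ.1+[2 code l ]

      code-injective : Injective _≡_ _≡_ code
      code-injective {[]} {[]} eq = ≡.refl
      code-injective {[]} {true ∷ _} ()
      code-injective {[]} {false ∷ _} ()
      code-injective {true ∷ _} {[]} ()
      code-injective {false ∷ _} {[]} ()
      code-injective {true ∷ l} {false ∷ l′} ()
      code-injective {false ∷ l} {true ∷ l′} ()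
      code-injective {true ∷ l} {true ∷ l′} eq =
        ≡.cong (true ∷_) (code-injective (ℕᵇₚ.2[1+_]-injective eq))
      code-injective {false ∷ l} {false ∷ l′} eq = ≡.cong (false ∷_)
          (code-injective (ℕᵇₚ.1+[2_]-injective eq))

    -- Distinct branches of the binary tree eventually pass through distinct nodes.
    module _ {S : Set s} (branch : S → ℕ → Bool)
      (branch-inj : ∀ {x y} → branch x ≗ branch y → x ≡ y) where

      branchFamily : S → ℕ → Carrier
      branchFamily x n = proj₁ generic-sequence (ℕᵇ.toℕ (code (prefix (branch x) n)))

      branchFamily-good : Good branchFamily
      branchFamily-good {m} σ σ-inj =
        let (N , separated) = uniform-bound (λ i n → ∀ j → Separated i j n) λ i →
                                uniform-bound (Separated i) (separate i)
        -- Below level `N` the chosen branches may share nodes. Beyond it a node determines its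
        -- level by its length, and then its branch by separation.
        in upTo N , λ τ τ-inj τ∉ → proj₂ generic-sequence _ λ {i} {j} {i′} {j′} eq →
          let prefixes = code-injective (ℕᵇₚ.toℕ-injective eq)
              i≡i′ = τ-inj (≡.trans (≡.sym (prefix-length (branch (σ j)) (τ i)))
                  (≡.trans (≡.cong length prefixes) (prefix-length (branch (σ j′)) (τ i′))))
          in i≡i′ , separated (τ i) (ℕₚ.≮⇒≥ λ τ<N → τ∉ i (∈-upTo⁺ τ<N)) j j′
               (≡.trans prefixes (≡.cong (λ i → prefix (branch (σ j′)) (τ i)) (≡.sym i≡i′)))
        where
        Separated : Fin m → Fin m → ℕ → Set
        Separated i j n = prefix (branch (σ i)) n ≡ prefix (branch (σ j)) n → i ≡ j
        separate : ∀ i j → ∃[ N ] ∀ n → N ≤ n → Separated i j n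
        separate i j with em {P = i ≡ j}
        ... | yes i≡j = 0 , λ _ _ _ → i≡j
        ... | no i≢j =
          let (k , differ) = byContradiction λ (none : ¬ (∃[ k ] branch (σ i) k ≢ branch (σ j) k)) →
                i≢j (σ-inj (branch-inj λ k → byContradiction λ ne → none (k , ne)))
          in suc k , λ n k<n eq → ⊥-elim (differ (prefix-injective n eq k k<n))

-- Linear independence over a domain and the exchange of independent families.

∷ᶠ-injective : ∀ {A : Set a} {m} {x : A} {f : Fin m → A} → (∀ j → f j ≢ x) → Injective _≡_ _≡_ f →
              Injective _≡_ _≡_ (x ∷ᶠ f)
∷ᶠ-injective new inj {zero}  {zero}  eq = ≡.refl
∷ᶠ-injective new inj {zero}  {suc j} eq = ⊥-elim (new j (≡.sym eq))
∷ᶠ-injective new inj {suc i} {zero}  eq = ⊥-elim (new i eq)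
∷ᶠ-injective new inj {suc i} {suc j} eq = ≡.cong suc (inj eq)

module Dimension (classical : Classical) {R : CommutativeRing c ℓ}
  (integral : ∀ {x y} → CommutativeRing._≈_ R (CommutativeRing._*_ R x y) (CommutativeRing.0# R) →
    CommutativeRing._≈_ R x (CommutativeRing.0# R) ⊎ CommutativeRing._≈_ R y (CommutativeRing.0# R))
  (1≉0 : ¬ CommutativeRing._≈_ R (CommutativeRing.1# R) (CommutativeRing.0# R))
  (M : Module R b ℓ₁) where

  open Classical classical
  open Choice classical
  open CommutativeRing R using (0#; 1#; _*_; -_; -‿inverseʳ; *-comm)
    renaming (Carrier to ∣R∣; _≈_ to _≈ᴿ_; sym to ≈ᴿ-sym; trans to ≈ᴿ-trans)
  open Module M
  open AbelianGroupProperties +ᴹ-abelianGroup using ()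
    renaming (inverseʳ-unique to +ᴹ-inverseʳ-unique)
  open AbelianGroupProperties (CommutativeRing.+-abelianGroup R) using ()
    renaming (⁻¹-involutive to -‿involutive; ε⁻¹≈ε to -0≈0)
  open CommutativeMonoidSum +ᴹ-commutativeMonoid using (sum; sum-remove; sum-cong-≋)
  open SetoidReasoning ≈ᴹ-setoid

  *ₗ-swap : ∀ r s x → r *ₗ (s *ₗ x) ≈ᴹ s *ₗ (r *ₗ x)
  *ₗ-swap r s x = ≈ᴹ-trans (≈ᴹ-sym (*ₗ-assoc r s x)) (≈ᴹ-trans (*ₗ-congʳ (*-comm r s)) (*ₗ-assoc s r x))

  neg-*ₗ : ∀ r x → r *ₗ x +ᴹ (- r) *ₗ x ≈ᴹ 0ᴹ
  neg-*ₗ r x = ≈ᴹ-trans (≈ᴹ-sym (*ₗ-distribʳ x r (- r))) (≈ᴹ-trans (*ₗ-congʳ (-‿inverseʳ r))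
      (*ₗ-zeroˡ x))

  -- Independence is that of an indexed family instead of a subset, so that a repeated value counts
  -- as a dependence. The exchange needs this when a member of the family coincides with a basis
  -- element.
  IndependentOn : {T : Set t} → (T → Carrierᴹ) → Pred T p → Set _
  IndependentOn {T = T} e P = ∀ m (x : Fin m → T) → (∀ j → P (x j)) → Injective _≡_ _≡_ x →
    ∀ (r : Fin m → ∣R∣) → sum (λ j → r j *ₗ e (x j)) ≈ᴹ 0ᴹ → ∀ j → r j ≈ᴿ 0#

  Independent : {T : Set t} → (T → Carrierᴹ) → Set _
  Independent {T = T} e = ∀ m (x : Fin m → T) → Injective _≡_ _≡_ x →
    ∀ (r : Fin m → ∣R∣) → sum (λ j → r j *ₗ e (x j)) ≈ᴹ 0ᴹ → ∀ j → r j ≈ᴿ 0#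

  independent-⊆ : {T : Set t} (e : T → Carrierᴹ) (Q : Pred T p′) {P : Pred T p} →
                  (∀ {x} → P x → Q x) → IndependentOn e Q → IndependentOn e P
  independent-⊆ e Q P⊆Q ind m x x∈P = ind m x (λ j → P⊆Q (x∈P j))

  module _ {T : Set t} (e : T → Carrierᴹ) where

    data Span (P : Pred T p) : Carrierᴹ → Set (c ⊔ b ⊔ ℓ₁ ⊔ t ⊔ p) where
      nil  : ∀ {x} → x ≈ᴹ 0ᴹ → Span P x
      cons : ∀ {x y} r z → P z → Span P y → x ≈ᴹ r *ₗ e z +ᴹ y → Span P x

    module _ {P : Pred T p} where

      span-resp : ∀ {x y} → x ≈ᴹ y → Span P x → Span P y
      span-resp eq (nil x≈0) = nil (≈ᴹ-trans (≈ᴹ-sym eq) x≈0)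
      span-resp eq (cons r z z∈P s x≈) = cons r z z∈P s (≈ᴹ-trans (≈ᴹ-sym eq) x≈)

      span-+ : ∀ {x y} → Span P x → Span P y → Span P (x +ᴹ y)
      span-+ (nil x≈0) s = span-resp (≈ᴹ-sym (≈ᴹ-trans (+ᴹ-congʳ x≈0) (+ᴹ-identityˡ _))) s
      span-+ (cons r z z∈P s x≈) s′ =
        cons r z z∈P (span-+ s s′) (≈ᴹ-trans (+ᴹ-congʳ x≈) (+ᴹ-assoc _ _ _))

      span-* : ∀ {x} r → Span P x → Span P (r *ₗ x)
      span-* r (nil x≈0) = nil (≈ᴹ-trans (*ₗ-congˡ x≈0) (*ₗ-zeroʳ r))
      span-* r (cons r′ z z∈P s x≈) = cons (r * r′) z z∈P (span-* r s)
        (≈ᴹ-trans (*ₗ-congˡ x≈) (≈ᴹ-trans (*ₗ-distribˡ r _ _) (+ᴹ-congʳ (≈ᴹ-sym (*ₗ-assoc r r′ _)))))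

      span-e : ∀ {z} → P z → Span P (e z)
      span-e {z} z∈P = cons 1# z z∈P (nil ≈ᴹ-refl) (≈ᴹ-sym (≈ᴹ-trans (+ᴹ-identityʳ _) (*ₗ-identityˡ _)))

      span-sum : ∀ {m} (x : Fin m → T) → (∀ j → P (x j)) → ∀ (r : Fin m → ∣R∣) →
          Span P (sum (λ j → r j *ₗ e (x j)))
      span-sum {zero}  x x∈P r = nil ≈ᴹ-refl
      span-sum {suc m} x x∈P r = cons (r zero) (x zero) (x∈P zero)
          (span-sum (x ∘ suc) (x∈P ∘ suc) (r ∘ suc)) ≈ᴹ-refl

      span-complement : ∀ {x y} → x +ᴹ y ≈ᴹ 0ᴹ → Span P y → Span P x
      span-complement {x} {y} eq s = span-resp (≈ᴹ-trans
        (+ᴹ-inverseʳ-unique y _ (≈ᴹ-trans (+ᴹ-congʳ (≈ᴹ-sym (*ₗ-identityˡ y))) (neg-*ₗ 1# y)))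
        (≈ᴹ-sym (+ᴹ-inverseʳ-unique y x (≈ᴹ-trans (+ᴹ-comm y x) eq))))
        (span-* (- 1#) s)

      add-term : ∀ {m} (x : Fin m → T) (r : Fin m → ∣R∣) (k : Fin m) s →
        Σ[ r′ ∈ (Fin m → ∣R∣) ]
          s *ₗ e (x k) +ᴹ sum (λ j → r j *ₗ e (x j)) ≈ᴹ sum (λ j → r′ j *ₗ e (x j))
      add-term x r zero s = (CommutativeRing._+_ R s (r zero)) ∷ᶠ (r ∘ suc) ,
        ≈ᴹ-trans (≈ᴹ-sym (+ᴹ-assoc _ _ _)) (+ᴹ-congʳ (≈ᴹ-sym (*ₗ-distribʳ _ s (r zero))))
      add-term x r (suc k) s = let (r′ , eq) = add-term (x ∘ suc) (r ∘ suc) k s in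
        r zero ∷ᶠ r′ , ≈ᴹ-trans (≈ᴹ-sym (+ᴹ-assoc _ _ _)) (≈ᴹ-trans (+ᴹ-congʳ (+ᴹ-comm _ _))
          (≈ᴹ-trans (+ᴹ-assoc _ _ _) (+ᴹ-congˡ eq)))

      -- `Span` allows a generator to recur, while independence speaks of distinct indices;
      -- recurring generators are merged by `add-term`.
      span⇒combination : ∀ {x} → Span P x →
        Σ[ m ∈ ℕ ] Σ[ y ∈ (Fin m → T) ] (∀ j → P (y j)) × Injective _≡_ _≡_ y ×
        (Σ[ r ∈ (Fin m → ∣R∣) ] x ≈ᴹ sum (λ j → r j *ₗ e (y j)))
      span⇒combination (nil x≈0) = 0 , (λ ()) , (λ ()) , (λ { {()} }) , (λ ()) , x≈0
      span⇒combination (cons s z z∈P sp x≈) with span⇒combination sp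
      ... | m , y , y∈P , inj , r , eq with em {P = Σ[ k ∈ Fin m ] y k ≡ z}
      ...   | yes (k , ≡.refl) = let (r′ , eq′) = add-term y r k s in
                m , y , y∈P , inj , r′ , ≈ᴹ-trans x≈ (≈ᴹ-trans (+ᴹ-congˡ eq) eq′)
      ...   | no z-new = suc m , z ∷ᶠ y , (λ { zero → z∈P ; (suc j) → y∈P j }) ,
                ∷ᶠ-injective (λ j y≡z → z-new (j , y≡z)) inj , s ∷ᶠ r , ≈ᴹ-trans x≈ (+ᴹ-congˡ eq)

    -- This is membership in the span over the field of fractions, stated without fractions.
    PureClosure : Pred T p → Carrierᴹ → Set _
    PureClosure P x = Σ[ s ∈ ∣R∣ ] ¬ s ≈ᴿ 0# × Span P (s *ₗ x)

    closure-e : ∀ {P : Pred T p} {z} → P z → PureClosure P (e z)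
    closure-e z∈P = 1# , 1≉0 , span-resp (≈ᴹ-sym (*ₗ-identityˡ _)) (span-e z∈P)

    -- A nontrivial relation must involve `z`, with a nonzero coefficient, because the members of
    -- `P` alone are independent. Solving for that term puts a multiple of `e z` in the span.
    dependent⇒closure : {P : Pred T p} → IndependentOn e P → ∀ z →
      ¬ IndependentOn e (λ x → P x ⊎ x ≡ z) → PureClosure P (e z)
    dependent⇒closure {P = P} ind z dependent = byContradiction λ no-relation →
      dependent λ m x x∈ inj r eq → byContradiction λ r≉0 → no-relation (find m x x∈ inj r eq r≉0)
      where
      find : ∀ m (x : Fin m → T) → (∀ j → P (x j) ⊎ x j ≡ z) → Injective _≡_ _≡_ x →
          ∀ (r : Fin m → ∣R∣) →
             sum (λ j → r j *ₗ e (x j)) ≈ᴹ 0ᴹ → ¬ (∀ j → r j ≈ᴿ 0#) → PureClosure P (e z)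
      find m x x∈ inj r eq r≉0 with em {P = Σ[ j ∈ Fin m ] x j ≡ z}
      ... | no avoids = ⊥-elim
          (r≉0 (ind m x (λ j → [ id , (λ x≡z → ⊥-elim (avoids (j , x≡z))) ]′ (x∈ j)) inj r eq))
      find (suc m) x x∈ inj r eq r≉0 | yes (k , ≡.refl) =
        r k , rk≉0 , span-complement split (span-sum (x ∘ punchIn k) others (r ∘ punchIn k))
        where
        split = ≈ᴹ-trans (≈ᴹ-sym (sum-remove {i = k} (λ j → r j *ₗ e (x j)))) eq
        others : ∀ j → P (x (punchIn k j))
        others j = [ id , (λ eq → ⊥-elim (Finₚ.punchInᵢ≢i k j (inj eq))) ]′ (x∈ (punchIn k j))
        rk≉0 : ¬ r k ≈ᴿ 0#
        rk≉0 rk≈0 = r≉0 (by-punchIn k rk≈0 (ind m (x ∘ punchIn k) others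
          (Finₚ.punchIn-injective k _ _ ∘ inj) (r ∘ punchIn k)
          (≈ᴹ-trans (≈ᴹ-sym (≈ᴹ-trans (+ᴹ-congʳ (≈ᴹ-trans (*ₗ-congʳ rk≈0) (*ₗ-zeroˡ _)))
              (+ᴹ-identityˡ _))) split)))

    closure-root : ∀ {P : Pred T p} {s x} → ¬ s ≈ᴿ 0# → PureClosure P (s *ₗ x) → PureClosure P x
    closure-root {s = s} s≉0 (s′ , s′≉0 , sp) =
      s′ * s , [ s′≉0 , s≉0 ]′ ∘ integral , span-resp (≈ᴹ-sym (*ₗ-assoc s′ s _)) sp

    not-in-closure : {P : Pred T p} {z : T} → IndependentOn e (λ x → P x ⊎ x ≡ z) →
                     (∀ {x} → P x → x ≢ z) → ¬ PureClosure P (e z)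
    not-in-closure {z = z} ind z∉P (s , s≉0 , sp) =
      let (m , y , y∈P , inj , r , eq) = span⇒combination sp
      in s≉0 (≈ᴿ-trans (≈ᴿ-sym (-‿involutive s)) (≈ᴿ-trans (CommutativeRing.-‿cong R
           (ind (suc m) (z ∷ᶠ y) (λ { zero → inj₂ ≡.refl ; (suc j) → inj₁ (y∈P j) })
             (∷ᶠ-injective (z∉P ∘ y∈P) inj) ((- s) ∷ᶠ r)
             (≈ᴹ-trans (+ᴹ-congˡ (≈ᴹ-sym eq)) (≈ᴹ-trans (+ᴹ-comm _ _) (neg-*ₗ s (e z)))) zero)) -0≈0))

  -- Denominators are multiplied together, and the product is nonzero in a domain.
  closure-trans : {T : Set t} {e : T → Carrierᴹ} {P : Pred T p} {T′ : Set t′} {e′ : T′ →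
      Carrierᴹ} {Q : Pred T′ p′} →
    (∀ z → P z → PureClosure e′ Q (e z)) → ∀ {x} → Span e P x → PureClosure e′ Q x
  closure-trans h (nil x≈0) = 1# , 1≉0 , nil (≈ᴹ-trans (*ₗ-identityˡ _) x≈0)
  closure-trans {e = e} {e′ = e′} h (cons {x} {y} r z z∈P sp x≈) with h z z∈P | closure-trans h sp
  ... | s , s≉0 , s-span | s′ , s′≉0 , s′-span =
    s * s′ , [ s≉0 , s′≉0 ]′ ∘ integral , span-resp e′ (≈ᴹ-sym (begin
      (s * s′) *ₗ x                               ≈⟨ *ₗ-congˡ x≈ ⟩
      (s * s′) *ₗ (r *ₗ e z +ᴹ y)                 ≈⟨ *ₗ-distribˡ _ _ _ ⟩
      (s * s′) *ₗ (r *ₗ e z) +ᴹ (s * s′) *ₗ y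
        ≈⟨ +ᴹ-cong (≈ᴹ-trans (*ₗ-congʳ (*-comm s s′))
            (≈ᴹ-trans (*ₗ-assoc s′ s _) (*ₗ-congˡ (*ₗ-swap s r _)))) (*ₗ-assoc s s′ y) ⟩
      s′ *ₗ (r *ₗ (s *ₗ e z)) +ᴹ s *ₗ (s′ *ₗ y)   ∎))
      (span-+ e′ (span-* e′ s′ (span-* e′ r s-span)) (span-* e′ s s′-span))

  open Quotient ≈ᴹ-setoid
    using (Q; class; element; element-class; class-cong; class-injective; element-injective)

  module _ {X : Pred Carrierᴹ (b ⊔ ℓ₁)} (basis : IsMaximalLinearlyIndependent M X) where
    open IsMaximalLinearlyIndependent basis

    basis-independent : IndependentOn element (X ∘ element)
    basis-independent m x x∈ inj r eq = independent m (element ∘ x) r x∈ (inj ∘ element-injective) eq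

    -- Either adjoining `y` creates a dependence, which yields a multiple of `y` in the span, or it
    -- does not, and maximality puts `y` in `X` already.
    basis-spans : ∀ y → PureClosure element (X ∘ element) y
    basis-spans y with em {P = IndependentOn element (λ z → X (element z) ⊎ z ≡ class y)}
    ... | no dependent =
          let (s , s≉0 , sp) = dependent⇒closure element basis-independent (class y) dependent in
          s , s≉0 , span-resp element (*ₗ-congˡ (element-class y)) sp
    ... | yes ind = 1# , 1≉0 , span-resp element (≈ᴹ-trans (element-class y) (≈ᴹ-sym (*ₗ-identityˡ y)))
            (span-e element {z = class y} (respects (≈ᴹ-sym (element-class y)) y∈X))
      where
      Y : Pred Carrierᴹ (b ⊔ ℓ₁)
      Y z = X z ⊎ class z ≡ class y
      Y-independent : LinearlyIndependent M Y
      Y-independent m x r x∈ inj eq = ind m (class ∘ x)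
        (λ j → [ inj₁ ∘ respects (≈ᴹ-sym (element-class (x j))) , inj₂ ]′ (x∈ j))
        (inj ∘ class-injective) r
        (≈ᴹ-trans (sum-cong-≋ λ j → *ₗ-congˡ (element-class (x j))) eq)
      y∈X : X y
      y∈X = maximal Y (λ u≈v → [ inj₁ ∘ respects u≈v , inj₂ ∘ ≡.trans (class-cong (≈ᴹ-sym u≈v)) ]′)
        Y-independent inj₁ (inj₂ ≡.refl)

    -- Exchange the members of the independent family one by one for members of the
    -- basis.  A maximal exchange is complete: if s is left over, some x in the basis is
    -- outside the pure closure of what remains when s is dropped, and may replace it.
    module Exchange {S : Set s} (v : S → Carrierᴹ) (v-independent : Independent v) where

      private
        e : S ⊎ Q → Carrierᴹ
        e = [ v , element ]′

        -- `G` is the graph of a partial injection from `S` to the basis. What remains are the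
        -- indices in `S` not yet exchanged, together with the basis elements that have replaced the
        -- others.
        data Remaining (G : S × Q → Bool) : Pred (S ⊎ Q) (s ⊔ b) where
          kept : ∀ {z} → (∀ x → ¬ G (z , x) ≡ true) → Remaining G (inj₁ z)
          used : ∀ {z x} → G (z , x) ≡ true → Remaining G (inj₂ x)

        record Φ (G : S × Q → Bool) : Set (c ⊔ ℓ ⊔ s ⊔ b ⊔ ℓ₁) where
          field
            within      : ∀ {z x} → G (z , x) ≡ true → X (element x)
            functional  : ∀ {z x y} → G (z , x) ≡ true → G (z , y) ≡ true → x ≡ y
            injective   : ∀ {z w x} → G (z , x) ≡ true → G (w , x) ≡ true → z ≡ w
            independent : IndependentOn e (Remaining G)
        open Φ

        Φ-resp : ∀ {G H} → G ≗ H → Φ G → Φ H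
        Φ-resp {G} {H} eq φ = record
          { within      = λ h → within φ (≡.trans (eq _) h)
          ; functional  = λ h h′ → functional φ (≡.trans (eq _) h) (≡.trans (eq _) h′)
          ; injective   = λ h h′ → injective φ (≡.trans (eq _) h) (≡.trans (eq _) h′)
          ; independent = independent-⊆ e (Remaining G) {Remaining H} (λ
              { (kept h) → kept λ x g → h x (≡.trans (≡.sym (eq _)) g)
              ; (used g) → used (≡.trans (eq _) g) }) (independent φ) }

        Φ-∅ : Φ (λ _ → false)
        Φ-∅ = record
          { within = λ () ; functional = λ () ; injective = λ ()
          ; independent = λ m x x∈ inj r eq →
              let (σ , x≡σ) = choose m x x∈
              in v-independent m σ (λ {i} {j} σ≡ →
                  inj (≡.trans (x≡σ i) (≡.trans (≡.cong inj₁ σ≡) (≡.sym (x≡σ j))))) r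
                   (≈ᴹ-trans (sum-cong-≋ λ j → *ₗ-congˡ (≈ᴹ-reflexive (≡.cong e (≡.sym (x≡σ j))))) eq) }
          where
          only : ∀ {x} → Remaining (λ _ → false) x → Σ[ z ∈ S ] x ≡ inj₁ z
          only (kept {z} _) = z , ≡.refl
          only (used ())
          choose : ∀ m (x : Fin m → S ⊎ Q) → (∀ j → Remaining (λ _ → false) (x j)) →
                   Σ[ σ ∈ (Fin m → S) ] ∀ j → x j ≡ inj₁ (σ j)
          choose m x x∈ = proj₁ ∘ only ∘ x∈ , proj₂ ∘ only ∘ x∈

        module _ (F : (S × Q → Bool) → Bool) (inhabited : ∃[ G ] F G ≡ true)
          (chain : Chain F)
          (φ : ∀ {G} → F G ≡ true → Φ G) where

          common : ∀ {p q} → ⋃ F p ≡ true → ⋃ F q ≡ true →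
                   Σ[ G ∈ _ ] F G ≡ true × G p ≡ true × G q ≡ true
          common = ⋃-common F chain

          -- A kept index is kept by every member of the chain, and a used basis element is used
          -- from some member on. Finitely many indices therefore remain in one common member, where
          -- independence is known.
          Eventually : (m : ℕ) → (Fin m → S ⊎ Q) → Set _
          Eventually m x = Σ[ G ∈ _ ] F G ≡ true × (∀ H → F H ≡ true → G ⊑ H → ∀ j → Remaining H (x j))

          eventually : ∀ {x} → Remaining (⋃ F) x → Eventually 1 (λ _ → x)
          eventually (kept h) = proj₁ inhabited , proj₂ inhabited , λ H H∈F _ _ →
            kept λ x g → h x (χ⁺ (H , H∈F , g))
          eventually (used g) = let (G , G∈F , g′) = χ⁻ g in
            G , G∈F , λ H H∈F G⊑H _ → used (G⊑H _ g′)

          eventually-∷ : ∀ {m} {x : Fin (suc m) → S ⊎ Q} →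
            Eventually 1 (λ _ → x zero) → Eventually m (x ∘ suc) → Eventually (suc m) x
          eventually-∷ (G , G∈F , g) (H , H∈F , h) =
            [ (λ G⊑H → H , H∈F , λ K K∈F H⊑K → λ
                { zero → g K K∈F (λ p → H⊑K p ∘ G⊑H p) zero ; (suc j) → h K K∈F H⊑K j })
            , (λ H⊑G → G , G∈F , λ K K∈F G⊑K → λ
                { zero → g K K∈F G⊑K zero ; (suc j) → h K K∈F (λ p → G⊑K p ∘ H⊑G p) j })
            ]′ (chain G∈F H∈F)

          all-eventually : ∀ m (x : Fin m → S ⊎ Q) → (∀ j → Remaining (⋃ F) (x j)) → Eventually m x
          all-eventually zero    x x∈ = proj₁ inhabited , proj₂ inhabited , λ _ _ _ ()
          all-eventually (suc m) x x∈ = eventually-∷ (eventually (x∈ zero))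
              (all-eventually m (x ∘ suc) (x∈ ∘ suc))

          Φ-⋃ : Φ (⋃ F)
          Φ-⋃ = record
            { within      = λ g → let (G , G∈F , g′) = χ⁻ g in within (φ G∈F) g′
            ; functional  = λ g h → let (G , G∈F , g′ , h′) = common g h in functional (φ G∈F) g′ h′
            ; injective   = λ g h → let (G , G∈F , g′ , h′) = common g h in injective (φ G∈F) g′ h′
            ; independent = λ m x x∈ → let (G , G∈F , g) = all-eventually m x x∈ in
                independent (φ G∈F) m x (g G G∈F λ _ → id) }

        open Zorn Φ Φ-resp Φ-∅ Φ-⋃

        module _ (G : S × Q → Bool) (φ : Φ G) (stuck : ∀ p → G p ≡ false → ¬ Φ (insert G p)) where

          module _ (z : S) (z∉dom : ∀ x → ¬ G (z , x) ≡ true) where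

            Rest : Pred (S ⊎ Q) (s ⊔ b)
            Rest y = Remaining G y × y ≢ inj₁ z

            extended : ∀ x → X (element x) → (∀ w → ¬ G (w , x) ≡ true) →
                       IndependentOn e (λ y → Rest y ⊎ y ≡ inj₂ x) → Φ (insert G (z , x))
            extended x x∈X x∉ran ind = record
              { within = λ g → [ within φ , (λ { ≡.refl → x∈X }) ]′ (old-or-new g)
              ; functional = λ g h → functional′ (old-or-new g) (old-or-new h)
              ; injective = λ g h → injective′ (old-or-new g) (old-or-new h)
              ; independent = independent-⊆ e (λ y → Rest y ⊎ y ≡ inj₂ x) {Remaining
                  (insert G (z , x))} remaining ind }
              where
              old-or-new : ∀ {p} → insert G (z , x) p ≡ true → G p ≡ true ⊎ p ≡ (z , x)
              old-or-new = insert⁻ G (z , x)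
              functional′ : ∀ {w x₁ x₂} → G (w , x₁) ≡ true ⊎ (w , x₁) ≡ (z , x) →
                            G (w , x₂) ≡ true ⊎ (w , x₂) ≡ (z , x) → x₁ ≡ x₂
              functional′ (inj₁ g) (inj₁ h) = functional φ g h
              functional′ (inj₁ g) (inj₂ ≡.refl) = ⊥-elim (z∉dom _ g)
              functional′ (inj₂ ≡.refl) (inj₁ h) = ⊥-elim (z∉dom _ h)
              functional′ (inj₂ ≡.refl) (inj₂ ≡.refl) = ≡.refl
              injective′ : ∀ {w₁ w₂ y} → G (w₁ , y) ≡ true ⊎ (w₁ , y) ≡ (z , x) →
                           G (w₂ , y) ≡ true ⊎ (w₂ , y) ≡ (z , x) → w₁ ≡ w₂
              injective′ (inj₁ g) (inj₁ h) = injective φ g h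
              injective′ (inj₁ g) (inj₂ ≡.refl) = ⊥-elim (x∉ran _ g)
              injective′ (inj₂ ≡.refl) (inj₁ h) = ⊥-elim (x∉ran _ h)
              injective′ (inj₂ ≡.refl) (inj₂ ≡.refl) = ≡.refl
              remaining : ∀ {y} → Remaining (insert G (z , x)) y → Rest y ⊎ y ≡ inj₂ x
              remaining (kept h) = inj₁ (kept (λ y g → h y (insert-old G _ _ g)) ,
                λ { ≡.refl → h x (insert-new G _) })
              remaining (used g) =
                [ (λ g′ → inj₁ (used g′ , λ ())) , (λ { ≡.refl → inj₂ ≡.refl }) ]′ (old-or-new g)

            rest-independent : IndependentOn e Rest
            rest-independent = independent-⊆ e (Remaining G) {Rest} proj₁ (independent φ)

            -- A basis element in the range of `G` belongs to `Rest`. Any other one could replace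
            -- `z` if it were independent of `Rest`, which `stuck` forbids.
            spanned : ∀ x → X (element x) → PureClosure e Rest (element x)
            spanned x x∈X = case em {P = Σ[ w ∈ S ] G (w , x) ≡ true} of λ
              { (yes (w , g)) → closure-e e (used g , λ ())
              ; (no x∉ran) → dependent⇒closure e rest-independent (inj₂ x) λ ind →
                  stuck (z , x) (¬-not (z∉dom x)) (extended x x∈X (λ w g → x∉ran (w , g)) ind) }

            absurd : ⊥
            absurd = not-in-closure e
              (independent-⊆ e (Remaining G) {λ y → Rest y ⊎ y ≡ inj₁ z} [ proj₁ ,
                  (λ { ≡.refl → kept z∉dom }) ]′ (independent φ))
              (λ p → proj₂ p)
              (let (s , s≉0 , sp) = basis-spans (v z) in closure-root e s≉0 (closure-trans spanned sp))

          total : ∀ z → Σ[ x ∈ Q ] G (z , x) ≡ true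
          total z = byContradiction λ none → absurd z λ x g → none (x , g)

          assignment : setoid S ≼ subsetoid ≈ᴹ-setoid X
          assignment = record
            { to = λ z → element (proj₁ (total z)) , within φ (proj₂ (total z))
            ; cong = λ { ≡.refl → ≈ᴹ-refl }
            ; injective = λ {z} {w} eq → injective φ (proj₂ (total z))
                (≡.subst (λ x → G (w , x) ≡ true) (≡.sym (element-injective eq)) (proj₂ (total w))) }

      independent⇒≼ : setoid S ≼ subsetoid ≈ᴹ-setoid X
      independent⇒≼ = assignment (proj₁ maximal-subset) (proj₁ (proj₂ maximal-subset))
          (proj₂ (proj₂ maximal-subset))

-- The ideal of null subsets of the index set.

module Null (classical : Classical) {ℓ} {R : CommutativeRing ℓ ℓ} (isValuationRing : IsValuationRing R)
  {I : Set ℓ} (A : I → RAlgebra R ℓ ℓ) (B : RAlgebra R ℓ ℓ)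
  (f : Hom (Π A) B) (f-surjective : IsSurjective f) where

  open Classical classical
  open Unary using (_⊆_; _∪_; ∁)
  open Choice classical
  open CommutativeRing R using (0#; 1#; _*_) renaming (Carrier to ∣R∣; _≈_ to _≈ᴿ_)
  open SemiringDivisibility (CommutativeRing.semiring R) using (_∣_; _,_)
  open ResidueField R isValuationRing using (𝔪)
  private
    module A k = RAlgebra (A k)
    module P = RAlgebra (Π A)
    module B = RAlgebra B
    module f = Hom f

  Supported : Pred I ℓ → P.Carrierᴹ → Set ℓ
  Supported J x = ∀ i → ¬ J i → A._≈ᴹ_ i (x i) (A.0ᴹ i)

  -- J is null iff f maps the subproduct over J into the total annihilator.
  Null : Pred I ℓ → Set ℓ
  Null J = ∀ a b → Supported J a → Supported J b → f.⟦ a P.∙ b ⟧ B.≈ᴹ B.0ᴹ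

  restrictBy : ∀ {J : Pred I ℓ} {i} → Dec (J i) → A.Carrierᴹ i → A.Carrierᴹ i
  restrictBy (yes _)     x = x
  restrictBy {i = i} (no _) x = A.0ᴹ i

  restrict : Pred I ℓ → P.Carrierᴹ → P.Carrierᴹ
  restrict J x i = restrictBy {J} em (x i)

  restrict-supported : ∀ J x → Supported J (restrict J x)
  restrict-supported J x i i∉J = helper em
    where
    helper : (d : Dec (J i)) → A._≈ᴹ_ i (restrictBy {J} d (x i)) (A.0ᴹ i)
    helper (yes i∈J) = ⊥-elim (i∉J i∈J)
    helper (no _)    = A.≈ᴹ-refl i

  restrict-∈ : ∀ J x i → J i → A._≈ᴹ_ i (restrict J x i) (x i)
  restrict-∈ J x i i∈J = helper em
    where
    helper : (d : Dec (J i)) → A._≈ᴹ_ i (restrictBy {J} d (x i)) (x i)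
    helper (yes _)  = A.≈ᴹ-refl i
    helper (no i∉J) = ⊥-elim (i∉J i∈J)

  by-cases : ∀ {p} (J : Pred I ℓ) {Q : Pred I p} → (∀ i → J i → Q i) → (∀ i → ¬ J i → Q i) → ∀ i → Q i
  by-cases J q q′ i = case em {P = J i} of λ { (yes i∈J) → q i i∈J ; (no i∉J) → q′ i i∉J }

  restrict-split : ∀ J x → x P.≈ᴹ restrict J x P.+ᴹ restrict (∁ J) x
  restrict-split J x = by-cases J
    (λ i i∈J → A.≈ᴹ-sym i (A.≈ᴹ-trans i
      (A.+ᴹ-cong i (restrict-∈ J x i i∈J) (restrict-supported (∁ J) x i (λ i∉J → i∉J i∈J)))
      (A.+ᴹ-identityʳ i _)))
    (λ i i∉J → A.≈ᴹ-sym i (A.≈ᴹ-trans i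
      (A.+ᴹ-cong i (restrict-supported J x i i∉J) (restrict-∈ (∁ J) x i i∉J))
      (A.+ᴹ-identityˡ i _)))

  module _ (J : Pred I ℓ) where
    private
      on : ∀ x i → J i → A._≈ᴹ_ i (restrict J x i) (x i)
      on = restrict-∈ J
      off : ∀ x i → ¬ J i → A._≈ᴹ_ i (restrict J x i) (A.0ᴹ i)
      off = restrict-supported J

    restrict-cong : ∀ {x y} → x P.≈ᴹ y → restrict J x P.≈ᴹ restrict J y
    restrict-cong {x} {y} x≈y = by-cases J
      (λ i ∈ → A.≈ᴹ-trans i (on x i ∈) (A.≈ᴹ-trans i (x≈y i) (A.≈ᴹ-sym i (on y i ∈))))
      (λ i ∉ → A.≈ᴹ-trans i (off x i ∉) (A.≈ᴹ-sym i (off y i ∉)))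

    restrict-+ : ∀ x y → restrict J (x P.+ᴹ y) P.≈ᴹ restrict J x P.+ᴹ restrict J y
    restrict-+ x y = by-cases J
      (λ i ∈ → A.≈ᴹ-trans i (on (x P.+ᴹ y) i ∈) (A.≈ᴹ-sym i (A.+ᴹ-cong i (on x i ∈) (on y i ∈))))
      (λ i ∉ → A.≈ᴹ-trans i (off (x P.+ᴹ y) i ∉) (A.≈ᴹ-sym i (A.≈ᴹ-trans i
        (A.+ᴹ-cong i (off x i ∉) (off y i ∉)) (A.+ᴹ-identityˡ i _))))

    restrict-*ₗ : ∀ r x → restrict J (r P.*ₗ x) P.≈ᴹ r P.*ₗ restrict J x
    restrict-*ₗ r x = by-cases J
      (λ i ∈ → A.≈ᴹ-trans i (on (r P.*ₗ x) i ∈) (A.≈ᴹ-sym i (A.*ₗ-congˡ i (on x i ∈))))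
      (λ i ∉ → A.≈ᴹ-trans i (off (r P.*ₗ x) i ∉) (A.≈ᴹ-sym i (A.≈ᴹ-trans i
        (A.*ₗ-congˡ i (off x i ∉)) (A.*ₗ-zeroʳ i r))))

    restrict-∙ : ∀ x y → restrict J (x P.∙ y) P.≈ᴹ restrict J x P.∙ restrict J y
    restrict-∙ x y = by-cases J
      (λ i ∈ → A.≈ᴹ-trans i (on (x P.∙ y) i ∈) (A.≈ᴹ-sym i (A.∙-cong i (on x i ∈) (on y i ∈))))
      (λ i ∉ → A.≈ᴹ-trans i (off (x P.∙ y) i ∉) (A.≈ᴹ-sym i (A.≈ᴹ-trans i
        (A.∙-cong i (off x i ∉) (A.≈ᴹ-refl i)) (A.∙-zeroˡ i _))))

  ∙-zero-cong : ∀ i {x x′ y y′} → A._≈ᴹ_ i x (A.0ᴹ i) → A._≈ᴹ_ i x′ (A.0ᴹ i) →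
                A._≈ᴹ_ i (A._∙_ i x y) (A._∙_ i x′ y′)
  ∙-zero-cong i x≈0 x′≈0 = A.≈ᴹ-trans i (A.∙-cong i x≈0 (A.≈ᴹ-refl i)) (A.≈ᴹ-trans i (A.∙-zeroˡ i _)
    (A.≈ᴹ-sym i (A.≈ᴹ-trans i (A.∙-cong i x′≈0 (A.≈ᴹ-refl i)) (A.∙-zeroˡ i _))))

  ∙-cong-zero : ∀ i {x x′ y y′} → A._≈ᴹ_ i y (A.0ᴹ i) → A._≈ᴹ_ i y′ (A.0ᴹ i) →
                A._≈ᴹ_ i (A._∙_ i x y) (A._∙_ i x′ y′)
  ∙-cong-zero i y≈0 y′≈0 = A.≈ᴹ-trans i (A.∙-cong i (A.≈ᴹ-refl i) y≈0) (A.≈ᴹ-trans i (A.∙-zeroʳ i _)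
    (A.≈ᴹ-sym i (A.≈ᴹ-trans i (A.∙-cong i (A.≈ᴹ-refl i) y′≈0) (A.∙-zeroʳ i _))))

  -- By surjectivity `y` is the image of some `z`. As `x` vanishes off `J`, replacing `z` by its
  -- restriction to `J` does not change either product.
  null⇒annihilated : ∀ {J x} → Null J → Supported J x → TotalAnnihilator B f.⟦ x ⟧
  null⇒annihilated {J} {x} null x-supp y = left , right
    where
    z = proj₁ (f-surjective y)
    fb≈y = proj₂ (f-surjective y) {z} (λ i → A.≈ᴹ-refl i)
    left : f.⟦ x ⟧ B.∙ y B.≈ᴹ B.0ᴹ
    left = B.≈ᴹ-trans (B.∙-cong B.≈ᴹ-refl (B.≈ᴹ-sym fb≈y)) (B.≈ᴹ-trans (B.≈ᴹ-sym (f.∙-homo x z))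
      (B.≈ᴹ-trans (f.⟦⟧-cong (by-cases J
        (λ i i∈J → A.∙-cong i (A.≈ᴹ-refl i) (A.≈ᴹ-sym i (restrict-∈ J z i i∈J)))
        (λ i i∉J → ∙-zero-cong i (x-supp i i∉J) (x-supp i i∉J))))
        (null x (restrict J z) x-supp (restrict-supported J z))))
    right : y B.∙ f.⟦ x ⟧ B.≈ᴹ B.0ᴹ
    right = B.≈ᴹ-trans (B.∙-cong (B.≈ᴹ-sym fb≈y) B.≈ᴹ-refl) (B.≈ᴹ-trans (B.≈ᴹ-sym (f.∙-homo z x))
      (B.≈ᴹ-trans (f.⟦⟧-cong (by-cases J
        (λ i i∈J → A.∙-cong i (A.≈ᴹ-sym i (restrict-∈ J z i i∈J)) (A.≈ᴹ-refl i))
        (λ i i∉J → ∙-cong-zero i (x-supp i i∉J) (x-supp i i∉J))))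
        (null (restrict J z) x (restrict-supported J z) x-supp)))

  f-∙-split : ∀ J a b → f.⟦ restrict J a P.∙ b ⟧ B.≈ᴹ B.0ᴹ → f.⟦ restrict (∁ J) a P.∙ b ⟧ B.≈ᴹ B.0ᴹ →
              f.⟦ a P.∙ b ⟧ B.≈ᴹ B.0ᴹ
  f-∙-split J a b p q = B.≈ᴹ-trans
    (f.⟦⟧-cong λ i → A.≈ᴹ-trans i (A.∙-cong i (restrict-split J a i) (A.≈ᴹ-refl i))
        (A.∙-distribʳ i (b i) _ _))
    (B.≈ᴹ-trans (f.+ᴹ-homo (restrict J a P.∙ b) (restrict (∁ J) a P.∙ b))
      (B.≈ᴹ-trans (B.+ᴹ-cong p q) (B.+ᴹ-identityˡ _)))

  null-∙ : ∀ {J} → Null J → ∀ a b → Supported J a → f.⟦ a P.∙ b ⟧ B.≈ᴹ B.0ᴹ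
  null-∙ null a b a-supp = B.≈ᴹ-trans (f.∙-homo a b) (proj₁ (null⇒annihilated null a-supp f.⟦ b ⟧))

  -- Splitting the left factor along `J` gives summands supported in `J` and in `K`; by `null-∙` the
  -- right factor may then be arbitrary.
  null-∪ : ∀ {J K L} → L ⊆ J ∪ K → Null J → Null K → Null L
  null-∪ {J} {K} {L} L⊆ null-J null-K a b a-supp b-supp = f-∙-split J a b
    (null-∙ null-J _ b (restrict-supported J a))
    (null-∙ null-K _ b λ i i∉K → by-cases J
      {λ i → ¬ K i → A._≈ᴹ_ i (restrict (∁ J) a i) (A.0ᴹ i)}
      (λ i i∈J _ → restrict-supported (∁ J) a i (λ i∉J → i∉J i∈J))
      (λ i i∉J i∉K → A.≈ᴹ-trans i (restrict-∈ (∁ J) a i i∉J)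
        (a-supp i λ i∈L → [ i∉J , i∉K ]′ (L⊆ i∈L))) i i∉K)

  null-⊆ : ∀ {J K} → J ⊆ K → Null K → Null J
  null-⊆ J⊆K null a b a-supp b-supp =
    null a b (λ i i∉K → a-supp i (i∉K ∘ J⊆K)) (λ i i∉K → b-supp i (i∉K ∘ J⊆K))

  null-empty : ∀ {J} → (∀ i → ¬ J i) → Null J
  null-empty empty a b a-supp b-supp = B.≈ᴹ-trans
    (f.⟦⟧-cong {y = P.0ᴹ} λ i → A.≈ᴹ-trans i (A.∙-cong i (a-supp i (empty i)) (A.≈ᴹ-refl i))
        (A.∙-zeroˡ i _))
    f.0ᴹ-homo

  null-⋃ : ∀ {m} (J : Fin m → Pred I ℓ) → (∀ k → Null (J k)) → ∀ {L} →
      (∀ {i} → L i → Σ[ k ∈ Fin m ] J k i) → Null L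
  null-⋃ {zero}  J null L⊆ = null-empty λ i i∈L → case L⊆ i∈L of λ { (() , _) }
  null-⋃ {suc m} J null {L} L⊆ = null-∪ {K = λ i → Σ[ k ∈ Fin m ] J (suc k) i}
    (λ i∈L → case L⊆ i∈L of λ { (zero , i∈J) → inj₁ i∈J ; (suc k , i∈J) → inj₂ (k , i∈J) })
    (null zero) (null-⋃ (J ∘ suc) (null ∘ suc) id)

  agree-mod-annihilator : ∀ {L} → Null L → ∀ x y → (∀ i → ¬ L i → A._≈ᴹ_ i (x i) (y i)) →
    TotalAnnihilator B (f.⟦ x ⟧ B.+ᴹ (B.-ᴹ f.⟦ y ⟧))
  agree-mod-annihilator {L} null x y agree z =
    B.≈ᴹ-trans (B.∙-cong (B.≈ᴹ-sym difference) B.≈ᴹ-refl) (proj₁ (annihilated z)) ,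
    B.≈ᴹ-trans (B.∙-cong B.≈ᴹ-refl (B.≈ᴹ-sym difference)) (proj₂ (annihilated z))
    where
    difference : f.⟦ x P.+ᴹ (P.-ᴹ y) ⟧ B.≈ᴹ f.⟦ x ⟧ B.+ᴹ (B.-ᴹ f.⟦ y ⟧)
    difference = B.≈ᴹ-trans (f.+ᴹ-homo x (P.-ᴹ y)) (B.+ᴹ-cong B.≈ᴹ-refl (f.-ᴹ-homo y))
    annihilated = null⇒annihilated {x = x P.+ᴹ (P.-ᴹ y)} null λ i i∉L →
      A.≈ᴹ-trans i (A.+ᴹ-cong i (agree i i∉L) (A.≈ᴹ-refl i)) (A.-ᴹ‿inverseʳ i (y i))

  infixr 7 _·_

  _·_ : (I → ∣R∣) → P.Carrierᴹ → P.Carrierᴹ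
  (u · a) i = A._*ₗ_ i (u i) (a i)

  *ₗ-∙-*ₗ : ∀ i r s x y → A._≈ᴹ_ i (A._∙_ i (A._*ₗ_ i r x) (A._*ₗ_ i s y))
      (A._*ₗ_ i (s * r) (A._∙_ i x y))
  *ₗ-∙-*ₗ i r s x y = A.≈ᴹ-trans i (A.*ₗ-∙-assocʳ i s _ y) (A.≈ᴹ-trans i
    (A.*ₗ-congˡ i (A.*ₗ-∙-assocˡ i r x y)) (A.≈ᴹ-sym i (A.*ₗ-assoc i s r _)))

  quotientBy : ∀ {x y} → Dec (x ∣ y) → ∣R∣
  quotientBy (yes (q , _)) = q
  quotientBy (no _)        = 0#

  quotientBy-∣ : ∀ {x y} (d : Dec (x ∣ y)) → x ∣ y → quotientBy d * x ≈ᴿ y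
  quotientBy-∣ (yes (_ , qx≈y)) _ = qx≈y
  quotientBy-∣ (no ∤) ∣ = ⊥-elim (∤ ∣)

  quotientBy-∤ : ∀ {x y} (d : Dec (x ∣ y)) → ¬ x ∣ y → quotientBy d ≈ᴿ 0#
  quotientBy-∤ (yes ∣) ∤ = ⊥-elim (∤ ∣)
  quotientBy-∤ (no _) _ = CommutativeRing.refl R

  -- Where u is a unit, a b = (u a)(u⁻¹ b).
  kernel-multiplier : ∀ {J} (u : I → ∣R∣) a b → f.⟦ u · a ⟧ B.≈ᴹ B.0ᴹ →
    Null (λ i → J i × 𝔪 (u i)) → Supported J a → Supported J b → f.⟦ a P.∙ b ⟧ B.≈ᴹ B.0ᴹ
  kernel-multiplier {J} u a b fua≈0 null a-supp b-supp = f-∙-split N a b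
    (null-∙ null _ b λ i ∉ → by-cases N
      {λ i → ¬ (J i × 𝔪 (u i)) → A._≈ᴹ_ i (restrict N a i) (A.0ᴹ i)}
      (λ i i∈N ∉ → A.≈ᴹ-trans i (restrict-∈ N a i i∈N) (a-supp i λ i∈J → ∉ (i∈J , i∈N)))
      (λ i i∉N _ → restrict-supported N a i i∉N) i ∉)
    (B.≈ᴹ-trans (f.⟦⟧-cong same) (B.≈ᴹ-trans (f.∙-homo (u · a) (v · b))
      (B.≈ᴹ-trans (B.∙-cong fua≈0 B.≈ᴹ-refl) (B.∙-zeroˡ _))))
    where
    N : Pred I ℓ
    N i = 𝔪 (u i)
    -- `v` inverts `u` where `u` is a unit. Elsewhere it is zero, in accordance with
    -- `restrict (∁ N) a`.
    v : I → ∣R∣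
    v i = quotientBy (em {P = u i ∣ 1#})
    same : restrict (∁ N) a P.∙ b P.≈ᴹ (u · a) P.∙ (v · b)
    same = by-cases N
      (λ i i∈N → A.≈ᴹ-trans i
        (A.≈ᴹ-trans i (A.∙-cong i (restrict-supported (∁ N) a i (λ i∉N → i∉N i∈N)) (A.≈ᴹ-refl i))
            (A.∙-zeroˡ i _))
        (A.≈ᴹ-sym i (A.≈ᴹ-trans i
          (A.∙-cong i (A.≈ᴹ-refl i) (A.≈ᴹ-trans i (A.*ₗ-congʳ i (quotientBy-∤ em i∈N))
              (A.*ₗ-zeroˡ i _)))
          (A.∙-zeroʳ i _))))
      (λ i i∉N → A.≈ᴹ-trans i (A.∙-cong i (restrict-∈ (∁ N) a i i∉N) (A.≈ᴹ-refl i))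
        (A.≈ᴹ-sym i (A.≈ᴹ-trans i (*ₗ-∙-*ₗ i (u i) (v i) (a i) (b i))
          (A.≈ᴹ-trans i (A.*ₗ-congʳ i (quotientBy-∣ em (byContradiction i∉N))) (A.*ₗ-identityˡ i _)))))

-- Sparse multipliers and the exclusion of infinite disjoint families of non-null sets.

module Ultraproducts (classical : Classical) {ℓ} {R : CommutativeRing ℓ ℓ}
    (isValuationRing : IsValuationRing R)
  {I : Set ℓ} (A : I → RAlgebra R ℓ ℓ) (B : RAlgebra R ℓ ℓ)
      (torsionFree : TorsionFree (RAlgebra.baseModule B))
  (f : Hom (Π A) B) (f-surjective : IsSurjective f)
  {X : Pred (RAlgebra.Carrierᴹ B) ℓ} (basis : IsMaximalLinearlyIndependent (RAlgebra.baseModule B) X)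
  {S : Set s} (S⋠X : ¬ (setoid S ≼ subsetoid (RAlgebra.≈ᴹ-setoid B) X))
  {T : Set t} (ι : ℕ → T) (ι-injective : Injective _≡_ _≡_ ι)
  (u : S → T → CommutativeRing.Carrier R)
  (u-good : Families.Good classical (residueField R isValuationRing) u) where

  open Classical classical
  open Unary using (_∈_; _⊆_; _∩_; ∁; ⋂)
  open Membership using () renaming (_∈_ to _∈ₗ_)
  open Choice classical
  open Sequences classical
  open Null classical isValuationRing A B f f-surjective public
  open IsValuationRing isValuationRing
  open ResidueField R isValuationRing using (𝔪; 𝔪-resp; 𝔪-0)
  open CommutativeRing R using (0#; 1#; _*_; _+_; _-_; -_; *-comm; zeroʳ; +-identityʳ; *-identityˡ)
    renaming (Carrier to ∣R∣; _≈_ to _≈ᴿ_; sym to ≈ᴿ-sym; trans to ≈ᴿ-trans)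
  open SemiringDivisibility (CommutativeRing.semiring R) using (_∣_; _,_; ∣-refl; ∣-trans)
  private
    module A k = RAlgebra (A k)
    module P = RAlgebra (Π A)
    module B = RAlgebra B
    module f = Hom f
    module Sumᴿ = CommutativeMonoidSum (CommutativeRing.+-commutativeMonoid R)
    module Sumᴮ = CommutativeMonoidSum B.+ᴹ-commutativeMonoid
  open Dimension classical {R = R} (λ {x} {y} → integral x y) 1≉0 B.baseModule using (module Exchange)

  sum-multiple : ∀ {m} (q : Fin m → ∣R∣) (w : Fin m → I → ∣R∣) x →
    Sumᴮ.sum (λ j → q j B.*ₗ f.⟦ w j · x ⟧) B.≈ᴹ f.⟦ (λ i → Sumᴿ.sum (λ j → q j * w j i)) · x ⟧
  sum-multiple {zero} q w x = B.≈ᴹ-sym (B.≈ᴹ-trans (f.⟦⟧-cong {y =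
    P.0ᴹ} λ i → A.*ₗ-zeroˡ i (x i)) f.0ᴹ-homo)
  sum-multiple {suc m} q w x = B.≈ᴹ-sym (B.≈ᴹ-trans
    (f.⟦⟧-cong {y = (q zero P.*ₗ (w zero · x)) P.+ᴹ
        ((λ i → Sumᴿ.sum (λ j → q (suc j) * w (suc j) i)) · x)}
      λ i → A.≈ᴹ-trans i (A.*ₗ-distribʳ i (x i) _ _) (A.+ᴹ-cong i (A.*ₗ-assoc i _ _ _) (A.≈ᴹ-refl i)))
    (B.≈ᴹ-trans (f.+ᴹ-homo _ _) (B.+ᴹ-cong (f.*ₗ-homo (q zero) (w zero · x))
      (B.≈ᴹ-sym (sum-multiple (q ∘ suc) (w ∘ suc) x)))))

  sum-scale : ∀ {m} s (r q : Fin m → ∣R∣) (y : Fin m → B.Carrierᴹ) → (∀ j → q j * s ≈ᴿ r j) →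
    s B.*ₗ Sumᴮ.sum (λ j → q j B.*ₗ y j) B.≈ᴹ Sumᴮ.sum (λ j → r j B.*ₗ y j)
  sum-scale {zero}  s r q y eq = B.*ₗ-zeroʳ s
  sum-scale {suc m} s r q y eq = B.≈ᴹ-trans (B.*ₗ-distribˡ s _ _) (B.+ᴹ-cong
    (B.≈ᴹ-trans (B.≈ᴹ-sym (B.*ₗ-assoc s (q zero) (y zero)))
        (B.*ₗ-congʳ (≈ᴿ-trans (*-comm s (q zero)) (eq zero))))
    (sum-scale s (r ∘ suc) (q ∘ suc) (y ∘ suc) (eq ∘ suc)))

  least-divisor : ∀ {m} (r : Fin (suc m) → ∣R∣) → Σ[ k ∈ Fin (suc m) ] ∀ j → r k ∣ r j
  least-divisor {zero}  r = zero , λ { zero → ∣-refl }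
  least-divisor {suc m} r = let (k , k∣) = least-divisor (r ∘ suc) in
    [ (λ ∣k → zero , λ { zero → ∣-refl ; (suc j) → ∣-trans ∣k (k∣ j) })
    , (λ k∣₀ → suc k , λ { zero → k∣₀ ; (suc j) → k∣ j }) ]′ (∣-total (r zero) (r (suc k)))

  -- Since divisibility is total, one coefficient divides all the others. It is nonzero, as
  -- otherwise all would vanish, and dividing by it turns it into 1, which is nonzero modulo 𝔪.
  primitive-multiple : ∀ {m} (r : Fin m → ∣R∣) → ¬ (∀ j → r j ≈ᴿ 0#) →
    Σ[ s ∈ ∣R∣ ] ¬ s ≈ᴿ 0# × (Σ[ q ∈ (Fin m → ∣R∣) ] (∀ j → q j * s ≈ᴿ r j) ×
        (Σ[ k ∈ Fin m ] q k ≈ᴿ 1#))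
  primitive-multiple {zero}  r r≉0 = ⊥-elim (r≉0 λ ())
  primitive-multiple {suc m} r r≉0 = r k , s≉0 , q , qs , k ,
    [ x-y≈0⇒x≈y _ _ , (λ s≈0 → ⊥-elim (s≉0 s≈0)) ]′ (integral (q k - 1#) (r k) q-1)
    where
    open AbelianGroupProperties (CommutativeRing.+-abelianGroup R) using ()
      renaming (x∙y⁻¹≈ε⇒x≈y to x-y≈0⇒x≈y; x≈y⇒x∙y⁻¹≈ε to x≈y⇒x-y≈0)
    open RingProperties (CommutativeRing.ring R) using ([y-z]x≈yx-zx)
    k = proj₁ (least-divisor r)
    cofactor : ∀ {x y} → x ∣ y → Σ[ z ∈ ∣R∣ ] z * x ≈ᴿ y
    cofactor (z , zx≈y) = z , zx≈y
    q : Fin (suc m) → ∣R∣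
    q j = proj₁ (cofactor (proj₂ (least-divisor r) j))
    qs : ∀ j → q j * r k ≈ᴿ r j
    qs j = proj₂ (cofactor (proj₂ (least-divisor r) j))
    s≉0 : ¬ r k ≈ᴿ 0#
    s≉0 s≈0 = r≉0 λ j → ≈ᴿ-trans (≈ᴿ-sym (qs j)) (≈ᴿ-trans (CommutativeRing.*-congˡ R s≈0) (zeroʳ _))
    q-1 : (q k - 1#) * r k ≈ᴿ 0#
    q-1 = ≈ᴿ-trans ([y-z]x≈yx-zx (r k) (q k) 1#)
        (x≈y⇒x-y≈0 (≈ᴿ-trans (qs k) (≈ᴿ-sym (*-identityˡ (r k)))))

  -- The images of the functions u s (λ i) are too many to be independent, and a relation
  -- between them, made primitive, is nonzero modulo 𝔪.
  sparse-multiplier : (class : I → T) (x : P.Carrierᴹ) →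
    Σ[ w ∈ (T → ∣R∣) ] f.⟦ (w ∘ class) · x ⟧ B.≈ᴹ B.0ᴹ ×
      (∀ (τ : ℕ → T) → Injective _≡_ _≡_ τ → ∃[ n ] ¬ 𝔪 (w (τ n)))
  sparse-multiplier class x = byContradiction λ none →
    S⋠X (Exchange.independent⇒≼ basis v λ m σ σ-inj r eq → byContradiction λ r≉0 →
      none (multiplier m σ σ-inj r eq r≉0))
    where
    v : S → B.Carrierᴹ
    v z = f.⟦ (u z ∘ class) · x ⟧
    multiplier : ∀ m (σ : Fin m → S) → Injective _≡_ _≡_ σ → ∀ (r : Fin m → ∣R∣) →
      Sumᴮ.sum (λ j → r j B.*ₗ v (σ j)) B.≈ᴹ B.0ᴹ → ¬ (∀ j → r j ≈ᴿ 0#) → _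
    multiplier m σ σ-inj r eq r≉0 =
      let (s , s≉0 , q , qs , k , q≈1) = primitive-multiple r r≉0
          combined = B.≈ᴹ-trans (sum-scale s r q (v ∘ σ) qs) eq
      in (λ z → Sumᴿ.sum (λ j → q j * u (σ j) z)) ,
         B.≈ᴹ-trans (B.≈ᴹ-sym (sum-multiple q (λ j → u (σ j) ∘ class) x))
           ([ (λ s≈0 → ⊥-elim (s≉0 s≈0)) , id ]′ (torsionFree s _ combined)) ,
         λ τ τ-inj → let (n , ≉0) = Families.good-nonvanishing classical (residueField R isValuationRing)
                           u u-good σ σ-inj q (λ q≈0 →
                               1∉𝔪 (𝔪-resp (≈ᴿ-trans (x-0≈x (q k)) q≈1) (q≈0 k))) τ τ-inj
                     in n , λ ∈𝔪 → ≉0 (𝔪-resp (≈ᴿ-sym (x-0≈x _)) ∈𝔪)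
      where
      open AbelianGroupProperties (CommutativeRing.+-abelianGroup R) using () renaming (ε⁻¹≈ε to -0≈0)
      x-0≈x : ∀ y → y - 0# ≈ᴿ y
      x-0≈x y = ≈ᴿ-trans (CommutativeRing.+-congˡ R -0≈0) (+-identityʳ y)
      1∉𝔪 : ¬ 𝔪 1#
      1∉𝔪 ∈𝔪 = ∈𝔪 ∣-refl

  glueBy : ∀ {N : Set a} {K : N → Pred I ℓ} → (N → P.Carrierᴹ) → ∀ {i} → Dec (Σ[ n ∈ N ] K n i) →
      A.Carrierᴹ i
  glueBy x {i} (yes (n , _)) = x n i
  glueBy x {i} (no _)        = A.0ᴹ i

  glue : ∀ {N : Set a} (K : N → Pred I ℓ) → (N → P.Carrierᴹ) → P.Carrierᴹ
  glue {N = N} K x i = glueBy {N = N} {K} x em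

  Disjoint : {N : Set a} → (N → Pred I ℓ) → Set _
  Disjoint K = ∀ {m n i} → K m i → K n i → m ≡ n

  glue-∈ : ∀ {N : Set a} (K : N → Pred I ℓ) → Disjoint K → ∀ x n {i} → K n i →
      A._≈ᴹ_ i (glue K x i) (x n i)
  glue-∈ {N = N} K disjoint x n {i} i∈K = helper em
    where
    helper : (d : Dec (Σ[ n ∈ N ] K n i)) → A._≈ᴹ_ i (glueBy {N = N} {K} x d) (x n i)
    helper (yes (m , i∈Km)) with disjoint i∈Km i∈K
    ... | ≡.refl = A.≈ᴹ-refl i
    helper (no ∉) = ⊥-elim (∉ (n , i∈K))

  glue-∉ : ∀ {N : Set a} (K : N → Pred I ℓ) x {i} → (∀ n → ¬ K n i) → A._≈ᴹ_ i (glue K x i) (A.0ᴹ i)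
  glue-∉ {N = N} K x {i} i∉K = helper em
    where
    helper : (d : Dec (Σ[ n ∈ N ] K n i)) → A._≈ᴹ_ i (glueBy {N = N} {K} x d) (A.0ᴹ i)
    helper (yes (m , i∈K)) = ⊥-elim (i∉K m i∈K)
    helper (no _) = A.≈ᴹ-refl i

  -- Witnesses `a`, `b` against nullity are taken on each set, and the `a` are glued to one element
  -- `x`. A multiplier `w` killing `x` is nonzero at some `ι n`; multiplying by the corresponding
  -- `b` isolates `w (ι n)` times `f (a b)`, contradicting torsion-freeness.
  no-infinite-disjoint-family : (D : ℕ → Pred I ℓ) → Disjoint D → (∀ n → ¬ Null (D n)) → ⊥
  no-infinite-disjoint-family D disjoint positive =
    let (w , kills , sparse) = sparse-multiplier class x
        (n , w∉𝔪) = sparse ι ι-injective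
    in contradictory w kills n w∉𝔪
    where
    Witness : ℕ → Set ℓ
    Witness n = Σ[ a ∈ P.Carrierᴹ ] Σ[ b ∈ P.Carrierᴹ ] Supported (D n) a × Supported (D n) b ×
                ¬ f.⟦ a P.∙ b ⟧ B.≈ᴹ B.0ᴹ
    witness : ∀ n → Witness n
    witness n = byContradiction λ none → positive n λ a b a-supp b-supp →
      byContradiction λ ab≉0 → none (a , b , a-supp , b-supp , ab≉0)
    x = glue D (proj₁ ∘ witness)
    class : I → T
    -- The default label outside all `D n` is harmless: the product is taken with some `b` supported
    -- in a single `D n`.
    class i = labelBy (ι 0) ι (em {P = Σ[ n ∈ ℕ ] D n i})
    contradictory : ∀ w → f.⟦ (w ∘ class) · x ⟧ B.≈ᴹ B.0ᴹ → ∀ n → ¬ 𝔪 (w (ι n)) → ⊥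
    contradictory w kills n w∉𝔪 =
      let (a , b , a-supp , b-supp , ab≉0) = witness n
          scaled : ((w ∘ class) · x) P.∙ b P.≈ᴹ w (ι n) P.*ₗ (a P.∙ b)
          scaled = by-cases (D n)
            (λ i i∈D →
              let (m , i∈Dm , class≡) = labelBy-yes {c₀ = ι 0} {label = ι}
                    (em {P = Σ[ n ∈ ℕ ] D n i}) (n , i∈D) in
              A.≈ᴹ-trans i (A.∙-cong i (A.*ₗ-cong i (CommutativeRing.reflexive R
                  (≡.cong w (≡.trans class≡ (≡.cong ι (disjoint i∈Dm i∈D)))))
                  (glue-∈ D disjoint (proj₁ ∘ witness) n i∈D)) (A.≈ᴹ-refl i))
                (A.*ₗ-∙-assocˡ i _ _ _))
            (λ i i∉D → A.≈ᴹ-trans i (∙-cong-zero i {x′ = A.0ᴹ i} {y′ =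
              b i} (b-supp i i∉D) (b-supp i i∉D))
              (A.≈ᴹ-trans i (A.∙-zeroˡ i _) (A.≈ᴹ-sym i (A.≈ᴹ-trans i (A.*ₗ-congˡ i
                (A.≈ᴹ-trans i (A.∙-cong i (A.≈ᴹ-refl i) (b-supp i i∉D)) (A.∙-zeroʳ i _)))
                    (A.*ₗ-zeroʳ i _)))))
          zero-product = B.≈ᴹ-trans (B.≈ᴹ-sym (f.*ₗ-homo (w (ι n)) (a P.∙ b))) (B.≈ᴹ-trans
            (f.⟦⟧-cong (λ i → A.≈ᴹ-sym i (scaled i))) (B.≈ᴹ-trans (f.∙-homo ((w ∘ class) · x) b)
            (B.≈ᴹ-trans (B.∙-cong kills B.≈ᴹ-refl) (B.∙-zeroˡ _))))
      in [ (λ w≈0 → w∉𝔪 (𝔪-resp (≈ᴿ-sym w≈0) 𝔪-0)) , ab≉0 ]′ (torsionFree (w (ι n)) _ zero-product)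

  -- Decomposition of the index set into finitely many atoms and a null set.

  Atom : Pred I ℓ → Set _
  Atom J = ¬ Null J × (∀ (K : Pred I ℓ) → Null (J ∩ K) ⊎ Null (J ∩ ∁ K))

  data Finitary (J : Pred I ℓ) : Set (Level.suc ℓ) where
    null  : Null J → Finitary J
    atom  : Atom J → Finitary J
    split : (K : Pred I ℓ) → Finitary (J ∩ K) → Finitary (J ∩ ∁ K) → Finitary J

  private
    record SplitOff (J : Pred I ℓ) : Set (Level.suc ℓ) where
      field
        piece rest : Pred I ℓ
        piece⊆     : piece ⊆ J
        rest⊆      : rest ⊆ J
        apart      : ∀ {i} → piece i → ¬ rest i
        positive   : ¬ Null piece
        infinitary : ¬ Finitary rest
    open SplitOff

    -- A non-finitary set is not an atom, so some `K` cuts it into two non-null halves. The halves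
    -- cannot both be finitary; one that is not becomes the rest, and the other is the piece.
    -- Iteration gives infinitely many disjoint non-null pieces.
    split-off : ∀ J → ¬ Finitary J → SplitOff J
    split-off J ¬finitary = byContradiction λ none →
      ¬finitary (atom (¬finitary ∘ null , λ K → byContradiction λ neither →
        ¬finitary (split K
          (byContradiction λ ¬finitary₁ → none (record
            { piece = J ∩ ∁ K ; rest = J ∩ K ; piece⊆ = proj₁ ; rest⊆ = proj₁
            ; apart = λ (_ , ∉) (_ , ∈) → ∉ ∈ ; positive = neither ∘ inj₂ ; infinitary = ¬finitary₁ }))
          (byContradiction λ ¬finitary₂ → none (record
            { piece = J ∩ K ; rest = J ∩ ∁ K ; piece⊆ = proj₁ ; rest⊆ = proj₁
            ; apart = λ (_ , ∈) (_ , ∉) → ∉ ∈ ; positive = neither ∘ inj₁ ; infinitary =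
              ¬finitary₂ })))))

    module _ (J : Pred I ℓ) (¬finitary : ¬ Finitary J) where
      stage : ℕ → Σ[ K ∈ Pred I ℓ ] ¬ Finitary K
      step : ∀ n → SplitOff (proj₁ (stage n))
      stage zero    = J , ¬finitary
      stage (suc n) = rest (step n) , infinitary (step n)
      step n = split-off (proj₁ (stage n)) (proj₂ (stage n))

      shrink : ∀ {m} k {i} → proj₁ (stage (k ℕ.+ m)) i → proj₁ (stage m) i
      shrink zero        ∈ = ∈
      shrink {m} (suc k) ∈ = shrink k (rest⊆ (step (k ℕ.+ m)) ∈)

      pieces-apart : ∀ {m n i} → m ℕ.< n → piece (step m) i → ¬ piece (step n) i
      pieces-apart {m} {n} {i} m<n ∈m ∈n = apart (step m) ∈m
        (shrink (n ℕ.∸ suc m) (≡.subst (λ n → proj₁ (stage n) i) (≡.sym (ℕₚ.m∸n+n≡m m<n))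
          (piece⊆ (step n) ∈n)))

      pieces-disjoint : Disjoint (piece ∘ step)
      pieces-disjoint {m} {n} ∈m ∈n = case ℕₚ.<-cmp m n of λ
        { (tri< m<n _ _) → ⊥-elim (pieces-apart m<n ∈m ∈n)
        ; (tri≈ _ m≡n _) → m≡n
        ; (tri> _ _ n<m) → ⊥-elim (pieces-apart n<m ∈n ∈m) }

  finitary : ∀ J → Finitary J
  finitary J = byContradiction λ ¬finitary →
    no-infinite-disjoint-family (piece ∘ step J ¬finitary) (pieces-disjoint J ¬finitary)
      (positive ∘ step J ¬finitary)

  record Decomposition (J : Pred I ℓ) : Set (Level.suc ℓ) where
    field
      size     : ℕ
      part     : Fin size → Pred I ℓ
      part⊆    : ∀ k → part k ⊆ J
      disjoint : Disjoint part
      atomic   : ∀ k → Atom (part k)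
      leftover : Null (λ i → J i × ∀ k → ¬ part k i)

  decompose : ∀ {J} → Finitary J → Decomposition J
  decompose (null J-null) = record
    { size = 0 ; part = λ () ; part⊆ = λ () ; disjoint = λ { {()} } ; atomic = λ ()
    ; leftover = null-⊆ proj₁ J-null }
  decompose {J} (atom J-atom) = record
    { size = 1 ; part = λ _ → J ; part⊆ = λ _ → id ; disjoint = λ { {zero} {zero} _ _ → ≡.refl }
    ; atomic = λ _ → J-atom ; leftover = null-empty λ i (i∈J , i∉J) → i∉J zero i∈J }
  decompose {J} (split K l r) = record
    { size     = L.size ℕ.+ M.size
    ; part     = parts ∘ splitAt L.size
    ; part⊆    = λ k → parts⊆ (splitAt L.size k)
    ; disjoint = λ {m} {n} ∈m ∈n → ≡.trans (≡.sym (Finₚ.join-splitAt L.size M.size m)) (≡.trans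
        (≡.cong (join L.size M.size) (parts-disjoint (splitAt L.size m) (splitAt L.size n) ∈m ∈n))
        (Finₚ.join-splitAt L.size M.size n))
    ; atomic   = λ k → parts-atomic (splitAt L.size k)
    ; leftover = null-∪ (λ {i} (i∈J , i∉) → case em {P = K i} of λ
        { (yes i∈K) → inj₁ ((i∈J , i∈K) , λ k ∈part → i∉ (join L.size M.size (inj₁ k))
            (≡.subst (λ s → parts s i) (≡.sym (Finₚ.splitAt-join L.size M.size (inj₁ k))) ∈part))
        ; (no i∉K) → inj₂ ((i∈J , i∉K) , λ k ∈part → i∉ (join L.size M.size (inj₂ k))
            (≡.subst (λ s → parts s i) (≡.sym (Finₚ.splitAt-join L.size M.size (inj₂ k))) ∈part)) })
        L.leftover M.leftover }
    where
    module L = Decomposition (decompose {J ∩ K} l)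
    module M = Decomposition (decompose {J ∩ ∁ K} r)
    parts : Fin L.size ⊎ Fin M.size → Pred I ℓ
    parts = [ L.part , M.part ]′
    parts⊆ : ∀ k → parts k ⊆ J
    parts⊆ (inj₁ k) = proj₁ ∘ L.part⊆ k
    parts⊆ (inj₂ k) = proj₁ ∘ M.part⊆ k
    parts-disjoint : ∀ m n {i} → parts m i → parts n i → m ≡ n
    parts-disjoint (inj₁ m) (inj₁ n) ∈m ∈n = ≡.cong inj₁ (L.disjoint ∈m ∈n)
    parts-disjoint (inj₁ m) (inj₂ n) ∈m ∈n = ⊥-elim (proj₂ (M.part⊆ n ∈n) (proj₂ (L.part⊆ m ∈m)))
    parts-disjoint (inj₂ m) (inj₁ n) ∈m ∈n = ⊥-elim (proj₂ (M.part⊆ m ∈m) (proj₂ (L.part⊆ n ∈n)))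
    parts-disjoint (inj₂ m) (inj₂ n) ∈m ∈n = ≡.cong inj₂ (M.disjoint ∈m ∈n)
    parts-atomic : ∀ k → Atom (parts k)
    parts-atomic (inj₁ k) = L.atomic k
    parts-atomic (inj₂ k) = M.atomic k

  -- The filter dual to the ideal of null sets, relative to `J`. It is proper when `J` is not null,
  -- and the dichotomy of an atom makes it maximal.
  conull : Pred I ℓ → Filter I
  conull J = record
    { members = λ X → Null (J ∩ ∁ X)
    ; full    = null-empty λ i (_ , ∉U) → ∉U _
    ; ∩-mem   = λ {X} {Y} → null-∪ λ {i} (i∈J , ∉) → case em {P = X i} of λ
        { (yes i∈X) → inj₂ (i∈J , λ i∈Y → ∉ (i∈X , i∈Y)) ; (no i∉X) → inj₁ (i∈J , i∉X) }
    ; ⊆-mem   = λ X⊆Y → null-⊆ λ (i∈J , i∉Y) → i∈J , i∉Y ∘ X⊆Y }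

  conull-ultrafilter : ∀ {J} → Atom J → IsUltrafilter (conull J)
  conull-ultrafilter {J} (positive , dichotomy) = record
    { proper  = λ ∅∈ → positive (null-⊆ (λ i∈J → i∈J , λ ()) ∅∈)
    ; maximal = λ G proper U⊆G {X} X∈G → [
        (λ J∩X-null → ⊥-elim (proper (Filter.⊆-mem G (λ (∈ , ∉) → ⊥-elim (∉ ∈)) (Filter.∩-mem G X∈G
          (U⊆G {∁ X} (null-⊆ (λ (i∈J , ∉) → i∈J , byContradiction ∉) J∩X-null)))))) , id ]′
              (dichotomy X) }

  -- A point of `J` outside the intersection is labelled by a member of the family which it misses,
  -- so each fibre of the labelling is null. A sparse multiplier has nonunit values at finitely many
  -- labels only, hence over a null set, and `kernel-multiplier` finishes.
  conull-complete : ∀ {κ : Setoid a b} → κ ≼ setoid T → ∀ J → SuccComplete κ (conull J)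
  conull-complete κ≼T J N N≼κ Y Y∈ = λ x y x-supp y-supp →
    let (w , kills , sparse) = sparse-multiplier class x in
    kernel-multiplier (w ∘ class) x y kills (small w sparse) x-supp y-supp
    where
    κ-label : N → T
    κ-label = Injection.to κ≼T ∘ Injection.to N≼κ
    κ-label-injective : Injective _≡_ _≡_ κ-label
    κ-label-injective = Injection.injective N≼κ ∘ Injection.injective κ≼T
    Missing : I → Pred N _
    Missing i j = ¬ Y j i
    class : I → T
    class i = labelBy (ι 0) κ-label (em {P = Σ[ j ∈ N ] Missing i j})
    J₁ : Pred I ℓ
    J₁ = J ∩ ∁ (⋂ N Y)
    missing : ∀ {i} → J₁ i → Σ[ j ∈ N ] Missing i j × class i ≡ κ-label j
    missing {i} (_ , ∉) =
      let (j , missed , eq) = labelBy-yes {c₀ = ι 0} {label = κ-label} (em {P = Σ[ j ∈ N ] Missing i j})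
            (byContradiction λ none → ∉ λ j → byContradiction λ i∉Y → none (j , i∉Y))
      in j , missed , eq
    -- Equality in `T` may live at another level; `χ` turns it into a predicate at the level of `I`.
    fibre-null : ∀ t → Null (λ i → J₁ i × χ (class i ≡ t) ≡ true)
    fibre-null t = case em {P = Σ[ i ∈ I ] J₁ i × class i ≡ t} of λ
      { (no none) → null-empty λ i (i∈ , eq) → none (i , i∈ , χ⁻ eq)
      ; (yes (i , i∈J₁ , eq)) → let (j , _ , eqⱼ) = missing i∈J₁ in
          null-⊆ (λ {i′} (i′∈J₁ , eq′) → let (j′ , missed , eqⱼ′) = missing i′∈J₁ in
            proj₁ i′∈J₁ , ≡.subst (Missing i′) (κ-label-injective
              (≡.trans (≡.sym eqⱼ′) (≡.trans (χ⁻ eq′) (≡.trans (≡.sym eq) eqⱼ)))) missed) (Y∈ j) }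
    fibres-null : ∀ l → Null (λ i → J₁ i × χ (class i ∈ₗ l) ≡ true)
    fibres-null []      = null-empty λ i (_ , ∈[]) → case χ⁻ ∈[] of λ ()
    fibres-null (t ∷ l) = null-∪ (λ (i∈ , ∈t∷l) → case χ⁻ ∈t∷l of λ
      { (here eq) → inj₁ (i∈ , χ⁺ eq) ; (there ∈l) → inj₂ (i∈ , χ⁺ ∈l) })
      (fibre-null t) (fibres-null l)
    small : ∀ w → (∀ (τ : ℕ → T) → Injective _≡_ _≡_ τ → ∃[ n ] ¬ 𝔪 (w (τ n))) →
        Null (λ i → J₁ i × 𝔪 (w (class i)))
    small w sparse = byContradiction λ positive →
      -- If the set were not null, no finite list could contain all labels with value in 𝔪, and an
      -- injective sequence of such labels would contradict sparseness.
      let (τ , τ-inj , τ∈) = injective-sequence (𝔪 ∘ w) λ l → byContradiction λ none →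
            positive (null-⊆ (λ {i} (i∈J₁ , ∈𝔪) → i∈J₁ ,
                χ⁺ (byContradiction λ ∉l → none (class i , ∈𝔪 , ∉l))) (fibres-null l))
          (n , ∉𝔪) = sparse τ τ-inj
      in ∉𝔪 (τ∈ n)

  -- The factorization through finitely many ultraproducts.

  whole : Decomposition U
  whole = decompose (finitary U)
  open Decomposition whole

  outside-null : Null (λ i → ∀ k → ¬ part k i)
  outside-null = null-⊆ (λ i∉ → _ , i∉) leftover

  by-part : ∀ {p} {Q : Pred I p} → (∀ k i → part k i → Q i) → (∀ i → (∀ k → ¬ part k i) → Q i) → ∀ i →
      Q i
  by-part q q′ i = case em {P = Σ[ k ∈ Fin size ] part k i} of λ
    { (yes (k , i∈)) → q k i i∈ ; (no i∉) → q′ i λ k i∈ → i∉ (k , i∈) }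

  private
    open Congruence (annihilatorCongruence B) using () renaming (≈⇒∼ to ≈⇒∼ᶻ)

    inside : ∀ x k {i} → part k i → A._≈ᴹ_ i (glue part x i) (x k i)
    inside = glue-∈ part disjoint

    outside : ∀ x {i} → (∀ k → ¬ part k i) → A._≈ᴹ_ i (glue part x i) (A.0ᴹ i)
    outside = glue-∉ part

    glue-cong : ∀ {x y} → (∀ k → Null (part k ∩ ∁ λ i → A._≈ᴹ_ i (x k i) (y k i))) →
                TotalAnnihilator B (f.⟦ glue part x ⟧ B.+ᴹ (B.-ᴹ f.⟦ glue part y ⟧))
    glue-cong {x} {y} x∼y = agree-mod-annihilator {L = Disagree} (null-⋃ _ x∼y id) (glue part x)
        (glue part y)
      (by-part {Q = λ i → ¬ Disagree i → A._≈ᴹ_ i (glue part x i) (glue part y i)}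
        (λ k i i∈ i∉ → A.≈ᴹ-trans i (inside x k i∈) (A.≈ᴹ-trans i
          (byContradiction λ x≉y → i∉ (k , i∈ , x≉y)) (A.≈ᴹ-sym i (inside y k i∈))))
        (λ i i∉ _ → A.≈ᴹ-trans i (outside x i∉) (A.≈ᴹ-sym i (outside y i∉))))
      where
      Disagree : Pred I ℓ
      Disagree i = Σ[ k ∈ Fin size ] part k i × ¬ A._≈ᴹ_ i (x k i) (y k i)

    glue-+ : ∀ x y → glue part (λ k → x k P.+ᴹ y k) P.≈ᴹ glue part x P.+ᴹ glue part y
    glue-+ x y = by-part
      (λ k i i∈ → A.≈ᴹ-trans i (inside (λ k → x k P.+ᴹ y k) k i∈)
        (A.≈ᴹ-sym i (A.+ᴹ-cong i (inside x k i∈) (inside y k i∈))))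
      (λ i i∉ → A.≈ᴹ-trans i (outside (λ k → x k P.+ᴹ y k) i∉) (A.≈ᴹ-sym i (A.≈ᴹ-trans i
        (A.+ᴹ-cong i (outside x i∉) (outside y i∉)) (A.+ᴹ-identityˡ i _))))

    glue-*ₗ : ∀ r x → glue part (λ k → r P.*ₗ x k) P.≈ᴹ r P.*ₗ glue part x
    glue-*ₗ r x = by-part
      (λ k i i∈ → A.≈ᴹ-trans i (inside (λ k → r P.*ₗ x k) k i∈)
          (A.≈ᴹ-sym i (A.*ₗ-congˡ i (inside x k i∈))))
      (λ i i∉ → A.≈ᴹ-trans i (outside (λ k → r P.*ₗ x k) i∉) (A.≈ᴹ-sym i (A.≈ᴹ-trans i
        (A.*ₗ-congˡ i (outside x i∉)) (A.*ₗ-zeroʳ i r))))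

    glue-∙ : ∀ x y → glue part (λ k → x k P.∙ y k) P.≈ᴹ glue part x P.∙ glue part y
    glue-∙ x y = by-part
      (λ k i i∈ → A.≈ᴹ-trans i (inside (λ k → x k P.∙ y k) k i∈)
        (A.≈ᴹ-sym i (A.∙-cong i (inside x k i∈) (inside y k i∈))))
      (λ i i∉ → A.≈ᴹ-trans i (outside (λ k → x k P.∙ y k) i∉) (A.≈ᴹ-sym i (A.≈ᴹ-trans i
        (A.∙-cong i (outside x i∉) (A.≈ᴹ-refl i)) (A.∙-zeroˡ i _))))

  -- Representatives are cut down to their parts and glued. Other representatives change the result
  -- on a null set only, which `f` maps into the total annihilator.
  factor : Hom (Π (λ k → reducedProduct A (conull (part k)))) (B /Z)
  factor = mkHom (λ x → f.⟦ glue part x ⟧)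
    (λ {x} {y} → glue-cong {x} {y})
    (λ x y → ≈⇒∼ᶻ (B.≈ᴹ-trans (f.⟦⟧-cong (glue-+ x y)) (f.+ᴹ-homo (glue part x) (glue part y))))
    (λ r x → ≈⇒∼ᶻ (B.≈ᴹ-trans (f.⟦⟧-cong (glue-*ₗ r x)) (f.*ₗ-homo r (glue part x))))
    (λ x y → ≈⇒∼ᶻ (B.≈ᴹ-trans (f.⟦⟧-cong (glue-∙ x y)) (f.∙-homo (glue part x) (glue part y))))

  factorsThroughUltraproducts : {κ : Setoid a b} → κ ≼ setoid T →
                                FactorsThroughUltraproducts f (SuccComplete κ)
  factorsThroughUltraproducts κ≼T =
    size , (λ k → conull (part k)) ,
    (λ k → conull-ultrafilter (atomic k) , conull-complete κ≼T (part k)) ,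
    factor ,
    λ x → agree-mod-annihilator outside-null x (glue part (λ _ → x)) (by-part
      {Q = λ i → ¬ (∀ k → ¬ part k i) → A._≈ᴹ_ i (x i) (glue part (λ _ → x) i)}
      (λ k i i∈ _ → A.≈ᴹ-sym i (inside (λ _ → x) k i∈))
      (λ i i∉ ∉ → ⊥-elim (∉ i∉)))

  -- Principal ultrafilters and the splitting over a finite subproduct.

  module Principals (principal : ∀ k → Principal (conull (part k))) where

    point : Fin size → I
    point k = proj₁ (principal k)

    others-null : ∀ k → Null (part k ∩ ∁ (point k ≡_))
    others-null k = Equivalence.from (proj₂ (principal k) (point k ≡_)) ≡.refl

    point∈part : ∀ k → part k (point k)
    point∈part k = Equivalence.to (proj₂ (principal k) (part k)) (null-empty λ i (∈ , ∉) → ∉ ∈)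

    point-injective : Injective _≡_ _≡_ point
    point-injective {j} {k} eq = disjoint (point∈part j) (≡.subst (part k) (≡.sym eq) (point∈part k))

    Off : Pred I ℓ
    Off i = ∀ k → ¬ point k ≡ i

    -- Each part agrees with its point up to a null set, and there are finitely many parts; what
    -- lies outside all parts is null as well.
    off-null : Null Off
    off-null = null-∪ (λ {i} off → case em {P = Σ[ k ∈ Fin size ] part k i} of λ
        { (yes (k , i∈)) → inj₂ (k , i∈ , off k) ; (no i∉) → inj₁ λ k i∈ → i∉ (k , i∈) })
      outside-null (null-⋃ (λ k → part k ∩ ∁ (point k ≡_)) others-null id)

    by-point : ∀ {p} {Q : Pred I p} → (∀ k → Q (point k)) → (∀ i → Off i → Q i) → ∀ i → Q i
    by-point q q′ i = case em {P = Σ[ k ∈ Fin size ] point k ≡ i} of λ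
      { (yes (k , ≡.refl)) → q k ; (no off) → q′ i λ k eq → off (k , eq) }

    private module Q = RAlgebra (Π (A ∘ point))

    extendBy : Q.Carrierᴹ → ∀ {i} → Dec (Σ[ k ∈ Fin size ] point k ≡ i) → A.Carrierᴹ i
    extendBy y (yes (k , ≡.refl)) = y k
    extendBy y {i} (no _)         = A.0ᴹ i

    extend : Q.Carrierᴹ → P.Carrierᴹ
    extend y i = extendBy y em

    extend-point : ∀ y k → A._≈ᴹ_ (point k) (extend y (point k)) (y k)
    extend-point y k = helper k ≡.refl em
      where
      -- The index found by `em` equals `k` by injectivity of `point`. Once `j` is `k`, the equation
      -- between points is reflexivity by axiom K.
      same : ∀ j → j ≡ k → (eq : point j ≡ point k) → A._≈ᴹ_ (point k) (extendBy y (yes (j , eq))) (y k)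
      same j ≡.refl ≡.refl = A.≈ᴹ-refl (point k)
      helper : ∀ j → j ≡ k → (d : Dec (Σ[ j ∈ Fin size ] point j ≡ point k)) →
          A._≈ᴹ_ (point k) (extendBy y d) (y k)
      helper _ _ (yes (j , eq)) = same j (point-injective eq) eq
      helper j j≡k (no off) = ⊥-elim (off (j , ≡.cong point j≡k))

    extend-off : ∀ y {i} → Off i → A._≈ᴹ_ i (extend y i) (A.0ᴹ i)
    extend-off y {i} off = helper em
      where
      helper : (d : Dec (Σ[ k ∈ Fin size ] point k ≡ i)) → A._≈ᴹ_ i (extendBy y d) (A.0ᴹ i)
      helper (yes (k , eq)) = ⊥-elim (off k eq)
      helper (no _)         = A.≈ᴹ-refl i

    extend-cong : ∀ {x y} → x Q.≈ᴹ y → extend x P.≈ᴹ extend y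
    extend-cong {x} {y} x≈y = by-point
      (λ k → A.≈ᴹ-trans (point k) (extend-point x k)
        (A.≈ᴹ-trans (point k) (x≈y k) (A.≈ᴹ-sym (point k) (extend-point y k))))
      (λ i off → A.≈ᴹ-trans i (extend-off x off) (A.≈ᴹ-sym i (extend-off y off)))

    extend-+ : ∀ x y → extend (x Q.+ᴹ y) P.≈ᴹ extend x P.+ᴹ extend y
    extend-+ x y = by-point
      (λ k → A.≈ᴹ-trans (point k) (extend-point (x Q.+ᴹ y) k)
        (A.≈ᴹ-sym (point k) (A.+ᴹ-cong (point k) (extend-point x k) (extend-point y k))))
      (λ i off → A.≈ᴹ-trans i (extend-off (x Q.+ᴹ y) off) (A.≈ᴹ-sym i (A.≈ᴹ-trans i
        (A.+ᴹ-cong i (extend-off x off) (extend-off y off)) (A.+ᴹ-identityˡ i _))))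

    extend-*ₗ : ∀ r x → extend (r Q.*ₗ x) P.≈ᴹ r P.*ₗ extend x
    extend-*ₗ r x = by-point
      (λ k → A.≈ᴹ-trans (point k) (extend-point (r Q.*ₗ x) k)
        (A.≈ᴹ-sym (point k) (A.*ₗ-congˡ (point k) (extend-point x k))))
      (λ i off → A.≈ᴹ-trans i (extend-off (r Q.*ₗ x) off) (A.≈ᴹ-sym i (A.≈ᴹ-trans i
        (A.*ₗ-congˡ i (extend-off x off)) (A.*ₗ-zeroʳ i r))))

    extend-∙ : ∀ x y → extend (x Q.∙ y) P.≈ᴹ extend x P.∙ extend y
    extend-∙ x y = by-point
      (λ k → A.≈ᴹ-trans (point k) (extend-point (x Q.∙ y) k)
        (A.≈ᴹ-sym (point k) (A.∙-cong (point k) (extend-point x k) (extend-point y k))))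
      (λ i off → A.≈ᴹ-trans i (extend-off (x Q.∙ y) off) (A.≈ᴹ-sym i (A.≈ᴹ-trans i
        (A.∙-cong i (extend-off x off) (A.≈ᴹ-refl i)) (A.∙-zeroˡ i _))))

    fromPoints : Hom (Π (A ∘ point)) B
    fromPoints = mkHom (λ y → f.⟦ extend y ⟧)
      (λ {x} {y} x≈y → f.⟦⟧-cong (extend-cong {x} {y} x≈y))
      (λ x y → B.≈ᴹ-trans (f.⟦⟧-cong (extend-+ x y)) (f.+ᴹ-homo (extend x) (extend y)))
      (λ r x → B.≈ᴹ-trans (f.⟦⟧-cong (extend-*ₗ r x)) (f.*ₗ-homo r (extend x)))
      (λ x y → B.≈ᴹ-trans (f.⟦⟧-cong (extend-∙ x y)) (f.∙-homo (extend x) (extend y)))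

    offPoints : Hom (Π A) (Z B)
    offPoints = mkHom (λ x → f.⟦ restrict Off x ⟧ , null⇒annihilated off-null
        (restrict-supported Off x))
      (λ {x} {y} x≈y → f.⟦⟧-cong (restrict-cong Off {x} {y} x≈y))
      (λ x y → B.≈ᴹ-trans (f.⟦⟧-cong (restrict-+ Off x y))
          (f.+ᴹ-homo (restrict Off x) (restrict Off y)))
      (λ r x → B.≈ᴹ-trans (f.⟦⟧-cong (restrict-*ₗ Off r x)) (f.*ₗ-homo r (restrict Off x)))
      (λ x y → B.≈ᴹ-trans (f.⟦⟧-cong (restrict-∙ Off x y)) (f.∙-homo (restrict Off x) (restrict Off y)))

    split-points : ∀ x → x P.≈ᴹ extend (x ∘ point) P.+ᴹ restrict Off x
    split-points x = by-point
      (λ k → A.≈ᴹ-sym (point k) (A.≈ᴹ-trans (point k)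
        (A.+ᴹ-cong (point k) (extend-point (x ∘ point) k)
          (restrict-supported Off x (point k) λ off → off k ≡.refl))
        (A.+ᴹ-identityʳ (point k) _)))
      (λ i off → A.≈ᴹ-sym i (A.≈ᴹ-trans i
        (A.+ᴹ-cong i (extend-off (x ∘ point) off) (restrict-∈ Off x i off)) (A.+ᴹ-identityˡ i _)))

    -- `f₁` is `f` applied to the coordinates at the points, extended by zero; `f₀` is `f` applied
    -- to the remaining coordinates, whose support is null.
    splitsOverFiniteSubproduct : SplitsOverFiniteSubproduct f
    splitsOverFiniteSubproduct =
      size , point , point-injective ,
      (mod-Z B ∘ₕ fromPoints , λ x → agree-mod-annihilator off-null x (extend (x ∘ point)) (by-point
        {Q = λ i → ¬ Off i → A._≈ᴹ_ i (x i) (extend (x ∘ point) i)}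
        (λ k _ → A.≈ᴹ-sym (point k) (extend-point (x ∘ point) k))
        (λ i off ¬off → ⊥-elim (¬off off)))) ,
      fromPoints ∘ₕ project point , offPoints ,
      (fromPoints , λ x → B.≈ᴹ-refl) ,
      λ x → B.≈ᴹ-trans (f.⟦⟧-cong (split-points x)) (f.+ᴹ-homo (extend (x ∘ point)) (restrict Off x))

-- Measurable cardinals obtained from nonprincipal ultrafilters.

module NonprincipalUltrafilter (classical : Classical) {ℓ} {I : Set ℓ} {F : Filter I}
  (ultra : IsUltrafilter F) (nonprincipal : ¬ Principal F) where

  open Classical classical
  open Unary using (_∈_; _∉_; _∪_; ∁; ⋂)
  open Choice classical
  open Filter F
  open IsUltrafilter ultra

  dichotomy : (X : Pred I ℓ) → X ∈ members ⊎ ∁ X ∈ members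
  dichotomy X = case em {P = X ∈ members} of λ
    { (yes X∈F) → inj₁ X∈F
    ; (no X∉F) → inj₂ (maximal G (λ ∅∈G → X∉F (⊆-mem [ (λ ()) , id ]′ ∅∈G)) (⊆-mem inj₁)
        (⊆-mem (λ {i} _ → case em {P = X i} of λ
          { (yes i∈X) → inj₂ i∈X ; (no i∉X) → inj₁ i∉X }) full)) }
    where
    -- This is the filter generated by the given one together with the complement of `X`; it is
    -- proper exactly because `X` is not a member.
    G : Filter I
    G = record
      { members = λ Y → (Y ∪ X) ∈ members
      ; full    = ⊆-mem inj₁ full
      ; ∩-mem   = λ p q → ⊆-mem (λ { (inj₁ y , inj₁ y′) → inj₁ (y , y′) ; (inj₂ x , _) →
          inj₂ x ; (_ , inj₂ x) → inj₂ x }) (∩-mem p q)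
      ; ⊆-mem   = λ Y⊆Y′ → ⊆-mem [ inj₁ ∘ Y⊆Y′ , inj₂ ]′ }

  singleton∉ : ∀ i → (i ≡_) ∉ members
  singleton∉ i i∈F = nonprincipal (i , λ J → mk⇔
    (λ J∈F → byContradiction λ i∉J →
        proper (⊆-mem (λ { (≡.refl , i∈J) → ⊥-elim (i∉J i∈J) }) (∩-mem i∈F J∈F)))
    (λ i∈J → ⊆-mem (λ { ≡.refl → i∈J }) i∈F))

  ⋂-Fin : ∀ {n} (Y : Fin n → Pred I ℓ) → (∀ k → Y k ∈ members) → (λ i → ∀ k → Y k i) ∈ members
  ⋂-Fin {zero}  Y Y∈ = ⊆-mem (λ _ ()) full
  ⋂-Fin {suc n} Y Y∈ = ⊆-mem (λ { (y₀ , y) zero → y₀ ; (y₀ , y) (suc k) → y k })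
    (∩-mem (Y∈ zero) (⋂-Fin (Y ∘ suc) (Y∈ ∘ suc)))

  Incomplete : Set ℓ → Set _
  Incomplete J = Σ[ Y ∈ (J → Pred I ℓ) ] (∀ j → Y j ∈ members) × ⋂ J Y ∉ members

  -- Cardinals up to that of `I` are represented by subsets of `I`. Coding these by `Bool` makes
  -- membership proofs irrelevant.
  Sub : (I → Bool) → Set ℓ
  Sub P = Σ[ i ∈ I ] P i ≡ true

  Sub-≡ : ∀ {P} {u v : Sub P} → proj₁ u ≡ proj₁ v → u ≡ v
  Sub-≡ {u = i , p} {v = _ , q} ≡.refl = ≡.cong (i ,_) (uip p q)

  Sub≼ : ∀ P → setoid (Sub P) ≼ setoid I
  Sub≼ P = mk↣ Sub-≡

  -- The complements of points are members, by nonprincipality, and have empty intersection.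
  I-incomplete : Incomplete (Sub (λ _ → true))
  I-incomplete = (λ (i , _) → ∁ (i ≡_)) ,
      (λ (i , _) → [ ⊥-elim ∘ singleton∉ i , id ]′ (dichotomy (i ≡_))) ,
    λ ⋂∈F → proper (⊆-mem (λ {i} h → ⊥-elim (h (i , ≡.refl) ≡.refl)) ⋂∈F)

  least-incomplete : Σ[ P ∈ Σ (I → Bool) (Incomplete ∘ Sub) ]
    ∀ P′ → setoid (Sub (proj₁ P)) ≼ setoid (Sub (proj₁ P′))
  least-incomplete = smallest (Sub ∘ proj₁) ((λ _ → true) , I-incomplete)

  M : Set ℓ
  M = Sub (proj₁ (proj₁ least-incomplete))

  M≼I : setoid M ≼ setoid I
  M≼I = Sub≼ _

  M-incomplete : Incomplete M
  M-incomplete = proj₂ (proj₁ least-incomplete)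

  -- `M` is least among subsets of `I`, so `J` is first replaced by its image in `I`.
  incomplete⇒M≼ : ∀ {J} → Incomplete J → setoid J ≼ setoid I → setoid M ≼ setoid J
  incomplete⇒M≼ {J} (Y , Y∈ , ⋂∉) J≼I =
    ≼-trans (proj₂ least-incomplete (image , image-incomplete)) image≼J
    where
    φ = Injection.to J≼I
    image : I → Bool
    image i = χ (Σ[ j ∈ J ] φ j ≡ i)
    preimage : Sub image → J
    preimage (i , i∈) = proj₁ (χ⁻ i∈)
    φ-preimage : ∀ s → φ (preimage s) ≡ proj₁ s
    φ-preimage (i , i∈) = proj₂ (χ⁻ i∈)
    image≼J : setoid (Sub image) ≼ setoid J
    image≼J = mk↣ {to = preimage} λ {u} {v} eq →
      Sub-≡ (≡.trans (≡.sym (φ-preimage u)) (≡.trans (≡.cong φ eq) (φ-preimage v)))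
    image-incomplete : Incomplete (Sub image)
    image-incomplete = Y ∘ preimage , Y∈ ∘ preimage , λ ⋂∈ → ⋂∉ (⊆-mem (λ {i} h j →
      ≡.subst (λ j → Y j i) (Injection.injective J≼I (φ-preimage (φ j , χ⁺ (j , ≡.refl))))
        (h (φ j , χ⁺ (j , ≡.refl)))) ⋂∈)

  private
    Y = proj₁ M-incomplete
    Y∈ = proj₁ (proj₂ M-incomplete)
    ⋂∉ = proj₂ (proj₂ M-incomplete)

  M-inhabited : M
  M-inhabited = byContradiction λ empty → ⋂∉ (⊆-mem (λ _ m → ⊥-elim (empty m)) full)

  -- A point outside the intersection of the `Y m` is sent to some `m` with the point outside `Y m`.
  -- The default elsewhere is immaterial, since the intersection is not a member.
  drop : I → M
  drop i = labelBy M-inhabited id (em {P = Σ[ m ∈ M ] ¬ Y m i})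

  drop-∉ : ∀ {i} → ¬ ⋂ M Y i → ¬ Y (drop i) i
  drop-∉ {i} i∉ =
    let (m , i∉Y , eq) = labelBy-yes {c₀ = M-inhabited} {label = id} (em {P = Σ[ m ∈ M ] ¬ Y m i})
          (byContradiction λ none → i∉ λ m → byContradiction λ i∉Y → none (m , i∉Y))
    in ≡.subst (λ m → ¬ Y m i) (≡.sym eq) i∉Y

  pushforward : Filter M
  pushforward = record
    { members = λ Z → (Z ∘ drop) ∈ members
    ; full    = ⊆-mem _ full
    ; ∩-mem   = ∩-mem
    ; ⊆-mem   = λ Z⊆Z′ → ⊆-mem Z⊆Z′ }

  -- `M` is infinite because filters are closed under finite intersections. Outside the intersection
  -- of all `Y m`, the fibre of `drop` over `m` misses the member `Y m`, so no point generates the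
  -- pushforward. Completeness is the minimality of `M`.
  measurable : Measurable M
  measurable = record
    { infinite      = λ (n , bij) → let (from , from-to) = inverse bij in
        ⋂∉ (⊆-mem (λ {i} h m → ≡.subst (λ m → Y m i) (from-to m) (h (Bijection.to bij m)))
          (⋂-Fin (Y ∘ from) (Y∈ ∘ from)))
    ; filter        = pushforward
    ; isUltrafilter = record
      { proper  = proper ∘ ⊆-mem (λ ())
      ; maximal = λ G G-proper V⊆G {Z} Z∈G → [ id , (λ ∁Z∈ → ⊥-elim (G-proper
          (Filter.⊆-mem G (λ (∈ , ∉) → ⊥-elim (∉ ∈)) (Filter.∩-mem G Z∈G (V⊆G {∁ Z} ∁Z∈))))) ]′
              (dichotomy (Z ∘ drop)) }
    ; nonprincipal  = λ (m , principal) → proper (⊆-mem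
        (λ { {i} (≡.refl , i∈Y , i∉) → ⊥-elim (drop-∉ i∉ i∈Y) })
        (∩-mem (Equivalence.from (principal (m ≡_)) ≡.refl)
          (∩-mem (Y∈ m) ([ ⊥-elim ∘ ⋂∉ , id ]′ (dichotomy (⋂ M Y))))))
    ; complete      = λ J (J≼M , M⋠J) Z Z∈ → byContradiction λ ∉F →
        M⋠J (incomplete⇒M≼ ((λ j → Z j ∘ drop) , Z∈ , ∉F) (≼-trans J≼M M≼I)) }
    where
    inverse : ∀ {n} (bij : Bijection (setoid M) (setoid (Fin n))) →
              Σ[ from ∈ (Fin n → M) ] ∀ m → from (Bijection.to bij m) ≡ m
    inverse bij = proj₁ ∘ Bijection.surjective bij ,
      λ m → Bijection.injective bij (proj₂ (Bijection.surjective bij (Bijection.to bij m)) ≡.refl)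

  -- `M ≼ κ` would contradict incompleteness at `M`, so comparability leaves only the strict
  -- inequality. The set `T` stands in for `κ`, since `≼-total` compares sets.
  large : {κ : Setoid a b} {T : Set t} → κ ≼ setoid T → setoid T ≼ κ → SuccComplete κ F → κ ≺ setoid M
  large {T = T} κ≼T T≼κ complete =
    [ ≼-trans κ≼T , (λ M≼T → ⊥-elim (M⋠κ (≼-trans M≼T T≼κ))) ]′ (≼-total T M) , M⋠κ
    where
    M⋠κ = λ M≼κ → ⋂∉ (complete M M≼κ Y Y∈)

module _ (classical : Classical) where
  open Choice classical

  -- Otherwise there would be a measurable `M` above `κ` that injects into `I`, against the assumed
  -- bound on `I`.
  small⇒principal : ∀ {ℓ} {I : Set ℓ} {κ : Setoid a b} {T : Set t} → κ ≼ setoid T → setoid T ≼ κ →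
    (∀ (M : Set ℓ) → Measurable M → κ ≺ setoid M → setoid I ≺ setoid M) →
    (F : Filter I) → IsUltrafilter F → SuccComplete κ F → Principal F
  small⇒principal κ≼T T≼κ small F ultra complete = byContradiction λ nonprincipal →
    let open NonprincipalUltrafilter classical ultra nonprincipal in
    proj₂ (small M measurable (large κ≼T T≼κ complete)) M≼I

-- The residue field and the two cases on the rank.

module ResidueClasses (classical : Classical) {ℓ} (R : CommutativeRing ℓ ℓ)
    (isValuationRing : IsValuationRing R)
  (k-infinite : Infinite (CommutativeRing.setoid (residueField R isValuationRing))) where

  open Choice classical
  open CommutativeRing R
  open ResidueField R isValuationRing using (𝔪-resp; ≈⇒∼; _∼_)
  open SemiringDivisibility semiring using (_,_; ∣-refl)
  open AbelianGroupProperties +-abelianGroup using () renaming (ε⁻¹≈ε to -0≈0)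

  private
    x-0≈x : ∀ x → x - 0# ≈ x
    x-0≈x x = trans (+-congˡ -0≈0) (+-identityʳ x)

  residue-inverse : ∀ {x} → ¬ x ∼ 0# → Σ[ y ∈ Carrier ] x * y ∼ 1#
  residue-inverse {x} x≁0 = case byContradiction (λ x∤1 → x≁0 (𝔪-resp (sym (x-0≈x x)) x∤1)) of λ
    { (y , yx≈1) → y , ≈⇒∼ (trans (*-comm x y) yx≈1) }

  1≁0 : ¬ 1# ∼ 0#
  1≁0 1-0∈𝔪 = 𝔪-resp (x-0≈x 1#) 1-0∈𝔪 ∣-refl

  open Families classical (residueField R isValuationRing) public
  open OverInfiniteField residue-inverse 1≁0 k-infinite public

theorem9 : Classical →
    ∀ {ℓ} (R : CommutativeRing ℓ ℓ) (isValuationRing : IsValuationRing R) →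
    let k = CommutativeRing.setoid (residueField R isValuationRing) in
    Infinite k →
    (I : Set ℓ) (A : I → RAlgebra R ℓ ℓ) (B : RAlgebra R ℓ ℓ) →
    TorsionFree (RAlgebra.baseModule B) →
    (f : Hom (Π A) B) → IsSurjective f →
    (rk : Setoid ℓ ℓ) → HasRank (RAlgebra.baseModule B) rk →
    (rk ≺ k →
    FactorsThroughUltraproducts f (SuccComplete k) ×
    ((∀ (M : Set ℓ) → Measurable M → k ≺ setoid M → setoid I ≺ setoid M) →
    SplitsOverFiniteSubproduct f)) ×
    (rk ≺ 2^ℵ₀ →
    FactorsThroughUltraproducts f CountablyComplete ×
    ((∀ (M : Set ℓ) → Measurable M → ℵ₀ ≺ setoid M → setoid I ≺ setoid M) →
    SplitsOverFiniteSubproduct f))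
theorem9 classical {ℓ} R isValuationRing k-infinite I A B torsionFree f f-surjective rk (X , basis ,
    X≅rk) =
  residueCase , continuumCase
  where
  open Choice classical
  open Sequences classical
  open ResidueClasses classical R isValuationRing k-infinite
  k = CommutativeRing.setoid (residueField R isValuationRing)

  X≼rk : subsetoid (RAlgebra.≈ᴹ-setoid B) X ≼ rk
  X≼rk = Bijection.injection X≅rk

  residueCase : rk ≺ k → FactorsThroughUltraproducts f (SuccComplete k) ×
    ((∀ (M : Set ℓ) → Measurable M → k ≺ setoid M → setoid I ≺ setoid M) → SplitsOverFiniteSubproduct f)
  residueCase (_ , k⋠rk) =
    factorsThroughUltraproducts ≼-quotient ,
    λ small → Principals.splitsOverFiniteSubproduct λ j →
        small⇒principal classical ≼-quotient quotient-≼ small _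
      (conull-ultrafilter (Decomposition.atomic whole j)) (conull-complete ≼-quotient _)
    where
    open Quotient k using (≼-quotient; quotient-≼; Q)
    ι = injective-sequence (λ (_ : Q) → ⊤) λ l →
          let (x , x∉l) = fresh-element Q-infinite l in x , tt , x∉l
    -- Both index sets are the residue classes. An injection of them into the basis would embed `k`
    -- in `rk`.
    open Ultraproducts classical isValuationRing A B torsionFree f f-surjective basis
      {S = Q} (λ Q≼X → k⋠rk (≼-trans ≼-quotient (≼-trans Q≼X X≼rk)))
      (proj₁ ι) (proj₁ (proj₂ ι)) cauchyFamily cauchyFamily-good

  continuumCase : rk ≺ 2^ℵ₀ → FactorsThroughUltraproducts f CountablyComplete ×
    ((∀ (M : Set ℓ) → Measurable M → ℵ₀ ≺ setoid M → setoid I ≺ setoid M) →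
        SplitsOverFiniteSubproduct f)
  continuumCase (_ , 2^ℵ₀⋠rk) =
    factorsThroughUltraproducts ℕ≼ℕ ,
    λ small → Principals.splitsOverFiniteSubproduct λ j → small⇒principal classical ℕ≼ℕ ℕ≼ℕ small _
      (conull-ultrafilter (Decomposition.atomic whole j)) (conull-complete ℕ≼ℕ _)
    where
    open Quotient 2^ℵ₀ using (≼-quotient; Q; element; element-injective)
    ℕ≼ℕ : ℵ₀ ≼ setoid ℕ
    ℕ≼ℕ = Identity.injection ℵ₀
    open Ultraproducts classical isValuationRing A B torsionFree f f-surjective basis
      -- The family is indexed by binary sequences up to pointwise equality, which are too many for
      -- the basis, and evaluated at the levels of the tree.
      {S = Q} (λ Q≼X → 2^ℵ₀⋠rk (≼-trans ≼-quotient (≼-trans Q≼X X≼rk)))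
      {T = ℕ} id id (branchFamily element element-injective)
          (branchFamily-good element element-injective)
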